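{- Let $b\ge 1$, let $\vec p=(p_1,\dots,p_b)$ with $p_i>0$ and $\sum_{i=1}^b p_i=1$, and let $\epsilon^+>0$, $\epsilon^*,\epsilon^-\ge 0$ with $\max\{\epsilon^+,\epsilon^*,\epsilon^-\}<1/8$; all of these are fixed constants. Let $n\to\infty$ through positive integers for which every $p_in$ is an integer, and let $u=u(n)$ be integers with $n/u\to 0$. For each such $n$ let $m=m(n)$ be such that there is a data structure with $m$-bit strings that $(\epsilon^+,\epsilon^*,\epsilon^-)$-encodes all $\vec p$-maps with $n$ keys from a universe of size $u$. Then the number of bits used per key satisfies $$\frac{m}{n}\ \ge\ (1-\epsilon^-)\log\frac{1}{\epsilon^+}+(1-\epsilon^--\epsilon^*)H(\vec p)-H(\epsilon^-,\epsilon^*,1-\epsilon^--\epsilon^*)+o(1)\qquad(n\to\infty).$$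
   Context: All logarithms are base two; for a probability vector $\vec q=(q_1,\dots,q_r)$, $H(\vec q)=-\sum_i q_i\log q_i$ with $0\log 0=0$. Let $U$ be a universe of size $u$ and $V=\{v_1,\dots,v_b\}$ a set of $b$ values, with $\bot\notin V$. A $\vec p$-map $M$ with $n$ keys is a set $\{(x,v(x)) : x\in X\}$ where $X\subseteq U$, $|X|=n$, $v:X\to V$, and $X_i=\{x\in X: v(x)=v_i\}$ satisfies $|X_i|=p_in$ for each $i\in[b]=\{1,\dots,b\}$. A data structure with $m$-bit strings is a fixed rule assigning to every $s\in\{0,1\}^m$ a function $s:U\to V\cup\{\bot\}$ (the answers to queries). For a string $s$ and a $\vec p$-map $M$ with key set $X$ define $$f^+(s)=\frac{|\{x\in U\setminus X: s(x)\ne\bot\}|}{|U\setminus X|},\quad f_i^*(s)=\frac{|\{x\in X_i: s(x)\in V\setminus\{v_i\}\}|}{|X_i|},\quad f_i^-(s)=\frac{|\{x\in X_i: s(x)=\bot\}|}{|X_i|}.$$ The string $s$ $(\epsilon^+,\epsilon^*,\epsilon^-)$-encodes $M$ if $f^+(s)\le\epsilon^+$ and, for all $i\in[b]$, $f_i^*(s)\le\epsilon^*$ and $f_i^-(s)\le\epsilon^-$. The data structure $(\epsilon^+,\epsilon^*,\epsilon^-)$-encodes all $\vec p$-maps if for every $\vec p$-map $M$ with $n$ keys from $U$ there is $s\in\{0,1\}^m$ that $(\epsilon^+,\epsilon^*,\epsilon^-)$-encodes $M$. -}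

module Defs where

open import Axiom.ExcludedMiddle using (ExcludedMiddle)
open import Data.Bool.Base using (Bool)
open import Data.Fin.Base using (Fin)
import Data.Fin.Properties as Fin
open import Data.Integer.Base as ℤ using (ℤ; +_; -[1+_])
import Data.Integer.Properties as ℤ
open import Data.Maybe.Base using (Maybe; just; nothing)
open import Data.Maybe.Properties using (≡-dec)
open import Data.Maybe.Relation.Unary.Any using (Any; dec)
open import Data.Nat.Base as ℕ using (ℕ; zero; suc)
import Data.Nat.Properties as ℕ
open import Data.Product.Base using (Σ-syntax; ∃-syntax; _×_; _,_; proj₁; proj₂)
open import Data.Rational.Base as ℚ using (ℚ; 0ℚ; 1ℚ; ½; _/_)
import Data.Rational.Properties as ℚ
open import Data.Rational.Unnormalised.Base as ℚᵘ using (mkℚᵘ)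
import Data.Rational.Unnormalised.Properties as ℚᵘ
open import Data.Sum.Base using (_⊎_; inj₁; inj₂; [_,_]′)
open import Data.Vec.Base using (Vec; allFin; count)
open import Data.Vec.Functional using (foldr)
open import Algebra.Definitions.RawSemiring ℚ.+-*-rawSemiring using (_^_)
open import Function.Base using (flip)
open import Level using (0ℓ)
open import Relation.Binary.PropositionalEquality
open import Relation.Nullary using (¬_; yes; no; ¬?; contradiction)
open import Relation.Nullary.Decidable using (_×-dec_)
open import Relation.Unary using (Pred; Decidable)

-- A real number x is the Dedekind cut { q ∈ ℚ | q < x }: a non-empty,
-- bounded, downward closed set of rationals without a greatest element.
-- One-sided cuts are the real numbers only in the presence of excluded
-- middle: without it they need not be located.

record ℝ : Set₁ where
  field
    lower     : Pred ℚ 0ℓ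
    inhabited : ∃[ q ] lower q
    bounded   : ∃[ q ] ¬ lower q
    closed    : ∀ {q r} → q ℚ.< r → lower r → lower q
    rounded   : ∀ {q} → lower q → ∃[ r ] q ℚ.< r × lower r

infix 4 _∈_ _∉_ _≤_ _<_ _≃_

-- q ∈ x means q < x, and q ∉ x means x ≤ q.

_∈_ : ℚ → ℝ → Set
q ∈ x = ℝ.lower x q

_∉_ : ℚ → ℝ → Set
q ∉ x = ¬ q ∈ x

_≤_ : ℝ → ℝ → Set
x ≤ y = ∀ q → q ∈ x → q ∈ y

_<_ : ℝ → ℝ → Set
x < y = ∃[ q ] q ∈ y × q ∉ x

_≃_ : ℝ → ℝ → Set
x ≃ y = x ≤ y × y ≤ x

private
  ≤⇒≯ : ∀ {q r} → q ℚ.≤ r → ¬ r ℚ.< q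
  ≤⇒≯ q≤r r<q = ℚ.<-irrefl refl (ℚ.≤-<-trans q≤r r<q)

  ∈∉⇒< : ∀ x {q r} → q ∈ x → r ∉ x → q ℚ.< r
  ∈∉⇒< x {q} {r} q∈x r∉x with q ℚ.<? r
  ... | yes q<r = q<r
  ... | no  q≮r =
        let s , q<s , s∈x = ℝ.rounded x q∈x
        in contradiction (ℝ.closed x (ℚ.≤-<-trans (ℚ.≮⇒≥ q≮r) q<s) s∈x) r∉x

  below : ∀ q → ∃[ r ] r ℚ.< q
  below q = q ℚ.- 1ℚ ,
    subst (q ℚ.- 1ℚ ℚ.<_) (ℚ.+-identityʳ q)
      (ℚ.+-monoʳ-< q (ℚ.negative⁻¹ (ℚ.- 1ℚ)))

fromℚ : ℚ → ℝ
fromℚ r = record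
  { lower     = λ q → q ℚ.< r
  ; inhabited = below r
  ; bounded   = r , ℚ.<-irrefl refl
  ; closed    = ℚ.<-trans
  ; rounded   = λ q<r → let s , q<s , s<r = ℚ.<-dense q<r in s , q<s , s<r
  }

fromℕ : ℕ → ℝ
fromℕ n = fromℚ (+ n / 1)

0ℝ 1ℝ : ℝ
0ℝ = fromℕ 0
1ℝ = fromℕ 1

infixl 6 _+_ _-_ _⊔_
infixl 7 _*_
infix  8 -_

_⊔_ : ℝ → ℝ → ℝ
x ⊔ y = record
  { lower     = λ q → q ∈ x ⊎ q ∈ y
  ; inhabited = let q , q∈x = ℝ.inhabited x in q , inj₁ q∈x
  ; bounded   = bound (ℝ.bounded x) (ℝ.bounded y)
  ; closed    = λ q<r → [ (λ r∈x → inj₁ (ℝ.closed x q<r r∈x))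
                        , (λ r∈y → inj₂ (ℝ.closed y q<r r∈y)) ]′
  ; rounded   = [ (λ q∈x → let r , q<r , r∈x = ℝ.rounded x q∈x in r , q<r , inj₁ r∈x)
                , (λ q∈y → let r , q<r , r∈y = ℝ.rounded y q∈y in r , q<r , inj₂ r∈y) ]′
  }
  where
  bound : ∃[ q ] q ∉ x → ∃[ q ] q ∉ y → ∃[ q ] ¬ (q ∈ x ⊎ q ∈ y)
  bound (b , b∉x) (d , d∉y) = b ℚ.⊔ d ,
    [ (λ h → ≤⇒≯ (ℚ.p≤p⊔q b d) (∈∉⇒< x h b∉x))
    , (λ h → ≤⇒≯ (ℚ.p≤q⊔p b d) (∈∉⇒< y h d∉y)) ]′

_+_ : ℝ → ℝ → ℝ
x + y = record
  { lower     = λ q → ∃[ a ] ∃[ c ] a ∈ x × c ∈ y × q ℚ.< a ℚ.+ c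
  ; inhabited = let a , a∈x = ℝ.inhabited x
                    c , c∈y = ℝ.inhabited y
                    q , q<  = below (a ℚ.+ c)
                in q , a , c , a∈x , c∈y , q<
  ; bounded   = let b , b∉x = ℝ.bounded x
                    d , d∉y = ℝ.bounded y
                in b ℚ.+ d , λ (a , c , a∈x , c∈y , b+d<a+c) →
                     ℚ.<-asym b+d<a+c
                       (ℚ.+-mono-< (∈∉⇒< x a∈x b∉x) (∈∉⇒< y c∈y d∉y))
  ; closed    = λ q<r (a , c , a∈x , c∈y , r<) → a , c , a∈x , c∈y , ℚ.<-trans q<r r<
  ; rounded   = λ (a , c , a∈x , c∈y , q<) →
                  let s , q<s , s< = ℚ.<-dense q< in s , q<s , a , c , a∈x , c∈y , s<
  }

-_ : ℝ → ℝ
- x = record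
  { lower     = λ q → ∃[ r ] r ∉ x × q ℚ.< ℚ.- r
  ; inhabited = let r , r∉x = ℝ.bounded x
                    q , q<  = below (ℚ.- r)
                in q , r , r∉x , q<
  ; bounded   = let a , a∈x = ℝ.inhabited x
                in ℚ.- a , λ (r , r∉x , -a<-r) →
                     ℚ.<-asym -a<-r (ℚ.neg-antimono-< (∈∉⇒< x a∈x r∉x))
  ; closed    = λ q<s (r , r∉x , s<) → r , r∉x , ℚ.<-trans q<s s<
  ; rounded   = λ (r , r∉x , q<) →
                  let s , q<s , s< = ℚ.<-dense q< in s , q<s , r , r∉x , s<
  }

_-_ : ℝ → ℝ → ℝ
x - y = x + (- y)

private
  corners : ℚ → ℚ → ℚ → ℚ → ℚ
  corners a b c d = ((a ℚ.* c) ℚ.⊓ (a ℚ.* d)) ℚ.⊓ ((b ℚ.* c) ℚ.⊓ (b ℚ.* d))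

  corners′ : ℚ → ℚ → ℚ → ℚ → ℚ
  corners′ a b c d = ((a ℚ.* c) ℚ.⊔ (a ℚ.* d)) ℚ.⊔ ((b ℚ.* c) ℚ.⊔ (b ℚ.* d))

  edgeˡ : ∀ p {c s d} → c ℚ.≤ s → s ℚ.≤ d →
          ((p ℚ.* c) ℚ.⊓ (p ℚ.* d)) ℚ.≤ p ℚ.* s × p ℚ.* s ℚ.≤ ((p ℚ.* c) ℚ.⊔ (p ℚ.* d))
  edgeˡ p {c} {s} {d} c≤s s≤d with ℚ.≤-total 0ℚ p
  ... | inj₁ 0≤p = ℚ.≤-trans (ℚ.p⊓q≤p (p ℚ.* c) (p ℚ.* d)) (ℚ.*-monoˡ-≤-nonNeg p c≤s)
                 , ℚ.≤-trans (ℚ.*-monoˡ-≤-nonNeg p s≤d) (ℚ.p≤q⊔p (p ℚ.* c) (p ℚ.* d))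
    where instance _ = ℚ.nonNegative 0≤p
  ... | inj₂ p≤0 = ℚ.≤-trans (ℚ.p⊓q≤q (p ℚ.* c) (p ℚ.* d)) (ℚ.*-monoˡ-≤-nonPos p s≤d)
                 , ℚ.≤-trans (ℚ.*-monoˡ-≤-nonPos p c≤s) (ℚ.p≤p⊔q (p ℚ.* c) (p ℚ.* d))
    where instance _ = ℚ.nonPositive p≤0

  edgeʳ : ∀ p {a r b} → a ℚ.≤ r → r ℚ.≤ b →
          ((a ℚ.* p) ℚ.⊓ (b ℚ.* p)) ℚ.≤ r ℚ.* p × r ℚ.* p ℚ.≤ ((a ℚ.* p) ℚ.⊔ (b ℚ.* p))
  edgeʳ p {a} {r} {b} a≤r r≤b
    rewrite ℚ.*-comm a p | ℚ.*-comm r p | ℚ.*-comm b p = edgeˡ p a≤r r≤b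

  corners-≤ : ∀ {a b c d r s} → a ℚ.≤ r → r ℚ.≤ b → c ℚ.≤ s → s ℚ.≤ d →
              corners a b c d ℚ.≤ r ℚ.* s × r ℚ.* s ℚ.≤ corners′ a b c d
  corners-≤ {a} {b} {c} {d} {r} {s} a≤r r≤b c≤s s≤d =
      ℚ.≤-trans (ℚ.⊓-mono-≤ (proj₁ (edgeˡ a c≤s s≤d)) (proj₁ (edgeˡ b c≤s s≤d)))
                (proj₁ (edgeʳ s a≤r r≤b))
    , ℚ.≤-trans (proj₂ (edgeʳ s a≤r r≤b))
                (ℚ.⊔-mono-≤ (proj₂ (edgeˡ a c≤s s≤d)) (proj₂ (edgeˡ b c≤s s≤d)))

  common : ∀ x {a b a′ b′} → a ∈ x → b ∉ x → a′ ∈ x → b′ ∉ x →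
           ∃[ r ] (a ℚ.≤ r × r ℚ.≤ b) × (a′ ℚ.≤ r × r ℚ.≤ b′)
  common x {a} {b} {a′} {b′} a∈ b∉ a′∈ b′∉ = a ℚ.⊔ a′ ,
    (ℚ.p≤p⊔q a a′ , ℚ.⊔-lub (lt a∈ b∉) (lt a′∈ b∉)) ,
    (ℚ.p≤q⊔p a a′ , ℚ.⊔-lub (lt a∈ b′∉) (lt a′∈ b′∉))
    where
    lt : ∀ {q r} → q ∈ x → r ∉ x → q ℚ.≤ r
    lt q∈ r∉ = ℚ.<⇒≤ (∈∉⇒< x q∈ r∉)

-- Interval multiplication: if a < x ≤ b and c < y ≤ d, then x y is at
-- least the minimum of the products of the endpoints, and x y is the
-- supremum of these minima.

_*_ : ℝ → ℝ → ℝ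
x * y = record
  { lower     = λ q → ∃[ a ] ∃[ b ] ∃[ c ] ∃[ d ]
                  a ∈ x × b ∉ x × c ∈ y × d ∉ y ×
                  q ℚ.< ((a ℚ.* c) ℚ.⊓ (a ℚ.* d)) ℚ.⊓ ((b ℚ.* c) ℚ.⊓ (b ℚ.* d))
  ; inhabited = let a , a∈x = ℝ.inhabited x
                    b , b∉x = ℝ.bounded x
                    c , c∈y = ℝ.inhabited y
                    d , d∉y = ℝ.bounded y
                    q , q<  = below (corners a b c d)
                in q , a , b , c , d , a∈x , b∉x , c∈y , d∉y , q<
  ; bounded   = let a , a∈x = ℝ.inhabited x
                    b , b∉x = ℝ.bounded x
                    c , c∈y = ℝ.inhabited y
                    d , d∉y = ℝ.bounded y
                in corners′ a b c d , λ (_ , _ , _ , _ , a′∈x , b′∉x , c′∈y , d′∉y , lt) →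
                     let r , (a≤r , r≤b) , (a′≤r , r≤b′) = common x a∈x b∉x a′∈x b′∉x
                         s , (c≤s , s≤d) , (c′≤s , s≤d′) = common y c∈y d∉y c′∈y d′∉y
                     in ≤⇒≯ (ℚ.≤-trans (proj₁ (corners-≤ a′≤r r≤b′ c′≤s s≤d′))
                                         (proj₂ (corners-≤ a≤r r≤b c≤s s≤d))) lt
  ; closed    = λ q<r (a , b , c , d , a∈ , b∉ , c∈ , d∉ , r<) →
                  a , b , c , d , a∈ , b∉ , c∈ , d∉ , ℚ.<-trans q<r r<
  ; rounded   = λ (a , b , c , d , a∈ , b∉ , c∈ , d∉ , q<) →
                  let s , q<s , s< = ℚ.<-dense q<
                  in s , q<s , a , b , c , d , a∈ , b∉ , c∈ , d∉ , s<
  }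

∑ : ∀ {n} → (Fin n → ℝ) → ℝ
∑ = foldr _+_ 0ℝ

-- 1/x is the supremum of the rationals s with s r ≤ 1 for some r ≥ x.

recip : (x : ℝ) → 0ℝ < x → ℝ
recip x (q , q∈x , q≮0) = record
  { lower     = λ q → ∃[ s ] ∃[ r ] q ℚ.< s × r ∉ x × s ℚ.* r ℚ.≤ 1ℚ
  ; inhabited = let r , r∉x = ℝ.bounded x
                    q , q<0 = below 0ℚ
                in q , 0ℚ , r , q<0 , r∉x , subst (ℚ._≤ 1ℚ) (sym (ℚ.*-zeroˡ r)) 0≤1
  ; bounded   = bound
  ; closed    = λ q<r (s , t , r<s , rest) → s , t , ℚ.<-trans q<r r<s , rest
  ; rounded   = λ (s , t , q<s , rest) →
                  let r , q<r , r<s = ℚ.<-dense q<s in r , q<r , s , t , r<s , rest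
  }
  where
  0≤1 : 0ℚ ℚ.≤ 1ℚ
  0≤1 = ℚ.nonNegative⁻¹ 1ℚ

  bound : ∃[ q ] ¬ (∃[ s ] ∃[ r ] q ℚ.< s × r ∉ x × s ℚ.* r ℚ.≤ 1ℚ)
  bound with ℝ.rounded x q∈x
  ... | t , q<t , t∈x = ℚ.1/ t , λ (s , r , 1/t<s , r∉x , sr≤1) →
        let 1<st : 1ℚ ℚ.< s ℚ.* t
            1<st = subst (ℚ._< s ℚ.* t) (ℚ.*-inverseˡ t) (ℚ.*-monoˡ-<-pos t 1/t<s)
            0<s : 0ℚ ℚ.< s
            0<s = ℚ.<-trans (ℚ.positive⁻¹ (ℚ.1/ t) {{ℚ.1/pos⇒pos t}}) 1/t<s
        in ≤⇒≯ sr≤1 (ℚ.<-trans 1<st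
             (ℚ.*-monoʳ-<-pos s {{ℚ.positive 0<s}} (∈∉⇒< x t∈x r∉x)))
    where
    instance
      t-pos : ℚ.Positive t
      t-pos = ℚ.positive (ℚ.≤-<-trans (ℚ.≮⇒≥ q≮0) q<t)
      t-nonZero : ℚ.NonZero t
      t-nonZero = ℚ.pos⇒nonZero t

2^_ : ℤ → ℚ
2^ (+ n)    = (+ 2 / 1) ^ n
2^ -[1+ n ] = ½ ^ suc n

private
  ι : ℕ → ℚ
  ι n = + n / 1

  ιᵘ : ∀ n → ℚ.toℚᵘ (ι n) ℚᵘ.≃ mkℚᵘ (+ n) 0
  ιᵘ n = ℚ.toℚᵘ-fromℚᵘ (mkℚᵘ (+ n) 0)

  ι-* : ∀ m n → ι (m ℕ.* n) ≡ ι m ℚ.* ι n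
  ι-* m n = ℚ.toℚᵘ-injective (begin
    ℚ.toℚᵘ (ι (m ℕ.* n))              ≈⟨ ιᵘ (m ℕ.* n) ⟩
    mkℚᵘ (+ (m ℕ.* n)) 0              ≡⟨ cong (λ i → mkℚᵘ i 0) (ℤ.pos-* m n) ⟩
    mkℚᵘ (+ m) 0 ℚᵘ.* mkℚᵘ (+ n) 0    ≈⟨ ℚᵘ.*-cong (ιᵘ m) (ιᵘ n) ⟨
    ℚ.toℚᵘ (ι m) ℚᵘ.* ℚ.toℚᵘ (ι n)    ≈⟨ ℚ.toℚᵘ-homo-* (ι m) (ι n) ⟨
    ℚ.toℚᵘ (ι m ℚ.* ι n)              ∎)
    where open import Relation.Binary.Reasoning.Setoid ℚᵘ.≃-setoid

  ι-suc : ∀ n → ι (suc n) ≡ 1ℚ ℚ.+ ι n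
  ι-suc n = ℚ.toℚᵘ-injective (begin
    ℚ.toℚᵘ (ι (suc n))                ≈⟨ ιᵘ (suc n) ⟩
    mkℚᵘ (+ suc n) 0                  ≡⟨ cong (λ k → mkℚᵘ (+ suc k) 0) (ℕ.*-identityʳ n) ⟨
    mkℚᵘ (+ suc (n ℕ.* 1)) 0          ≡⟨ cong (λ i → mkℚᵘ (+ 1 ℤ.+ i) 0) (ℤ.pos-* n 1) ⟩
    ℚ.toℚᵘ 1ℚ ℚᵘ.+ mkℚᵘ (+ n) 0       ≈⟨ ℚᵘ.+-congʳ (ℚ.toℚᵘ 1ℚ) (ιᵘ n) ⟨
    ℚ.toℚᵘ 1ℚ ℚᵘ.+ ℚ.toℚᵘ (ι n)       ≈⟨ ℚ.toℚᵘ-homo-+ 1ℚ (ι n) ⟨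
    ℚ.toℚᵘ (1ℚ ℚ.+ ι n)               ∎)
    where open import Relation.Binary.Reasoning.Setoid ℚᵘ.≃-setoid

  ι-^ : ∀ m n → ι (m ℕ.^ n) ≡ ι m ^ n
  ι-^ m zero    = refl
  ι-^ m (suc n) = trans (ι-* m (m ℕ.^ n)) (cong (ι m ℚ.*_) (ι-^ m n))

  /-≤ : ∀ {a b : ℤ} {k l} → a ℤ.* + suc l ℤ.≤ b ℤ.* + suc k → a / suc k ℚ.≤ b / suc l
  /-≤ {a} {b} {k} {l} le = ℚ.toℚᵘ-cancel-≤
    (ℚᵘ.≤-respˡ-≃ (ℚᵘ.≃-sym (ℚ.toℚᵘ-fromℚᵘ (mkℚᵘ a k)))
      (ℚᵘ.≤-respʳ-≃ (ℚᵘ.≃-sym (ℚ.toℚᵘ-fromℚᵘ (mkℚᵘ b l))) (ℚᵘ.*≤* le)))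

  ι-cancel-≤ : ∀ {m n} → ι m ℚ.≤ ι n → m ℕ.≤ n
  ι-cancel-≤ {m} {n} le with
    ℚᵘ.≤-respˡ-≃ (ιᵘ m) (ℚᵘ.≤-respʳ-≃ (ιᵘ n) (ℚ.toℚᵘ-mono-≤ le))
  ... | ℚᵘ.*≤* le′ = ℤ.drop‿+≤+ (subst₂ ℤ._≤_ (ℤ.*-identityʳ (+ m)) (ℤ.*-identityʳ (+ n)) le′)

  ≤ι : ∀ q → q ℚ.≤ ι ℤ.∣ ℚ.↥ q ∣
  ≤ι q@(ℚ.mkℚ (+ n) d _) = ℚ.≤-trans (ℚ.≤-reflexive (sym (ℚ.↥p/↧p≡p q)))
    (/-≤ {+ n} {+ n} {d} {0} (ℤ.*-monoˡ-≤-nonNeg (+ n) (ℤ.+≤+ (ℕ.s≤s ℕ.z≤n))))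
  ≤ι q@(ℚ.mkℚ -[1+ n ] _ _) = ℚ.≤-trans (ℚ.<⇒≤ (ℚ.negative⁻¹ q))
    (ℚ.nonNegative⁻¹ (ι (suc n)) {{ℚ.normalize-nonNeg (suc n) 1}})

  ^-mono : ∀ {q r} n → 0ℚ ℚ.≤ q → q ℚ.≤ r → 0ℚ ℚ.≤ q ^ n × q ^ n ℚ.≤ r ^ n
  ^-mono {q} {r} zero 0≤q q≤r = ℚ.nonNegative⁻¹ 1ℚ , ℚ.≤-refl
  ^-mono {q} {r} (suc n) 0≤q q≤r =
    let 0≤qⁿ , qⁿ≤rⁿ = ^-mono n 0≤q q≤r
    in subst (ℚ._≤ q ℚ.* q ^ n) (ℚ.*-zeroʳ q)
         (ℚ.*-monoˡ-≤-nonNeg q {{ℚ.nonNegative 0≤q}} 0≤qⁿ)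
     , ℚ.≤-trans (ℚ.*-monoˡ-≤-nonNeg q {{ℚ.nonNegative 0≤q}} qⁿ≤rⁿ)
         (ℚ.*-monoʳ-≤-nonNeg (r ^ n) {{ℚ.nonNegative (ℚ.≤-trans 0≤qⁿ qⁿ≤rⁿ)}} q≤r)

  n≤2ⁿ : ∀ n → n ℕ.≤ 2 ℕ.^ n
  n≤2ⁿ zero    = ℕ.z≤n
  n≤2ⁿ (suc n) = ℕ.+-mono-≤ (ℕ.m^n>0 2 n) (ℕ.≤-trans (n≤2ⁿ n) (ℕ.m≤m+n _ 0))

  2ᵃ≤Sᵏ⇒a≤kS : ∀ a S k → 2 ℕ.^ a ℕ.≤ S ℕ.^ k → a ℕ.≤ S ℕ.* k
  2ᵃ≤Sᵏ⇒a≤kS a S k le = ℕ.≮⇒≥ λ Sk<a → ℕ.<⇒≱ (ℕ.^-monoʳ-< 2 (ℕ.s≤s (ℕ.s≤s ℕ.z≤n)) Sk<a)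
    (ℕ.≤-trans le (ℕ.≤-trans (ℕ.^-monoˡ-≤ k (n≤2ⁿ S)) (ℕ.≤-reflexive (ℕ.^-*-assoc 2 S k))))

  1≤rd : ∀ r → 0ℚ ℚ.< r → 1ℚ ℚ.≤ r ℚ.* ι (ℚ.↧ₙ r)
  1≤rd (ℚ.mkℚ (+ 0) _ _)      (ℚ.*<* (ℤ.+<+ ()))
  1≤rd (ℚ.mkℚ -[1+ _ ] _ _)   (ℚ.*<* ())
  1≤rd r@(ℚ.mkℚ (+ suc c) d _) _ = ℚ.toℚᵘ-cancel-≤
    (ℚᵘ.≤-respʳ-≃ (ℚᵘ.≃-sym (ℚᵘ.≃-trans (ℚ.toℚᵘ-homo-* r (ι (suc d)))
        (ℚᵘ.*-congˡ {mkℚᵘ (+ suc c) d} (ιᵘ (suc d)))))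
      (ℚᵘ.*≤* (ℤ.+≤+ (begin
        1 ℕ.* suc (d ℕ.* 1)      ≡⟨ ℕ.*-identityˡ (suc (d ℕ.* 1)) ⟩
        suc d ℕ.* 1              ≤⟨ ℕ.*-monoˡ-≤ 1 (ℕ.m≤n*m (suc d) (suc c)) ⟩
        suc c ℕ.* suc d ℕ.* 1    ∎))))
    where open ℕ.≤-Reasoning

  ½ⁿ≤r : ∀ r → 0ℚ ℚ.< r → ∃[ n ] 2^ -[1+ n ] ℚ.≤ r
  ½ⁿ≤r r 0<r = n , ℚ.≮⇒≥ λ r<½ⁿ → ≤⇒≯ (½ⁿn≤1 (suc n))
      (ℚ.≤-<-trans (1≤rd r 0<r) (ℚ.*-monoˡ-<-pos (ι (suc n)) {{ℚ.normalize-pos (suc n) 1}} r<½ⁿ))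
    where
    n = ℚ.denominator-1 r

    ½ⁿn≤1 : ∀ m → ½ ^ m ℚ.* ι m ℚ.≤ 1ℚ
    ½ⁿn≤1 zero    = ℚ.nonNegative⁻¹ 1ℚ
    ½ⁿn≤1 (suc m) = begin
      ½ ℚ.* ½ ^ m ℚ.* ι (suc m)             ≡⟨ ℚ.*-assoc ½ (½ ^ m) (ι (suc m)) ⟩
      ½ ℚ.* (½ ^ m ℚ.* ι (suc m))           ≡⟨ cong (λ h → ½ ℚ.* (½ ^ m ℚ.* h)) (ι-suc m) ⟩
      ½ ℚ.* (½ ^ m ℚ.* (1ℚ ℚ.+ ι m))        ≡⟨ cong (½ ℚ.*_) (ℚ.*-distribˡ-+ (½ ^ m) 1ℚ (ι m)) ⟩
      ½ ℚ.* (½ ^ m ℚ.* 1ℚ ℚ.+ ½ ^ m ℚ.* ι m) ≤⟨ ℚ.*-monoˡ-≤-nonNeg ½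
                                                 (ℚ.+-mono-≤ (½ⁿ1≤1 m) (½ⁿn≤1 m)) ⟩
      ½ ℚ.* (1ℚ ℚ.+ 1ℚ)                     ≡⟨⟩
      1ℚ                                    ∎
      where
      open ℚ.≤-Reasoning
      ½ⁿ1≤1 : ∀ m → ½ ^ m ℚ.* 1ℚ ℚ.≤ 1ℚ
      ½ⁿ1≤1 m = begin
        ½ ^ m ℚ.* 1ℚ  ≡⟨ ℚ.*-identityʳ (½ ^ m) ⟩
        ½ ^ m         ≤⟨ proj₂ (^-mono m (ℚ.nonNegative⁻¹ ½) (ℚ.p≤p⊔q ½ 1ℚ)) ⟩
        1ℚ ^ m        ≡⟨ 1ⁿ m ⟩
        1ℚ            ∎
        where
        1ⁿ : ∀ m → 1ℚ ^ m ≡ 1ℚ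
        1ⁿ zero    = refl
        1ⁿ (suc m) = trans (ℚ.*-identityˡ (1ℚ ^ m)) (1ⁿ m)


-- log x is the supremum of the rationals a/k with 2ᵃ ≤ xᵏ.

log⁺ : (x : ℝ) → 0ℝ < x → ℝ
log⁺ x (q , q∈x , q≮0) = record
  { lower     = λ q → ∃[ a ] ∃[ k ] ∃[ r ]
                  q ℚ.< a / suc k × r ∈ x × 0ℚ ℚ.< r × 2^ a ℚ.≤ r ^ suc k
  ; inhabited =
      let r , q<r , r∈x = ℝ.rounded x q∈x
          0<r = ℚ.≤-<-trans (ℚ.≮⇒≥ q≮0) q<r
          n , ½ⁿ≤r = ½ⁿ≤r r 0<r
          s , s< = below (-[1+ n ] / 1)
      in s , -[1+ n ] , 0 , r , s< , r∈x , 0<r ,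
         subst (2^ -[1+ n ] ℚ.≤_) (sym (ℚ.*-identityʳ r)) ½ⁿ≤r
  ; bounded   = ι S , unbounded
  ; closed    = λ q<r (a , k , s , r< , rest) → a , k , s , ℚ.<-trans q<r r< , rest
  ; rounded   = λ (a , k , s , q< , rest) →
                  let r , q<r , r< = ℚ.<-dense q< in r , q<r , a , k , s , r< , rest
  }
  where
  b = proj₁ (ℝ.bounded x)
  S = ℤ.∣ ℚ.↥ b ∣

  unbounded : ¬ (∃[ a ] ∃[ k ] ∃[ r ]
                  ι S ℚ.< a / suc k × r ∈ x × 0ℚ ℚ.< r × 2^ a ℚ.≤ r ^ suc k)
  unbounded (-[1+ n ] , k , r , S< , _) =
    flip ≤⇒≯ S< (/-≤ { -[1+ n ] } {+ S} {k} {0} (subst₂ ℤ._≤_ (sym (ℤ.*-identityʳ -[1+ n ])) (ℤ.pos-* S (suc k)) ℤ.-≤+))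
  unbounded (+ α , k , r , S< , r∈x , 0<r , 2ᵃ≤rᵏ) = flip ≤⇒≯ S<
    (/-≤ {+ α} {+ S} {k} {0} (subst₂ ℤ._≤_ (sym (ℤ.*-identityʳ (+ α))) (ℤ.pos-* S (suc k))
      (ℤ.+≤+ (2ᵃ≤Sᵏ⇒a≤kS α S (suc k) (ι-cancel-≤
        (subst₂ ℚ._≤_ (sym (ι-^ 2 α)) (sym (ι-^ S (suc k)))
          (ℚ.≤-trans 2ᵃ≤rᵏ (proj₂ (^-mono (suc k) (ℚ.<⇒≤ 0<r) r≤S)))))))))
    where
    r≤S : r ℚ.≤ ι S
    r≤S = ℚ.≤-trans (ℚ.<⇒≤ (∈∉⇒< x r∈x (proj₂ (ℝ.bounded x)))) (≤ι b)

-- Excluded middle decides whether 0 < x. The reciprocal and the logarithm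
-- are 0 elsewhere, so in H the convention 0 log 0 = 0 holds.

module Classical (em : ExcludedMiddle 0ℓ) where

  infix 8 _⁻¹

  _⁻¹ : ℝ → ℝ
  x ⁻¹ with em {0ℝ < x}
  ... | yes 0<x = recip x 0<x
  ... | no  _   = 0ℝ

  log : ℝ → ℝ
  log x with em {0ℝ < x}
  ... | yes 0<x = log⁺ x 0<x
  ... | no  _   = 0ℝ

  H : ∀ {r} → (Fin r → ℝ) → ℝ
  H q = - ∑ (λ i → q i * log (q i))

Vanishes : Pred ℕ 0ℓ → (ℕ → ℝ) → Set
Vanishes P e = ∀ (δ : ℚ) → 0ℚ ℚ.< δ → ∃[ N ] (∀ n → N ℕ.≤ n → P n →
  fromℚ (ℚ.- δ) ≤ e n × e n ≤ fromℚ δ)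

-- aₙ ≥ c + o(1) as n → ∞ through the n that satisfy P.

infix 4 _≥_+o[1]along_

_≥_+o[1]along_ : (ℕ → ℝ) → ℝ → Pred ℕ 0ℓ → Set₁
a ≥ c +o[1]along P = ∃[ e ] Vanishes P e × (∀ n → P n → c + e n ≤ a n)

infixl 7 _÷_

-- The fraction k/d, with k ÷ 0 = 0.

_÷_ : ℕ → ℕ → ℚ
k ÷ zero  = 0ℚ
k ÷ suc d = + k / suc d

#_ : ∀ {u} {P : Pred (Fin u) 0ℓ} → Decidable P → ℕ
# P? = count P? (allFin _)

module _ {u b : ℕ} (s : Fin u → Maybe (Fin b)) where

  ≡⊥? : Decidable (λ x → s x ≡ nothing)
  ≡⊥? x = ≡-dec Fin._≟_ (s x) nothing

  ≢⊥? : Decidable (λ x → s x ≢ nothing)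
  ≢⊥? x = ¬? (≡⊥? x)

  ≡? : ∀ i → Decidable (λ x → s x ≡ just i)
  ≡? i x = ≡-dec Fin._≟_ (s x) (just i)

  -- s(x) ∈ V ∖ {vᵢ}
  other? : ∀ i → Decidable (λ x → Any (_≢ i) (s x))
  other? i x = dec (λ j → ¬? (j Fin.≟ i)) (s x)

-- The set { (x , v(x)) : x ∈ X } as a partial function with domain X.

record PMap {b} (p : Fin b → ℝ) (n u : ℕ) : Set where
  field
    val  : Fin u → Maybe (Fin b)
    ∣X∣  : # (≢⊥? val) ≡ n
    ∣Xᵢ∣ : ∀ i → fromℕ (# (≡? val i)) ≃ p i * fromℕ n

-- The universe is Fin u, the values are Fin b, and ⊥ is nothing.

DataStructure : (m u b : ℕ) → Set
DataStructure m u b = Vec Bool m → Fin u → Maybe (Fin b)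

module _ {u b : ℕ} (M s : Fin u → Maybe (Fin b)) where

  f⁺ : ℚ
  f⁺ = # (λ x → ≡⊥? M x ×-dec ≢⊥? s x) ÷ # (≡⊥? M)

  f* f⁻ : Fin b → ℚ
  f* i = # (λ x → ≡? M i x ×-dec other? s i x) ÷ # (≡? M i)
  f⁻ i = # (λ x → ≡? M i x ×-dec ≡⊥? s x) ÷ # (≡? M i)

module _ (ε⁺ ε* ε⁻ : ℝ) where

  Encodes : ∀ {u b} (s M : Fin u → Maybe (Fin b)) → Set
  Encodes s M = fromℚ (f⁺ M s) ≤ ε⁺ ×
    (∀ i → fromℚ (f* M s i) ≤ ε* × fromℚ (f⁻ M s i) ≤ ε⁻)

  EncodesAll : ∀ {m u b} → DataStructure m u b → (p : Fin b → ℝ) → ℕ → Set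
  EncodesAll {u = u} D p n =
    (M : PMap p n u) → ∃[ s ] Encodes (D s) (PMap.val M)

-- The positive n for which every pᵢ n is an integer.

Admissible : ∀ {b} → (Fin b → ℝ) → Pred ℕ 0ℓ
Admissible p n = 1 ℕ.≤ n × (∀ i → ∃[ k ] p i * fromℕ n ≃ fromℕ k)

{-# OPTIONS --safe #-}
module Submission where

-- Fix a string s and draw a sequence of n distinct elements of U, the first
-- p₁n of them mapped to v₁, and so on. Give a drawn x mapped to vᵢ the weight
-- x₀/(pᵢ ε⁺), y/ε⁺ or z according to whether s(x) is vᵢ, another value or ⊥,
-- where (x₀, y, z) is close to (1 - ε⁻ - ε*, ε*, ε⁻) and x₀ + y + z ≤ 1. By the
-- AM-GM inequality the products of the weights over all sequences sum to at
-- most uⁿ, for every s with f⁺(s) ≤ ε⁺; an averaging argument, which chooses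
-- the sequence element by element, yields a map for which the sum over all s
-- of these products is at most 2ᵐ (u/(u - n))ⁿ. Some s encodes that map, and
-- its product is at least 2 to the power n times the right-hand side, as the
-- weight of a correct answer is the largest. Stirling's formula is not needed
-- because sequences rather than sets are drawn.
--
-- For irrational parameters the bound is proved at rational points: all reals
-- are limits of rational sequences that lie on the favourable side of them.

-- Per key, the logarithm of the product for the encoded map is at least (1-ε⁻-ε*)(log x₀ + H(p) +
-- log 1/ε⁺) + ε*(log y + log 1/ε⁺) + ε⁻ log z, and by Gibbs' inequality (1-ε⁻-ε*, ε*, ε⁻) is the
-- best choice under x₀ + y + z ≤ 1; this is the origin of the last entropy term. The factor 1/pᵢ
-- cancels the frequency of class i, so that the correct answers of all classes together cost x₀
-- times the number of answered elements. The bound 1/8 keeps a correct answer the heaviest: x₀ ≥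
-- 1/2, y and z ≤ 1/4, 1/ε⁺ ≥ 1. The hypothesis n/u → 0 enters twice: f⁺ does not see the n keys,
-- whose answers add up to n/u to the fraction of answered elements, and drawing without replacement
-- costs log(u/(u - n)) per key. An error fraction times a class size need not be an integer, so the
-- inequalities are raised to the power of a common denominator D instead of rounding. Error
-- fractions are approximated from above, logarithms of 1/ε⁺, ε⁻, ε* and 1-ε⁻-ε* from below, those
-- of the pᵢ from above. The pᵢ themselves are rational as soon as one n is admissible.

module Rational where

  open import Defs using (2^_; #_; ≡⊥?; ≢⊥?; ≡?; other?; f⁺; f*; f⁻; _÷_; DataStructure)
  open import Data.Bool.Base using (Bool; true; false; if_then_else_)
  open import Data.Fin.Base as Fin using (Fin; zero; suc; finToFun; funToFin)
  import Data.Fin.Properties as Fin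
  open import Data.Integer.Base as ℤ using (ℤ; -[1+_])
  import Data.Integer.Tactic.RingSolver as ℤ-solver
  open import Data.List.Base using (List; []; _∷_; map; length; foldr)
  open import Data.List.Membership.DecPropositional using () renaming (_∈?_ to ∈-dec)
  open import Data.List.Membership.Propositional using (_∈_; _∉_)
  open import Data.List.Properties using (map-∘; length-map)
  open import Data.List.Relation.Unary.All using (All; []; _∷_)
  open import Data.List.Relation.Unary.AllPairs using (AllPairs; []; _∷_)
  open import Data.List.Relation.Unary.Any using (here; there)
  open import Data.Maybe.Base using (Maybe; just; nothing)
  open import Data.Maybe.Properties using (≡-dec)
  import Data.Maybe.Relation.Unary.Any as Maybe
  open import Data.Nat.Base as ℕ using (ℕ; zero; suc)
  import Data.Nat.Properties as ℕ
  import Data.Nat.Tactic.RingSolver as ℕ-solver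
  open import Data.Product.Base using (∃-syntax; _×_; _,_; proj₁; proj₂)
  open import Data.Rational.Base hiding (_÷_)
  open import Data.Rational.Properties
  open import Data.Rational.Unnormalised.Base as ℚᵘ using (mkℚᵘ)
  import Data.Rational.Unnormalised.Properties as ℚᵘ
  open import Data.Sum.Base using (inj₁; inj₂)
  open import Data.Vec.Base using (Vec; count; tabulate; lookup)
  open import Data.Vec.Properties using (tabulate-cong; tabulate∘lookup)
  open import Function.Base using (_∘_; id)
  open import Level using (0ℓ)
  open import Relation.Binary.PropositionalEquality
  open import Relation.Nullary
  open import Relation.Nullary.Decidable using (_×-dec_; dec⇒maybe)
  open import Relation.Unary using (Pred; Decidable)
  open import Tactic.RingSolver using (solve-∀)
  open import Tactic.RingSolver.Core.AlmostCommutativeRing using (AlmostCommutativeRing; fromCommutativeRing)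
  open import Algebra.Bundles using (CommutativeRing)
  open import Algebra.Properties.CommutativeSemiring.Exp (CommutativeRing.commutativeSemiring +-*-commutativeRing) public
  open import Algebra.Properties.Semiring.Sum (CommutativeRing.semiring +-*-commutativeRing) public
    using (sum; sum-cong-≗; ∑-comm; ∑-distrib-+; *-distribˡ-sum; *-distribʳ-sum; sum-replicate-zero)
  open import Algebra.Properties.CommutativeMonoid.Sum *-1-commutativeMonoid public
    using () renaming (sum to ∏; ∑-distrib-+ to ∏-distrib-*)
  import Algebra.Properties.Semiring.Sum ℕ.+-*-semiring as ℕΣ

  -- Arithmetic of rationals

  ringℚ : AlmostCommutativeRing 0ℓ 0ℓ
  ringℚ = fromCommutativeRing +-*-commutativeRing λ q → dec⇒maybe (0ℚ ≟ q)

  -- With the difference supplied as `d`, what remains of an inequality is a ring identity for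
  -- `solve-∀`.
  ≤-by : ∀ {p q} d → 0ℚ ≤ d → p + d ≡ q → p ≤ q
  ≤-by {p} d 0≤d refl = subst (_≤ p + d) (+-identityʳ p) (+-monoʳ-≤ p 0≤d)

  <-by : ∀ {p q} d → 0ℚ < d → p + d ≡ q → p < q
  <-by {p} d 0<d refl = subst (_< p + d) (+-identityʳ p) (+-monoʳ-< p 0<d)

  ≤⇒≯ : ∀ {p q} → p ≤ q → ¬ q < p
  ≤⇒≯ p≤q q<p = <-irrefl refl (≤-<-trans p≤q q<p)

  p≤q⇒0≤q-p : ∀ {p q} → p ≤ q → 0ℚ ≤ q - p
  p≤q⇒0≤q-p {p} {q} p≤q = subst (_≤ q - p) (+-inverseʳ p) (+-monoˡ-≤ (- p) p≤q)

  p<q⇒0<q-p : ∀ {p q} → p < q → 0ℚ < q - p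
  p<q⇒0<q-p {p} {q} p<q = subst (_< q - p) (+-inverseʳ p) (+-monoˡ-< (- p) p<q)

  0≤+ : ∀ {p q} → 0ℚ ≤ p → 0ℚ ≤ q → 0ℚ ≤ p + q
  0≤+ = +-mono-≤

  0≤* : ∀ {p q} → 0ℚ ≤ p → 0ℚ ≤ q → 0ℚ ≤ p * q
  0≤* {p} {q} 0≤p 0≤q = nonNegative⁻¹ _ {{nonNeg*nonNeg⇒nonNeg p {{nonNegative 0≤p}} q {{nonNegative 0≤q}}}}

  0<* : ∀ {p q} → 0ℚ < p → 0ℚ < q → 0ℚ < p * q
  0<* {p} {q} 0<p 0<q = positive⁻¹ _ {{pos*pos⇒pos p {{positive 0<p}} q {{positive 0<q}}}}

  *-monoˡ : ∀ {r p q} → 0ℚ ≤ r → p ≤ q → r * p ≤ r * q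
  *-monoˡ {r} 0≤r = *-monoˡ-≤-nonNeg r {{nonNegative 0≤r}}

  *-monoʳ : ∀ {r p q} → 0ℚ ≤ r → p ≤ q → p * r ≤ q * r
  *-monoʳ {r} 0≤r = *-monoʳ-≤-nonNeg r {{nonNegative 0≤r}}

  *-mono : ∀ {p q r s} → 0ℚ ≤ p → 0ℚ ≤ r → p ≤ q → r ≤ s → p * r ≤ q * s
  *-mono 0≤p 0≤r p≤q r≤s = ≤-trans (*-monoˡ 0≤p r≤s) (*-monoʳ (≤-trans 0≤r r≤s) p≤q)

  *-cancelˡ : ∀ {r p q} → 0ℚ < r → r * p ≤ r * q → p ≤ q
  *-cancelˡ {r} 0<r = *-cancelˡ-≤-pos r {{positive 0<r}}

  0≤1 : 0ℚ ≤ 1ℚ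
  0≤1 = nonNegative⁻¹ 1ℚ

  0<1 : 0ℚ < 1ℚ
  0<1 = positive⁻¹ 1ℚ

  0≤½ : 0ℚ ≤ ½
  0≤½ = nonNegative⁻¹ ½

  opaque
    inv : ∀ {p} → 0ℚ < p → ∃[ q ] 0ℚ < q × p * q ≡ 1ℚ
    inv {p} 0<p = (1/ p) {{p≢0}} , positive⁻¹ ((1/ p) {{p≢0}}) {{1/pos⇒pos p {{p-pos}}}} , *-inverseʳ p {{p≢0}}
      where
      p-pos : Positive p
      p-pos = positive 0<p
      p≢0 : NonZero p
      p≢0 = pos⇒nonZero p {{p-pos}}

  opaque
    ι : ℕ → ℚ
    ι n = ℤ.+ n / 1

  opaque
    unfolding ι

    ι-def : ∀ n → ι n ≡ ℤ.+ n / 1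
    ι-def n = refl

    ι-0 : ι 0 ≡ 0ℚ
    ι-0 = refl

    ι-suc : ∀ n → ι (suc n) ≡ 1ℚ + ι n
    ι-suc n = toℚᵘ-injective (begin
      toℚᵘ (ι (suc n))              ≈⟨ toℚᵘ-fromℚᵘ (mkℚᵘ (ℤ.+ suc n) 0) ⟩
      mkℚᵘ (ℤ.+ suc n) 0              ≈⟨ ℚᵘ.*≡* (lem (ℤ.+ n)) ⟩
      toℚᵘ 1ℚ ℚᵘ.+ mkℚᵘ (ℤ.+ n) 0     ≈⟨ ℚᵘ.+-congʳ (toℚᵘ 1ℚ) (toℚᵘ-fromℚᵘ (mkℚᵘ (ℤ.+ n) 0)) ⟨
      toℚᵘ 1ℚ ℚᵘ.+ toℚᵘ (ι n)       ≈⟨ toℚᵘ-homo-+ 1ℚ (ι n) ⟨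
      toℚᵘ (1ℚ + ι n)               ∎)
      where
      open import Relation.Binary.Reasoning.Setoid ℚᵘ.≃-setoid
      lem : ∀ m → (ℤ.1ℤ ℤ.+ m) ℤ.* ℤ.1ℤ ≡ (ℤ.1ℤ ℤ.* ℤ.1ℤ ℤ.+ m ℤ.* ℤ.1ℤ) ℤ.* ℤ.1ℤ
      lem = ℤ-solver.solve-∀

    ι-+ : ∀ m n → ι (m ℕ.+ n) ≡ ι m + ι n
    ι-+ zero n = sym (+-identityˡ (ι n))
    ι-+ (suc m) n = trans (ι-suc (m ℕ.+ n)) (trans (cong (λ q → 1ℚ + q) (ι-+ m n))
      (trans (sym (+-assoc 1ℚ (ι m) (ι n))) (cong (_+ ι n) (sym (ι-suc m)))))

    ι-* : ∀ m n → ι (m ℕ.* n) ≡ ι m * ι n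
    ι-* zero n = sym (*-zeroˡ (ι n))
    ι-* (suc m) n = trans (ι-+ n (m ℕ.* n)) (trans (cong (λ q → ι n + q) (ι-* m n))
      (trans (lem (ι m) (ι n)) (cong (_* ι n) (sym (ι-suc m)))))
      where
      lem : ∀ m n → n + m * n ≡ (1ℚ + m) * n
      lem = solve-∀ ringℚ

    0≤ι : ∀ n → 0ℚ ≤ ι n
    0≤ι zero = ≤-refl
    0≤ι (suc n) = subst (0ℚ ≤_) (sym (ι-suc n)) (0≤+ 0≤1 (0≤ι n))

    0<ι : ∀ n → 0ℚ < ι (suc n)
    0<ι n = subst (0ℚ <_) (sym (ι-suc n)) (+-mono-<-≤ 0<1 (0≤ι n))

    ι-mono-≤ : ∀ {m n} → m ℕ.≤ n → ι m ≤ ι n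
    ι-mono-≤ {m} {n} m≤n = ≤-by (ι (n ℕ.∸ m)) (0≤ι (n ℕ.∸ m))
      (trans (sym (ι-+ m (n ℕ.∸ m))) (cong ι (ℕ.m+[n∸m]≡n m≤n)))

    ι-cancel-≤ : ∀ {m n} → ι m ≤ ι n → m ℕ.≤ n
    ι-cancel-≤ {m} {n} le = ℕ.≮⇒≥ λ n<m → <-irrefl refl (<-≤-trans
      (<-≤-trans (<-by 1ℚ 0<1 (trans (+-comm (ι n) 1ℚ) (sym (ι-suc n)))) (ι-mono-≤ n<m)) le)

    ι-injective : ∀ {m n} → ι m ≡ ι n → m ≡ n
    ι-injective eq = ℕ.≤-antisym (ι-cancel-≤ (≤-reflexive eq)) (ι-cancel-≤ (≤-reflexive (sym eq)))

    ι-^ : ∀ m n → ι (m ℕ.^ n) ≡ ι m ^ n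
    ι-^ m zero = refl
    ι-^ m (suc n) = trans (ι-* m (m ℕ.^ n)) (cong (ι m *_) (ι-^ m n))

    /-* : ∀ a d → (a / suc d) * ι (suc d) ≡ a / 1
    /-* a d = toℚᵘ-injective (begin
      toℚᵘ ((a / suc d) * ι (suc d))          ≈⟨ toℚᵘ-homo-* (a / suc d) (ι (suc d)) ⟩
      toℚᵘ (a / suc d) ℚᵘ.* toℚᵘ (ι (suc d))  ≈⟨ ℚᵘ.*-cong (toℚᵘ-fromℚᵘ (mkℚᵘ a d)) (toℚᵘ-fromℚᵘ (mkℚᵘ (ℤ.+ suc d) 0)) ⟩
      mkℚᵘ a d ℚᵘ.* mkℚᵘ (ℤ.+ suc d) 0          ≈⟨ ℚᵘ.*≡* (trans (lem a (ℤ.+ suc d)) (cong (λ e → a ℤ.* ℤ.+ suc e) (sym (ℕ.*-identityʳ d)))) ⟩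
      mkℚᵘ a 0                                ≈⟨ toℚᵘ-fromℚᵘ (mkℚᵘ a 0) ⟨
      toℚᵘ (a / 1)                            ∎)
      where
      open import Relation.Binary.Reasoning.Setoid ℚᵘ.≃-setoid
      lem : ∀ a d → a ℤ.* d ℤ.* ℤ.1ℤ ≡ a ℤ.* d
      lem = ℤ-solver.solve-∀

    ÷-* : ∀ k d → (k ÷ suc d) * ι (suc d) ≡ ι k
    ÷-* k = /-* (ℤ.+ k)

    archimedes : ∀ q → ∃[ n ] q ≤ ι n
    archimedes q@(mkℚ (ℤ.+ n) d _) = n , ≤-by (q * ι d) (0≤* (nonNegative⁻¹ q) (0≤ι d))
      (trans (trans (lem q (ι d)) (cong (q *_) (sym (ι-suc d))))
      (trans (cong (_* ι (suc d)) (sym (↥p/↧p≡p q))) (/-* (ℤ.+ n) d)))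
      where
      lem : ∀ q d → q + q * d ≡ q * (1ℚ + d)
      lem = solve-∀ ringℚ
    archimedes q@(mkℚ -[1+ n ] _ _) = 0 , <⇒≤ (negative⁻¹ q)

  opaque
    archimedes-* : ∀ {h} q → 0ℚ < h → ∃[ n ] q ≤ h * ι (suc n)
    archimedes-* {h} q 0<h =
      let r , 0<r , hr≡1 = inv 0<h
          n , qr≤n = archimedes (q * r)
      in n , (begin
        q                ≡⟨ *-identityʳ q ⟨
        q * 1ℚ           ≡⟨ cong (q *_) hr≡1 ⟨
        q * (h * r)      ≡⟨ lem q h r ⟩
        h * (q * r)      ≤⟨ *-monoˡ (<⇒≤ 0<h) (≤-trans qr≤n (ι-mono-≤ (ℕ.n≤1+n n))) ⟩
        h * ι (suc n)    ∎)
      where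
      open ≤-Reasoning
      lem : ∀ q h r → q * (h * r) ≡ h * (q * r)
      lem = solve-∀ ringℚ

  0≤^ : ∀ {p} n → 0ℚ ≤ p → 0ℚ ≤ p ^ n
  0≤^ zero 0≤p = 0≤1
  0≤^ (suc n) 0≤p = 0≤* 0≤p (0≤^ n 0≤p)

  0<^ : ∀ {p} n → 0ℚ < p → 0ℚ < p ^ n
  0<^ zero 0<p = 0<1
  0<^ (suc n) 0<p = 0<* 0<p (0<^ n 0<p)

  ^-monoˡ : ∀ {p q} n → 0ℚ ≤ p → p ≤ q → p ^ n ≤ q ^ n
  ^-monoˡ zero 0≤p p≤q = ≤-refl
  ^-monoˡ (suc n) 0≤p p≤q = *-mono 0≤p (0≤^ n 0≤p) p≤q (^-monoˡ n 0≤p p≤q)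

  1^n≡1 : ∀ n → 1ℚ ^ n ≡ 1ℚ
  1^n≡1 zero = refl
  1^n≡1 (suc n) = trans (*-identityˡ _) (1^n≡1 n)

  opaque
    unfolding ι

    bernoulli : ∀ {h} n → 0ℚ ≤ h → h ≤ 1ℚ → 1ℚ - ι n * h ≤ (1ℚ - h) ^ n
    bernoulli {h} zero 0≤h h≤1 = ≤-reflexive (lem h)
      where
      lem : ∀ h → 1ℚ - 0ℚ * h ≡ 1ℚ
      lem = solve-∀ ringℚ
    bernoulli {h} (suc n) 0≤h h≤1 = begin
      1ℚ - ι (suc n) * h             ≡⟨ cong (λ m → 1ℚ - m * h) (ι-suc n) ⟩
      1ℚ - (1ℚ + ι n) * h            ≤⟨ ≤-by _ (0≤* (0≤ι n) (0≤* 0≤h 0≤h)) (lem (ι n) h) ⟩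
      (1ℚ - h) * (1ℚ - ι n * h)      ≤⟨ *-monoˡ (p≤q⇒0≤q-p h≤1) (bernoulli n 0≤h h≤1) ⟩
      (1ℚ - h) * (1ℚ - h) ^ n        ∎
      where
      open ≤-Reasoning
      lem : ∀ n h → 1ℚ - (1ℚ + n) * h + n * (h * h) ≡ (1ℚ - h) * (1ℚ - n * h)
      lem = solve-∀ ringℚ

  -- The AM-GM inequality

  ∏ᴸ ∑ᴸ : List ℚ → ℚ
  ∏ᴸ = foldr _*_ 1ℚ
  ∑ᴸ = foldr _+_ 0ℚ

  0≤∏ᴸ : ∀ {ts} → All (0ℚ ≤_) ts → 0ℚ ≤ ∏ᴸ ts
  0≤∏ᴸ [] = 0≤1
  0≤∏ᴸ (0≤t ∷ 0≤ts) = 0≤* 0≤t (0≤∏ᴸ 0≤ts)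

  0≤∑ᴸ : ∀ {ts} → All (0ℚ ≤_) ts → 0ℚ ≤ ∑ᴸ ts
  0≤∑ᴸ [] = ≤-refl
  0≤∑ᴸ (0≤t ∷ 0≤ts) = 0≤+ 0≤t (0≤∑ᴸ 0≤ts)

  private
    opaque
      unfolding ι
      -- One variable of the AM-GM inequality against n equal ones, with mean μ.
      mean-step : ∀ {μ h} n → 0ℚ ≤ μ → 0ℚ ≤ μ + h → (μ + h) ^ n * (μ - ι n * h) ≤ μ ^ suc n
      mean-step {μ} {h} zero 0≤μ 0≤μ+h = ≤-reflexive (lem μ h)
        where
        lem : ∀ μ h → 1ℚ * (μ - 0ℚ * h) ≡ μ * 1ℚ
        lem = solve-∀ ringℚ
      mean-step {μ} {h} (suc n) 0≤μ 0≤μ+h = begin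
        (μ + h) * (μ + h) ^ n * (μ - ι (suc n) * h)         ≡⟨ cong (λ m → (μ + h) * (μ + h) ^ n * (μ - m * h)) (ι-suc n) ⟩
        (μ + h) * (μ + h) ^ n * (μ - (1ℚ + ι n) * h)        ≤⟨ ≤-by _ (0≤* (0≤^ n 0≤μ+h) (0≤* (0≤+ 0≤1 (0≤ι n)) (square h))) (lem μ h (ι n) ((μ + h) ^ n)) ⟩
        μ * ((μ + h) ^ n * (μ - ι n * h))                   ≤⟨ *-monoˡ 0≤μ (mean-step n 0≤μ 0≤μ+h) ⟩
        μ * μ ^ suc n                                       ∎
        where
        open ≤-Reasoning
        lem : ∀ μ h n p → (μ + h) * p * (μ - (1ℚ + n) * h) + p * ((1ℚ + n) * (h * h)) ≡ μ * (p * (μ - n * h))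
        lem = solve-∀ ringℚ
        square : ∀ h → 0ℚ ≤ h * h
        square h with ≤-total 0ℚ h
        ... | inj₁ 0≤h = 0≤* 0≤h 0≤h
        ... | inj₂ h≤0 = subst (0ℚ ≤_) (sq h) (0≤* (neg-antimono-≤ h≤0) (neg-antimono-≤ h≤0))
          where
          sq : ∀ h → (- h) * (- h) ≡ h * h
          sq = solve-∀ ringℚ

  opaque
    unfolding ι

    -- The power on the right avoids roots. Without the head `t`, the remaining n + 1 numbers have
    -- mean at most `μ + h`, where (n + 1) h = μ - t; after the induction hypothesis, `mean-step`
    -- puts `t` back. A singleton is separate because h is a quotient by the number of remaining
    -- elements.
    am-gm : ∀ {ts μ} → 0ℚ ≤ μ → All (0ℚ ≤_) ts → ∑ᴸ ts ≤ ι (length ts) * μ → ∏ᴸ ts ≤ μ ^ length ts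
    am-gm 0≤μ [] _ = ≤-refl
    am-gm {t ∷ []} {μ} 0≤μ (0≤t ∷ []) le = subst₂ _≤_ (lem t) (trans (lem′ μ) (sym (*-identityʳ μ))) le
      where
      lem : ∀ t → t + 0ℚ ≡ t * 1ℚ
      lem = solve-∀ ringℚ
      lem′ : ∀ t → 1ℚ * t ≡ t
      lem′ = solve-∀ ringℚ
    am-gm {t ∷ ts@(_ ∷ ts′)} {μ} 0≤μ (0≤t ∷ 0≤ts) le =
      let n = length ts′
          r , 0<r , nr≡1 = inv (0<ι n)
          h = (μ - t) * r
          nh : ι (suc n) * h ≡ μ - t
          nh = trans (lem₁ (ι (suc n)) (μ - t) r) (trans (cong (_* (μ - t)) nr≡1) (*-identityˡ _))
          mean : ∑ᴸ ts ≤ ι (suc n) * (μ + h)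
          mean = ≤-by _ (p≤q⇒0≤q-p le) (trans (cong (λ k → ∑ᴸ ts + (k * μ - (t + ∑ᴸ ts))) (ι-suc (suc n)))
            (trans (lem₂ (∑ᴸ ts) (ι (suc n)) μ t) (trans (cong (λ k → ι (suc n) * μ + k) (sym nh)) (sym (*-distribˡ-+ (ι (suc n)) μ h)))))
          0≤μ+h : 0ℚ ≤ μ + h
          0≤μ+h = *-cancelˡ (0<ι n) (≤-trans (≤-reflexive (*-zeroʳ (ι (suc n)))) (≤-trans (0≤∑ᴸ 0≤ts) mean))
      in begin
        t * ∏ᴸ ts                                       ≤⟨ *-monoˡ 0≤t (am-gm 0≤μ+h 0≤ts mean) ⟩
        t * (μ + h) ^ suc n                             ≡⟨ lem₃ t μ ((μ + h) ^ suc n) ⟩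
        (μ + h) ^ suc n * (μ - (μ - t))                 ≡⟨ cong (λ k → (μ + h) ^ suc n * (μ - k)) nh ⟨
        (μ + h) ^ suc n * (μ - ι (suc n) * h)           ≤⟨ mean-step (suc n) 0≤μ 0≤μ+h ⟩
        μ ^ suc (suc n)                                 ∎
      where
      open ≤-Reasoning
      lem₁ : ∀ n d r → n * (d * r) ≡ (n * r) * d
      lem₁ = solve-∀ ringℚ
      lem₂ : ∀ s n μ t → s + ((1ℚ + n) * μ - (t + s)) ≡ n * μ + (μ - t)
      lem₂ = solve-∀ ringℚ
      lem₃ : ∀ t μ p → t * p ≡ p * (μ - (μ - t))
      lem₃ = solve-∀ ringℚ

  -- Logarithms of rationals

  2ℚ : ℚ
  2ℚ = ℤ.+ 2 / 1

  0<2 : 0ℚ < 2ℚ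
  0<2 = positive⁻¹ 2ℚ

  ½^n*2^n≡1 : ∀ n → ½ ^ n * 2ℚ ^ n ≡ 1ℚ
  ½^n*2^n≡1 n = trans (sym (^-distrib-* ½ 2ℚ n)) (1^n≡1 n)

  infix 4 _≤log_

  -- l ≤ log r: there are α, β and K = k + 1 with l ≤ (α − β) / K and
  -- 2^(α−β) ≤ r^K, both written without subtraction.
  record _≤log_ (l r : ℚ) : Set where
    constructor ≤log-intro
    field
      α β k    : ℕ
      exponent : l * ι (suc k) + ι β ≤ ι α
      power    : 2ℚ ^ α ≤ r ^ suc k * 2ℚ ^ β

  ≤log-mono : ∀ {l l′ r r′} → l′ ≤ l → 0ℚ ≤ r → r ≤ r′ → l ≤log r → l′ ≤log r′
  ≤log-mono l′≤l 0≤r r≤r′ (≤log-intro α β k e p) = ≤log-intro α β k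
    (≤-trans (+-monoˡ-≤ (ι β) (*-monoʳ (0≤ι (suc k)) l′≤l)) e)
    (≤-trans p (*-monoʳ (0≤^ β (<⇒≤ 0<2)) (^-monoˡ (suc k) 0≤r r≤r′)))

  0≤log1 : 0ℚ ≤log 1ℚ
  0≤log1 = ≤log-intro 0 0 0 (≤-reflexive (trans (cong (_+ ι 0) (*-zeroˡ (ι 1))) (+-identityˡ (ι 0)))) ≤-refl

  ≤log-* : ∀ {l l′ r r′} → l ≤log r → l′ ≤log r′ → l + l′ ≤log r * r′
  ≤log-* {l} {l′} {r} {r′} (≤log-intro α β k e p) (≤log-intro α′ β′ k′ e′ p′) =
    -- The two exponents are brought to the denominator K K′; the successor of the third argument
    -- reduces to `K * K′`.
    ≤log-intro (α ℕ.* K′ ℕ.+ α′ ℕ.* K) (β ℕ.* K′ ℕ.+ β′ ℕ.* K) (k′ ℕ.+ k ℕ.* K′) exponent power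
    where
    open ≤-Reasoning
    K = suc k
    K′ = suc k′

    ι-+* : ∀ a b c d → ι (a ℕ.* b ℕ.+ c ℕ.* d) ≡ ι a * ι b + ι c * ι d
    ι-+* a b c d = trans (ι-+ (a ℕ.* b) (c ℕ.* d)) (cong₂ _+_ (ι-* a b) (ι-* c d))

    2^-+* : ∀ a b c d → 2ℚ ^ (a ℕ.* b ℕ.+ c ℕ.* d) ≡ (2ℚ ^ a) ^ b * (2ℚ ^ c) ^ d
    2^-+* a b c d = trans (^-homo-* 2ℚ (a ℕ.* b) (c ℕ.* d)) (sym (cong₂ _*_ (^-assocʳ 2ℚ a b) (^-assocʳ 2ℚ c d)))

    exponent : (l + l′) * ι (K ℕ.* K′) + ι (β ℕ.* K′ ℕ.+ β′ ℕ.* K) ≤ ι (α ℕ.* K′ ℕ.+ α′ ℕ.* K)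
    exponent = begin
      (l + l′) * ι (K ℕ.* K′) + ι (β ℕ.* K′ ℕ.+ β′ ℕ.* K)           ≡⟨ cong₂ (λ x y → (l + l′) * x + y) (ι-* K K′) (ι-+* β K′ β′ K) ⟩
      (l + l′) * (ι K * ι K′) + (ι β * ι K′ + ι β′ * ι K)           ≡⟨ lem l l′ (ι K) (ι K′) (ι β) (ι β′) ⟩
      (l * ι K + ι β) * ι K′ + (l′ * ι K′ + ι β′) * ι K             ≤⟨ +-mono-≤ (*-monoʳ (0≤ι K′) e) (*-monoʳ (0≤ι K) e′) ⟩
      ι α * ι K′ + ι α′ * ι K                                       ≡⟨ ι-+* α K′ α′ K ⟨
      ι (α ℕ.* K′ ℕ.+ α′ ℕ.* K)                                     ∎
      where
      lem : ∀ l l′ k k′ b b′ → (l + l′) * (k * k′) + (b * k′ + b′ * k) ≡ (l * k + b) * k′ + (l′ * k′ + b′) * k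
      lem = solve-∀ ringℚ

    power : 2ℚ ^ (α ℕ.* K′ ℕ.+ α′ ℕ.* K) ≤ (r * r′) ^ (K ℕ.* K′) * 2ℚ ^ (β ℕ.* K′ ℕ.+ β′ ℕ.* K)
    power = begin
      2ℚ ^ (α ℕ.* K′ ℕ.+ α′ ℕ.* K)                                            ≡⟨ 2^-+* α K′ α′ K ⟩
      (2ℚ ^ α) ^ K′ * (2ℚ ^ α′) ^ K                                           ≤⟨ *-mono (0≤^ K′ (0≤^ α (<⇒≤ 0<2))) (0≤^ K (0≤^ α′ (<⇒≤ 0<2)))
                                                                                  (^-monoˡ K′ (0≤^ α (<⇒≤ 0<2)) p) (^-monoˡ K (0≤^ α′ (<⇒≤ 0<2)) p′) ⟩
      (r ^ K * 2ℚ ^ β) ^ K′ * (r′ ^ K′ * 2ℚ ^ β′) ^ K                         ≡⟨ cong₂ _*_ (^-distrib-* (r ^ K) (2ℚ ^ β) K′) (^-distrib-* (r′ ^ K′) (2ℚ ^ β′) K) ⟩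
      ((r ^ K) ^ K′ * (2ℚ ^ β) ^ K′) * ((r′ ^ K′) ^ K * (2ℚ ^ β′) ^ K)        ≡⟨ cong₂ (λ x y → (x * (2ℚ ^ β) ^ K′) * (y * (2ℚ ^ β′) ^ K))
                                                                                  (^-assocʳ r K K′) (trans (^-assocʳ r′ K′ K) (cong (r′ ^_) (ℕ.*-comm K′ K))) ⟩
      (r ^ (K ℕ.* K′) * (2ℚ ^ β) ^ K′) * (r′ ^ (K ℕ.* K′) * (2ℚ ^ β′) ^ K)    ≡⟨ lem (r ^ (K ℕ.* K′)) ((2ℚ ^ β) ^ K′) (r′ ^ (K ℕ.* K′)) ((2ℚ ^ β′) ^ K) ⟩
      (r ^ (K ℕ.* K′) * r′ ^ (K ℕ.* K′)) * ((2ℚ ^ β) ^ K′ * (2ℚ ^ β′) ^ K)    ≡⟨ cong₂ _*_ (^-distrib-* r r′ (K ℕ.* K′)) (2^-+* β K′ β′ K) ⟨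
      (r * r′) ^ (K ℕ.* K′) * 2ℚ ^ (β ℕ.* K′ ℕ.+ β′ ℕ.* K)                    ∎
      where
      lem : ∀ a b c d → (a * b) * (c * d) ≡ (a * c) * (b * d)
      lem = solve-∀ ringℚ

  ≤log-^ : ∀ {l r} n → l ≤log r → ι n * l ≤log r ^ n
  ≤log-^ {l} zero l≤r = subst (_≤log 1ℚ) (sym (trans (cong (_* l) ι-0) (*-zeroˡ l))) 0≤log1
  ≤log-^ {l} {r} (suc n) l≤r = subst (_≤log r ^ suc n) (sym (trans (cong (_* l) (ι-suc n)) (lem l (ι n)))) (≤log-* l≤r (≤log-^ n l≤r))
    where
    lem : ∀ l n → (1ℚ + n) * l ≡ l + n * l
    lem = solve-∀ ringℚ

  ≤log-∏ : ∀ {A : Set} {l r : A → ℚ} → (∀ a → l a ≤log r a) → ∀ as → ∑ᴸ (map l as) ≤log ∏ᴸ (map r as)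
  ≤log-∏ l≤r [] = 0≤log1
  ≤log-∏ l≤r (a ∷ as) = ≤log-* (l≤r a) (≤log-∏ l≤r as)

  2^-cancel-≤ : ∀ {m n} → 2ℚ ^ m ≤ 2ℚ ^ n → m ℕ.≤ n
  2^-cancel-≤ {m} {n} le = ℕ.≮⇒≥ λ n<m → ℕ.<⇒≱ (ℕ.^-monoʳ-< 2 (ℕ.s≤s (ℕ.s≤s ℕ.z≤n)) n<m)
    (ι-cancel-≤ (subst₂ _≤_ (sym (ι-2^ m)) (sym (ι-2^ n)) le))
    where
    ι-2^ : ∀ n → ι (2 ℕ.^ n) ≡ 2ℚ ^ n
    ι-2^ n = trans (ι-^ 2 n) (cong (_^ n) (ι-def 2))

  -- Both sides of `power` are now powers of two, so the natural exponents can be compared and K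
  -- cancelled.
  ≤log-2^ : ∀ {l} m → l ≤log 2ℚ ^ m → l ≤ ι m
  ≤log-2^ {l} m (≤log-intro α β k e p) = *-cancelˡ (0<ι k) (subst₂ _≤_ (lem l (ι (suc k)) (ι β)) (lem (ι m) (ι (suc k)) (ι β))
    (+-monoˡ-≤ (- ι β) (begin
      l * ι (suc k) + ι β        ≤⟨ e ⟩
      ι α                        ≤⟨ ι-mono-≤ α≤ ⟩
      ι (m ℕ.* suc k ℕ.+ β)      ≡⟨ trans (ι-+ (m ℕ.* suc k) β) (cong (_+ ι β) (ι-* m (suc k))) ⟩
      ι m * ι (suc k) + ι β      ∎)))
    where
    open ≤-Reasoning
    α≤ : α ℕ.≤ m ℕ.* suc k ℕ.+ β
    α≤ = 2^-cancel-≤ (≤-trans p (≤-reflexive (sym (trans (^-homo-* 2ℚ (m ℕ.* suc k) β) (cong (_* 2ℚ ^ β) (sym (^-assocʳ 2ℚ m (suc k))))))))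
    lem : ∀ l k b → l * k + b - b ≡ k * l
    lem = solve-∀ ringℚ

  opaque
    unfolding ι

    ≤log-ℤ : ∀ {l r} a k → l ≤ a / suc k → 2^ a ≤ r ^ suc k → l ≤log r
    ≤log-ℤ {l} {r} a k l≤ p = go a (≤-trans (*-monoʳ (0≤ι (suc k)) l≤) (≤-reflexive (/-* a k))) p
      where
      open ≤-Reasoning
      go : ∀ a → l * ι (suc k) ≤ a / 1 → 2^ a ≤ r ^ suc k → l ≤log r
      go (ℤ.+ α) e p = ≤log-intro α 0 k (subst (_≤ ι α) (sym (+-identityʳ _)) e) (subst (2ℚ ^ α ≤_) (sym (*-identityʳ _)) p)
      go -[1+ n ] e p = ≤log-intro 0 (suc n) k
        (≤-trans (+-monoˡ-≤ (ι (suc n)) e) (≤-reflexive (+-inverseˡ (ι (suc n)))))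
        (begin
          1ℚ                            ≡⟨ ½^n*2^n≡1 (suc n) ⟨
          ½ ^ suc n * 2ℚ ^ suc n        ≤⟨ *-monoʳ (0≤^ (suc n) (<⇒≤ 0<2)) p ⟩
          r ^ suc k * 2ℚ ^ suc n        ∎)

  private
    opaque
      unfolding ι

      2^-⊖ : ∀ α β → ∃[ a ] (2^ a) * 2ℚ ^ β ≡ 2ℚ ^ α × a / 1 + ι β ≡ ι α
      2^-⊖ α zero = ℤ.+ α , *-identityʳ _ , +-identityʳ _
      2^-⊖ zero (suc β) = -[1+ β ] , ½^n*2^n≡1 (suc β) , +-inverseˡ (ι (suc β))
      2^-⊖ (suc α) (suc β) =
        let a , eq , eq′ = 2^-⊖ α β
        in a , trans (lem (2^ a) 2ℚ (2ℚ ^ β)) (cong (2ℚ *_) eq)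
             , trans (cong (λ x → a / 1 + x) (ι-suc β)) (trans (lem′ (a / 1) (ι β)) (trans (cong (λ x → 1ℚ + x) eq′) (sym (ι-suc α))))
        where
        lem : ∀ a t b → a * (t * b) ≡ t * (a * b)
        lem = solve-∀ ringℚ
        lem′ : ∀ a b → a + (1ℚ + b) ≡ 1ℚ + (a + b)
        lem′ = solve-∀ ringℚ

      fraction : ∀ l → ∃[ α ] ∃[ β ] ∃[ d ] l * ι (suc d) + ι β ≡ ι α
      fraction l@(mkℚ (ℤ.+ n) d _) = n , 0 , d , trans (+-identityʳ _) (trans (cong (_* ι (suc d)) (sym (↥p/↧p≡p l))) (/-* (ℤ.+ n) d))
      fraction l@(mkℚ -[1+ n ] d _) = 0 , suc n , d ,
        trans (cong (_+ ι (suc n)) (trans (cong (_* ι (suc d)) (sym (↥p/↧p≡p l))) (/-* -[1+ n ] d))) (+-inverseˡ (ι (suc n)))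

  -- If K (l + h) is an integer and p^K > 2^(K (l + h)), then by Bernoulli's
  -- inequality the rational p (1 - 1/(2 K)) < p has logarithm above l + h - 1/K.
  ≤log-1/ : ∀ {p q l h} → 0ℚ < p → 0ℚ < q → p * q ≡ 1ℚ → 0ℚ < h →
    (∀ a k r → r < p → 0ℚ < r → 2^ a ≤ r ^ suc k → a / suc k ≤ l) →
    - (l + h) ≤log q
  ≤log-1/ {p} {q} {l} {h} 0<p 0<q pq≡1 0<h bound = helper (p ^ K * 2ℚ ^ β ≤? 2ℚ ^ α)
    where
    frac = fraction (l + h)
    α₀ = proj₁ frac
    β₀ = proj₁ (proj₂ frac)
    d  = proj₁ (proj₂ (proj₂ frac))
    eq₀ = proj₂ (proj₂ (proj₂ frac))
    arch = archimedes-* {h} 2ℚ 0<h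
    N = proj₁ arch
    2≤hN = proj₂ arch
    open ≤-Reasoning
    N+1 = suc N
    k = N ℕ.+ d ℕ.* N+1
    -- The denominator d + 1 of l + h makes K (l + h) an integer; the factor N + 1 in addition gives
    -- h K ≥ 2.
    K = suc d ℕ.* N+1
    α = α₀ ℕ.* N+1
    β = β₀ ℕ.* N+1
    L = l + h

    eq : L * ι K + ι β ≡ ι α
    eq = begin-equality
      L * ι K + ι β                                  ≡⟨ cong₂ (λ x y → L * x + y) (ι-* (suc d) N+1) (ι-* β₀ N+1) ⟩
      L * (ι (suc d) * ι N+1) + ι β₀ * ι N+1         ≡⟨ lem L (ι (suc d)) (ι N+1) (ι β₀) ⟩
      (L * ι (suc d) + ι β₀) * ι N+1                 ≡⟨ cong (_* ι N+1) eq₀ ⟩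
      ι α₀ * ι N+1                                   ≡⟨ ι-* α₀ N+1 ⟨
      ι α                                            ∎
      where
      lem : ∀ l d n b → l * (d * n) + b * n ≡ (l * d + b) * n
      lem = solve-∀ ringℚ

    2≤hK : 2ℚ ≤ h * ι K
    2≤hK = ≤-trans 2≤hN (*-monoˡ (<⇒≤ 0<h) (ι-mono-≤ (ℕ.m≤n*m N+1 (suc d))))

    helper : Dec (p ^ K * 2ℚ ^ β ≤ 2ℚ ^ α) → - L ≤log q
    helper (yes le) = ≤log-intro β α k
      (≤-reflexive (trans (cong (λ x → - L * ι K + x) (sym eq)) (lem L (ι K) (ι β))))
      (begin
        2ℚ ^ β                        ≡⟨ *-identityˡ _ ⟨
        1ℚ * 2ℚ ^ β                   ≡⟨ cong (_* 2ℚ ^ β) (1^n≡1 K) ⟨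
        1ℚ ^ K * 2ℚ ^ β               ≡⟨ cong (λ x → x ^ K * 2ℚ ^ β) (trans (*-comm q p) pq≡1) ⟨
        (q * p) ^ K * 2ℚ ^ β          ≡⟨ cong (_* 2ℚ ^ β) (^-distrib-* q p K) ⟩
        q ^ K * p ^ K * 2ℚ ^ β        ≡⟨ *-assoc (q ^ K) (p ^ K) (2ℚ ^ β) ⟩
        q ^ K * (p ^ K * 2ℚ ^ β)      ≤⟨ *-monoˡ (0≤^ K (<⇒≤ 0<q)) le ⟩
        q ^ K * 2ℚ ^ α                ∎)
      where
      lem : ∀ l k b → - l * k + (l * k + b) ≡ b
      lem = solve-∀ ringℚ
    helper (no ≰) =
      -- The exponent is one lower than K (l + h), which pays for the factor ½ lost to Bernoulli's
      -- inequality. The hypothesis `bound` then yields K (l + h) - 1 ≤ K l, that is h K ≤ 1,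
      -- against h K ≥ 2.
      let a , eqₐ , eqₐ′ = 2^-⊖ α (suc β)
          s , 0<s , Ks≡1 = inv (0<ι k)
          η = s * ½
          0<η = 0<* 0<s (positive⁻¹ ½)
          Kη : ι K * η ≡ ½
          Kη = trans (sym (*-assoc (ι K) s ½)) (trans (cong (_* ½) Ks≡1) (*-identityˡ ½))
          s≤1 : s ≤ 1ℚ
          s≤1 = *-cancelˡ (0<ι k) (subst₂ _≤_ (trans (ι-def 1) (sym Ks≡1)) (sym (*-identityʳ (ι K))) (ι-mono-≤ {1} (ℕ.s≤s ℕ.z≤n)))
          η≤½ : η ≤ ½
          η≤½ = subst (η ≤_) (*-identityˡ ½) (*-monoʳ 0≤½ s≤1)
          r = p * (1ℚ - η)
          0<r : 0ℚ < r
          0<r = 0<* 0<p (p<q⇒0<q-p (≤-<-trans η≤½ (<-by ½ (positive⁻¹ ½) refl)))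
          r<p : r < p
          r<p = <-by (p * η) (0<* 0<p 0<η) (lem₁ p η)
          half : ½ * p ^ K ≤ r ^ K
          half = begin
            ½ * p ^ K                          ≡⟨ cong (λ x → (1ℚ - x) * p ^ K) Kη ⟨
            (1ℚ - ι K * η) * p ^ K             ≤⟨ *-monoʳ (0≤^ K (<⇒≤ 0<p)) (bernoulli K (<⇒≤ 0<η) (≤-trans η≤½ (≤-by ½ 0≤½ refl))) ⟩
            (1ℚ - η) ^ K * p ^ K               ≡⟨ *-comm ((1ℚ - η) ^ K) (p ^ K) ⟩
            p ^ K * (1ℚ - η) ^ K               ≡⟨ ^-distrib-* p (1ℚ - η) K ⟨
            r ^ K                              ∎
          power : 2^ a ≤ r ^ K
          power = *-cancelˡ (0<^ (suc β) 0<2) (begin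
            2ℚ ^ suc β * 2^ a                  ≡⟨ *-comm (2ℚ ^ suc β) (2^ a) ⟩
            (2^ a) * 2ℚ ^ suc β                ≡⟨ eqₐ ⟩
            2ℚ ^ α                             ≤⟨ <⇒≤ (≰⇒> ≰) ⟩
            p ^ K * 2ℚ ^ β                     ≡⟨ lem₂ (p ^ K) (2ℚ ^ β) ⟩
            2ℚ ^ suc β * (½ * p ^ K)           ≤⟨ *-monoˡ (0≤^ (suc β) (<⇒≤ 0<2)) half ⟩
            2ℚ ^ suc β * r ^ K                 ∎)
          a≤lK : a / 1 ≤ l * ι K
          a≤lK = ≤-trans (≤-reflexive (sym (/-* a k))) (*-monoʳ (0≤ι K) (bound a k r r<p 0<r power))
          a≡ : a / 1 ≡ L * ι K - 1ℚ
          a≡ = begin-equality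
            a / 1                              ≡⟨ lem₃ (a / 1) (ι β) ⟩
            a / 1 + (1ℚ + ι β) - (1ℚ + ι β)    ≡⟨ cong (λ x → a / 1 + x - (1ℚ + ι β)) (ι-suc β) ⟨
            a / 1 + ι (suc β) - (1ℚ + ι β)     ≡⟨ cong (_- (1ℚ + ι β)) (trans eqₐ′ (sym eq)) ⟩
            L * ι K + ι β - (1ℚ + ι β)         ≡⟨ lem₄ (L * ι K) (ι β) ⟩
            L * ι K - 1ℚ                       ∎
          2≤1 : 2ℚ ≤ 1ℚ
          2≤1 = begin
            2ℚ                                 ≤⟨ 2≤hK ⟩
            h * ι K                            ≡⟨ lem₅ l h (ι K) ⟩
            (L * ι K - 1ℚ) + (1ℚ - l * ι K)    ≡⟨ cong (_+ (1ℚ - l * ι K)) a≡ ⟨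
            a / 1 + (1ℚ - l * ι K)             ≤⟨ +-monoˡ-≤ (1ℚ - l * ι K) a≤lK ⟩
            l * ι K + (1ℚ - l * ι K)           ≡⟨ lem₆ (l * ι K) ⟩
            1ℚ                                 ∎
      in contradiction (<-by 1ℚ 0<1 refl) (≤⇒≯ 2≤1)
      where
      lem₁ : ∀ p η → p * (1ℚ - η) + p * η ≡ p
      lem₁ = solve-∀ ringℚ
      lem₂ : ∀ p t → p * t ≡ 2ℚ * t * (½ * p)
      lem₂ = solve-∀ ringℚ
      lem₃ : ∀ a b → a ≡ a + (1ℚ + b) - (1ℚ + b)
      lem₃ = solve-∀ ringℚ
      lem₄ : ∀ a b → a + b - (1ℚ + b) ≡ a - 1ℚ
      lem₄ = solve-∀ ringℚ
      lem₅ : ∀ l h k → h * k ≡ ((l + h) * k - 1ℚ) + (1ℚ - l * k)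
      lem₅ = solve-∀ ringℚ
      lem₆ : ∀ a → a + (1ℚ - a) ≡ 1ℚ
      lem₆ = solve-∀ ringℚ

  -- Finite sums and averaging

  sum-mono : ∀ {n} {f g : Fin n → ℚ} → (∀ i → f i ≤ g i) → sum f ≤ sum g
  sum-mono {zero} f≤g = ≤-refl
  sum-mono {suc n} f≤g = +-mono-≤ (f≤g zero) (sum-mono (f≤g ∘ suc))

  0≤sum : ∀ {n} {f : Fin n → ℚ} → (∀ i → 0ℚ ≤ f i) → 0ℚ ≤ sum f
  0≤sum {zero} 0≤f = ≤-refl
  0≤sum {suc n} 0≤f = 0≤+ (0≤f zero) (0≤sum (0≤f ∘ suc))

  term≤sum : ∀ {n} {f : Fin n → ℚ} → (∀ i → 0ℚ ≤ f i) → ∀ i → f i ≤ sum f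
  term≤sum {suc n} {f} 0≤f zero = ≤-by (sum (f ∘ suc)) (0≤sum (0≤f ∘ suc)) refl
  term≤sum {suc n} {f} 0≤f (suc i) = ≤-trans (term≤sum (0≤f ∘ suc) i)
    (≤-by (f zero) (0≤f zero) (+-comm (sum (f ∘ suc)) (f zero)))

  sum-const : ∀ n c → sum {n} (λ _ → c) ≡ ι n * c
  sum-const zero c = sym (trans (cong (_* c) ι-0) (*-zeroˡ c))
  sum-const (suc n) c = trans (cong (c +_) (sum-const n c)) (trans (lem c (ι n)) (cong (_* c) (sym (ι-suc n))))
    where
    lem : ∀ c n → c + n * c ≡ (1ℚ + n) * c
    lem = solve-∀ ringℚ

  ∏-mono : ∀ {n} {f g : Fin n → ℚ} → (∀ i → 0ℚ ≤ f i) → (∀ i → f i ≤ g i) → ∏ f ≤ ∏ g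
  ∏-mono {zero} 0≤f f≤g = ≤-refl
  ∏-mono {suc n} {f} 0≤f f≤g = *-mono (0≤f zero) (0≤∏ (0≤f ∘ suc)) (f≤g zero) (∏-mono (0≤f ∘ suc) (f≤g ∘ suc))
    where
    0≤∏ : ∀ {n} {f : Fin n → ℚ} → (∀ i → 0ℚ ≤ f i) → 0ℚ ≤ ∏ f
    0≤∏ {zero} 0≤f = 0≤1
    0≤∏ {suc n} 0≤f = 0≤* (0≤f zero) (0≤∏ (0≤f ∘ suc))

  ∏-^ : ∀ {n} (f : Fin n → ℚ) k → ∏ f ^ k ≡ ∏ (λ i → f i ^ k)
  ∏-^ {zero} f k = 1^n≡1 k
  ∏-^ {suc n} f k = trans (^-distrib-* (f zero) (∏ (f ∘ suc)) k) (cong (f zero ^ k *_) (∏-^ (f ∘ suc) k))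

  ⟦_⟧ : ∀ {A : Set} → Dec A → ℚ
  ⟦ a? ⟧ = if does a? then 1ℚ else 0ℚ

  module _ {A : Set} where
    ⟦⟧-yes : (a? : Dec A) → A → ⟦ a? ⟧ ≡ 1ℚ
    ⟦⟧-yes (yes _) a = refl
    ⟦⟧-yes (no ¬a) a = contradiction a ¬a

    ⟦⟧-no : (a? : Dec A) → ¬ A → ⟦ a? ⟧ ≡ 0ℚ
    ⟦⟧-no (yes a) ¬a = contradiction a ¬a
    ⟦⟧-no (no _) ¬a = refl

    0≤⟦⟧ : (a? : Dec A) → 0ℚ ≤ ⟦ a? ⟧
    0≤⟦⟧ (yes _) = 0≤1
    0≤⟦⟧ (no _) = ≤-refl

  sum-≟ : ∀ {n} (y : Fin n) (f : Fin n → ℚ) → sum (λ x → ⟦ x Fin.≟ y ⟧ * f x) ≡ f y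
  sum-≟ {suc n} zero f = trans (cong₂ _+_ (*-identityˡ (f zero))
    (trans (sum-cong-≗ (λ x → *-zeroˡ (f (suc x)))) (sum-replicate-zero n))) (+-identityʳ (f zero))
  sum-≟ {suc n} (suc y) f = trans (cong₂ _+_ (*-zeroˡ (f zero)) (sum-≟ y (f ∘ suc))) (+-identityˡ (f (suc y)))

  ∏-ones : ∀ n → ∏ {n} (λ _ → 1ℚ) ≡ 1ℚ
  ∏-ones zero = refl
  ∏-ones (suc n) = trans (*-identityˡ _) (∏-ones n)

  ∏-≟ : ∀ {n} (y : Fin n) v → ∏ (λ x → if does (y Fin.≟ x) then v else 1ℚ) ≡ v
  ∏-≟ {suc n} zero v = trans (cong (v *_) (∏-ones n)) (*-identityʳ v)
  ∏-≟ {suc n} (suc y) v = trans (*-identityˡ _) (∏-≟ y v)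

  unused : ∀ {u} (used : List (Fin u)) → ι u ≤ sum (λ x → ⟦ ¬? (∈-dec Fin._≟_ x used) ⟧) + ι (length used)
  unused {u} [] = ≤-reflexive (sym (trans (trans (cong (sum {u} (λ _ → 1ℚ) +_) ι-0) (+-identityʳ _)) (trans (sum-const u 1ℚ) (*-identityʳ (ι u)))))
  unused {u} (y ∷ ys) = begin
    ι u                                                                         ≤⟨ unused ys ⟩
    sum (new ys) + ι (length ys)                                                ≤⟨ +-monoˡ-≤ (ι (length ys)) (sum-mono step) ⟩
    sum (λ x → new (y ∷ ys) x + ⟦ x Fin.≟ y ⟧ * 1ℚ) + ι (length ys)             ≡⟨ cong (_+ ι (length ys)) (∑-distrib-+ (new (y ∷ ys)) (λ x → ⟦ x Fin.≟ y ⟧ * 1ℚ)) ⟩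
    sum (new (y ∷ ys)) + sum (λ x → ⟦ x Fin.≟ y ⟧ * 1ℚ) + ι (length ys)         ≡⟨ cong (λ d → sum (new (y ∷ ys)) + d + ι (length ys)) (sum-≟ y (λ _ → 1ℚ)) ⟩
    sum (new (y ∷ ys)) + 1ℚ + ι (length ys)                                     ≡⟨ +-assoc (sum (new (y ∷ ys))) 1ℚ (ι (length ys)) ⟩
    sum (new (y ∷ ys)) + (1ℚ + ι (length ys))                                   ≡⟨ cong (sum (new (y ∷ ys)) +_) (ι-suc (length ys)) ⟨
    sum (new (y ∷ ys)) + ι (suc (length ys))                                    ∎
    where
    open ≤-Reasoning
    new : List (Fin u) → Fin u → ℚ
    new used x = ⟦ ¬? (∈-dec Fin._≟_ x used) ⟧
    step : ∀ x → new ys x ≤ new (y ∷ ys) x + ⟦ x Fin.≟ y ⟧ * 1ℚ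
    step x with x Fin.≟ y | ∈-dec Fin._≟_ x ys
    ... | yes _ | yes _ = 0≤1
    ... | yes _ | no _  = ≤-refl
    ... | no _  | yes _ = ≤-refl
    ... | no _  | no _  = ≤-refl

  below-average : ∀ {u} (h : Fin u → ℚ) → (∀ x → 0ℚ ≤ h x) → ∀ used v →
    suc v ℕ.+ length used ℕ.≤ u → ∃[ x ] x ∉ used × ι (suc v) * h x ≤ sum h
  below-average {u} h 0≤h used v le
    with Fin.any? (λ x → ¬? (∈-dec Fin._≟_ x used) ×-dec (ι (suc v) * h x ≤? sum h))
  ... | yes found = found
  ... | no none = contradiction (0<ι v) (≤⇒≯ none-new)
    where
    open ≤-Reasoning
    H = sum h
    v+1 = suc v
    new : Fin u → ℚ
    new x = ⟦ ¬? (∈-dec Fin._≟_ x used) ⟧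
    many : ι v+1 ≤ sum new
    many = subst₂ _≤_ (lem (ι v+1) (ι (length used))) (lem (sum new) (ι (length used)))
      (+-monoˡ-≤ (- ι (length used)) (≤-trans (≤-reflexive (sym (ι-+ v+1 (length used))))
        (≤-trans (ι-mono-≤ le) (unused used))))
      where
      lem : ∀ a b → a + b - b ≡ a
      lem = solve-∀ ringℚ
    excess : Fin u → ℚ
    excess x = ι v+1 * h x + - H * new x
    0≤excess : ∀ x → 0ℚ ≤ excess x
    0≤excess x = helper (∈-dec Fin._≟_ x used)
      where
      helper : Dec (x ∈ used) → 0ℚ ≤ excess x
      helper (yes x∈) rewrite ⟦⟧-no (¬? (∈-dec Fin._≟_ x used)) (λ x∉ → x∉ x∈) =
        subst (0ℚ ≤_) (sym (trans (cong (ι v+1 * h x +_) (*-zeroʳ (- H))) (+-identityʳ _))) (0≤* (0≤ι v+1) (0≤h x))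
      helper (no x∉) rewrite ⟦⟧-yes (¬? (∈-dec Fin._≟_ x used)) x∉ =
        subst (0ℚ ≤_) (cong (ι v+1 * h x +_) (sym (*-identityʳ (- H))))
          (p≤q⇒0≤q-p (<⇒≤ (≰⇒> (λ ≤H → none (x , x∉ , ≤H)))))
    sum-excess : sum excess ≤ 0ℚ
    sum-excess = begin
      sum excess                                       ≡⟨ ∑-distrib-+ (λ x → ι v+1 * h x) (λ x → - H * new x) ⟩
      sum (λ x → ι v+1 * h x) + sum (λ x → - H * new x) ≡⟨ cong₂ _+_ (*-distribˡ-sum (ι v+1) h) (*-distribˡ-sum (- H) new) ⟨
      ι v+1 * H + - H * sum new                        ≤⟨ ≤-by _ (0≤* (0≤sum 0≤h) (p≤q⇒0≤q-p many)) (lem (ι v+1) H (sum new)) ⟩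
      0ℚ                                               ∎
      where
      lem : ∀ v h n → v * h + - h * n + h * (n - v) ≡ 0ℚ
      lem = solve-∀ ringℚ
    none-new : ι v+1 ≤ 0ℚ
    none-new = ≤-trans many (≤-trans (sum-mono new≤0) (≤-reflexive (sum-replicate-zero u)))
      where
      new≤0 : ∀ x → new x ≤ 0ℚ
      new≤0 x = helper (∈-dec Fin._≟_ x used)
        where
        helper : Dec (x ∈ used) → new x ≤ 0ℚ
        helper (yes x∈) = ≤-reflexive (⟦⟧-no (¬? (∈-dec Fin._≟_ x used)) (λ x∉ → x∉ x∈))
        helper (no x∉) = contradiction (x , x∉ , p≤) none
          where
          p≤ : ι v+1 * h x ≤ H
          p≤ = subst₂ _≤_ (lem (ι v+1 * h x) H) (+-identityˡ H)
            (+-monoˡ-≤ H (≤-trans (≤-reflexive (cong (λ d → ι v+1 * h x + - H * d) (sym (⟦⟧-yes (¬? (∈-dec Fin._≟_ x used)) x∉))))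
              (≤-trans (term≤sum 0≤excess x) sum-excess)))
            where
            lem : ∀ a h → a + - h * 1ℚ + h ≡ a
            lem = solve-∀ ringℚ

  -- Greedy choice of the keys

  module _ {C : Set} {u N : ℕ} (w : C → Fin N → Fin u → ℚ) (0≤w : ∀ c s x → 0ℚ ≤ w c s x) where

    weight : Fin N → List (C × Fin u) → ℚ
    weight s = ∏ᴸ ∘ map (λ (c , x) → w c s x)

    total : Fin N → List C → ℚ
    total s = ∏ᴸ ∘ map (λ c → sum (w c s))

    0≤total : ∀ s cs → 0ℚ ≤ total s cs
    0≤total s [] = 0≤1
    0≤total s (c ∷ cs) = 0≤* (0≤sum (0≤w c s)) (0≤total s cs)

    -- The elements are chosen one after the other, each time below the average
    -- of the remaining potential Σₛ t(s) Π w.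
    greedy : ∀ v cs used (t : Fin N → ℚ) → (∀ s → 0ℚ ≤ t s) →
      suc v ℕ.+ (length cs ℕ.+ length used) ℕ.≤ u →
      ∃[ ps ] map proj₁ ps ≡ cs × AllPairs (λ p q → proj₂ p ≢ proj₂ q) ps × All (λ p → proj₂ p ∉ used) ps ×
        ι (suc v) ^ length cs * sum (λ s → t s * weight s ps) ≤ sum (λ s → t s * total s cs)
    greedy v [] used t 0≤t le = [] , refl , [] , [] , ≤-reflexive (*-identityˡ _)
    greedy v (c ∷ cs) used t 0≤t le =
      let x , x∉ , average = below-average h 0≤h used v (ℕ.≤-trans (ℕ.+-monoʳ-≤ (suc v) (ℕ.m≤n+m (length used) (suc (length cs)))) le)
          ps , eq , distinct , fresh , bound = greedy v cs (x ∷ used) (λ s → t s * w c s x) (λ s → 0≤* (0≤t s) (0≤w c s x))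
            (subst (ℕ._≤ u) (cong (suc v ℕ.+_) (sym (ℕ.+-suc (length cs) (length used)))) le)
      in (c , x) ∷ ps , cong (c ∷_) eq , new fresh ∷ distinct , x∉ ∷ old fresh , (begin
        ι v+1 * ι v+1 ^ length cs * sum (λ s → t s * (w c s x * weight s ps))        ≡⟨ *-assoc (ι v+1) (ι v+1 ^ length cs) _ ⟩
        ι v+1 * (ι v+1 ^ length cs * sum (λ s → t s * (w c s x * weight s ps)))      ≡⟨ cong (λ y → ι v+1 * (ι v+1 ^ length cs * y)) (sum-cong-≗ (λ s → sym (*-assoc (t s) (w c s x) (weight s ps)))) ⟩
        ι v+1 * (ι v+1 ^ length cs * sum (λ s → t s * w c s x * weight s ps))        ≤⟨ *-monoˡ (0≤ι v+1) bound ⟩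
        ι v+1 * h x                                                                  ≤⟨ average ⟩
        sum h                                                                        ≡⟨ ∑-comm (λ x s → t s * w c s x * total s cs) ⟩
        sum (λ s → sum (λ x → t s * w c s x * total s cs))                           ≡⟨ sum-cong-≗ factor ⟩
        sum (λ s → t s * (sum (w c s) * total s cs))                                 ∎)
      where
      open ≤-Reasoning
      v+1 = suc v
      h : Fin u → ℚ
      h x = sum (λ s → t s * w c s x * total s cs)
      0≤h : ∀ x → 0ℚ ≤ h x
      0≤h x = 0≤sum (λ s → 0≤* (0≤* (0≤t s) (0≤w c s x)) (0≤total s cs))
      factor : ∀ s → sum (λ x → t s * w c s x * total s cs) ≡ t s * (sum (w c s) * total s cs)
      factor s = trans (sym (*-distribʳ-sum (total s cs) (λ x → t s * w c s x)))
        (trans (cong (_* total s cs) (sym (*-distribˡ-sum (t s) (w c s)))) (*-assoc (t s) (sum (w c s)) (total s cs)))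
      new : ∀ {x ps} → All (λ p → proj₂ p ∉ x ∷ used) ps → All (λ p → x ≢ proj₂ p) ps
      new [] = []
      new (∉ ∷ ∉s) = (λ eq → ∉ (here (sym eq))) ∷ new ∉s
      old : ∀ {x ps} → All (λ p → proj₂ p ∉ x ∷ used) ps → All (λ p → proj₂ p ∉ used) ps
      old [] = []
      old (∉ ∷ ∉s) = (λ ∈ → ∉ (there ∈)) ∷ old ∉s

  -- Counting, and maps given by lists of keys

  ι-# : ∀ {u} {P : Pred (Fin u) 0ℓ} (P? : Decidable P) → ι (# P?) ≡ sum (λ x → ⟦ P? x ⟧)
  ι-# {u} P? = go id
    where
    go : ∀ {n} (f : Fin n → Fin u) → ι (count P? (tabulate f)) ≡ sum (λ i → ⟦ P? (f i) ⟧)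
    go {zero} f = ι-0
    go {suc n} f with does (P? (f zero))
    ... | true = trans (ι-suc (count P? (tabulate (f ∘ suc)))) (cong (1ℚ +_) (go (f ∘ suc)))
    ... | false = trans (go (f ∘ suc)) (sym (+-identityˡ _))

  module _ {b u : ℕ} where

    asMap : List (Fin b × Fin u) → Fin u → Maybe (Fin b)
    asMap [] x = nothing
    asMap ((c , y) ∷ ps) x = if does (x Fin.≟ y) then just c else asMap ps x

    asMap-fresh : ∀ {y} ps → All (λ p → y ≢ proj₂ p) ps → asMap ps y ≡ nothing
    asMap-fresh [] [] = refl
    asMap-fresh {y} ((c , x) ∷ ps) (y≢x ∷ fresh) with y Fin.≟ x
    ... | yes y≡x = contradiction y≡x y≢x
    ... | no _ = asMap-fresh ps fresh

    -- A single identity for all counts that are needed: `r` will be the indicator of the domain, of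
    -- a class, or of the wrong or missing answers in a class. Each of these vanishes outside the
    -- keys.
    sum-asMap : ∀ (r : Fin u → Maybe (Fin b) → ℚ) → (∀ x → r x nothing ≡ 0ℚ) →
      ∀ ps → AllPairs (λ p q → proj₂ p ≢ proj₂ q) ps →
      sum (λ x → r x (asMap ps x)) ≡ ∑ᴸ (map (λ (c , x) → r x (just c)) ps)
    sum-asMap r r≡0 [] [] = trans (sum-cong-≗ r≡0) (sum-replicate-zero u)
    sum-asMap r r≡0 ((c , y) ∷ ps) (fresh ∷ distinct) = begin
      sum (λ x → r x (asMap ((c , y) ∷ ps) x))                                       ≡⟨ sum-cong-≗ split ⟩
      sum (λ x → ⟦ x Fin.≟ y ⟧ * r x (just c) + r x (asMap ps x))                    ≡⟨ ∑-distrib-+ (λ x → ⟦ x Fin.≟ y ⟧ * r x (just c)) (λ x → r x (asMap ps x)) ⟩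
      sum (λ x → ⟦ x Fin.≟ y ⟧ * r x (just c)) + sum (λ x → r x (asMap ps x))        ≡⟨ cong₂ _+_ (sum-≟ y (λ x → r x (just c))) (sum-asMap r r≡0 ps distinct) ⟩
      r y (just c) + ∑ᴸ (map (λ (c , x) → r x (just c)) ps)                          ∎
      where
      open ≡-Reasoning
      split : ∀ x → r x (asMap ((c , y) ∷ ps) x) ≡ ⟦ x Fin.≟ y ⟧ * r x (just c) + r x (asMap ps x)
      split x with x Fin.≟ y
      ... | no _ = sym (trans (cong (_+ r x (asMap ps x)) (*-zeroˡ (r x (just c)))) (+-identityˡ _))
      ... | yes refl = sym (trans (cong₂ _+_ (*-identityˡ (r x (just c))) (trans (cong (r x) (asMap-fresh ps fresh)) (r≡0 x))) (+-identityʳ _))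

    module _ {ps : List (Fin b × Fin u)} (distinct : AllPairs (λ p q → proj₂ p ≢ proj₂ q) ps) where

      #dom-asMap : # (≢⊥? (asMap ps)) ≡ length ps
      #dom-asMap = ι-injective (trans (ι-# (≢⊥? (asMap ps)))
        (trans (sum-asMap (λ _ τ → ⟦ ¬? (≡-dec Fin._≟_ τ nothing) ⟧) (λ _ → refl) ps distinct) (ones ps)))
        where
        ones : ∀ (ps : List (Fin b × Fin u)) → ∑ᴸ (map (λ _ → 1ℚ) ps) ≡ ι (length ps)
        ones [] = sym ι-0
        ones (p ∷ ps) = trans (cong (1ℚ +_) (ones ps)) (sym (ι-suc (length ps)))

      #class-asMap : ∀ i → ι (# (≡? (asMap ps) i)) ≡ ∑ᴸ (map (λ c → ⟦ c Fin.≟ i ⟧) (map proj₁ ps))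
      #class-asMap i = trans (ι-# (≡? (asMap ps) i))
        (trans (sum-asMap (λ _ τ → ⟦ ≡-dec Fin._≟_ τ (just i) ⟧) (λ _ → refl) ps distinct) (classes ps))
        where
        classes : ∀ ps → ∑ᴸ (map (λ (c , x) → ⟦ c Fin.≟ i ⟧) ps) ≡ ∑ᴸ (map (λ c → ⟦ c Fin.≟ i ⟧) (map proj₁ ps))
        classes [] = refl
        classes (p ∷ ps) = cong (⟦ proj₁ p Fin.≟ i ⟧ +_) (classes ps)

  ≟-sym : ∀ {n} (i j : Fin n) → ⟦ i Fin.≟ j ⟧ ≡ ⟦ j Fin.≟ i ⟧
  ≟-sym i j with j Fin.≟ i
  ... | yes refl = ⟦⟧-yes (i Fin.≟ i) refl
  ... | no j≢i = ⟦⟧-no (i Fin.≟ j) (j≢i ∘ sym)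

  sum-by-class : ∀ {b} (f : Fin b → ℚ) cs → ∑ᴸ (map f cs) ≡ sum (λ i → ∑ᴸ (map (λ c → ⟦ c Fin.≟ i ⟧) cs) * f i)
  sum-by-class {b} f [] = sym (trans (sum-cong-≗ (λ i → *-zeroˡ (f i))) (sum-replicate-zero b))
  sum-by-class f (c ∷ cs) = begin
    f c + ∑ᴸ (map f cs)                                              ≡⟨ cong₂ _+_ (sym (sum-≟ c f)) (sum-by-class f cs) ⟩
    sum (λ i → ⟦ i Fin.≟ c ⟧ * f i) + sum (λ i → occ i * f i)        ≡⟨ ∑-distrib-+ (λ i → ⟦ i Fin.≟ c ⟧ * f i) (λ i → occ i * f i) ⟨
    sum (λ i → ⟦ i Fin.≟ c ⟧ * f i + occ i * f i)                    ≡⟨ sum-cong-≗ (λ i → trans (sym (*-distribʳ-+ (f i) ⟦ i Fin.≟ c ⟧ (occ i))) (cong (λ d → (d + occ i) * f i) (≟-sym i c))) ⟩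
    sum (λ i → (⟦ c Fin.≟ i ⟧ + occ i) * f i)                        ∎
    where
    open ≡-Reasoning
    occ : _ → ℚ
    occ i = ∑ᴸ (map (λ c → ⟦ c Fin.≟ i ⟧) cs)

  ∏-by-class : ∀ {A : Set} {b} (class : A → Fin b) (f : A → ℚ) as →
    ∏ᴸ (map f as) ≡ ∏ (λ i → ∏ᴸ (map (λ a → if does (class a Fin.≟ i) then f a else 1ℚ) as))
  ∏-by-class {b = b} class f [] = sym (∏-ones b)
  ∏-by-class class f (a ∷ as) = trans (cong₂ _*_ (sym (∏-≟ (class a) (f a))) (∏-by-class class f as))
    (sym (∏-distrib-* (λ i → if does (class a Fin.≟ i) then f a else 1ℚ) (λ i → ∏ᴸ (map (λ a → if does (class a Fin.≟ i) then f a else 1ℚ) as))))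

  classList : ∀ {b} (k : Fin b → ℕ) → ∃[ cs ] length cs ≡ ℕΣ.sum k × ∀ i → ∑ᴸ (map (λ c → ⟦ c Fin.≟ i ⟧) cs) ≡ ι (k i)
  classList {zero} k = [] , refl , λ ()
  classList {suc b} k =
    let cs , len , occ = classList (k ∘ suc)
    in replicates (k zero) cs , trans (length-replicates (k zero) cs) (cong (k zero ℕ.+_) len) , λ where
      zero → trans (occ-replicates (k zero) cs zero) (trans (cong₂ _+_ (*-identityʳ (ι (k zero))) (occ-zero cs)) (+-identityʳ _))
      (suc i) → trans (occ-replicates (k zero) cs (suc i)) (trans (cong₂ _+_ (*-zeroʳ (ι (k zero))) (trans (occ-suc cs i) (occ i))) (+-identityˡ _))
    where
    replicates : ∀ n → List (Fin b) → List (Fin (suc b))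
    replicates zero cs = map suc cs
    replicates (suc n) cs = zero ∷ replicates n cs
    length-replicates : ∀ n cs → length (replicates n cs) ≡ n ℕ.+ length cs
    length-replicates zero [] = refl
    length-replicates zero (c ∷ cs) = cong suc (length-replicates zero cs)
    length-replicates (suc n) cs = cong suc (length-replicates n cs)
    occurrences : ∀ {b} → List (Fin b) → Fin b → ℚ
    occurrences cs i = ∑ᴸ (map (λ c → ⟦ c Fin.≟ i ⟧) cs)
    occ-replicates : ∀ n cs i → occurrences (replicates n cs) i ≡ ι n * ⟦ zero {b} Fin.≟ i ⟧ + occurrences (map suc cs) i
    occ-replicates zero cs i = sym (trans (cong (_+ occurrences (map suc cs) i) (trans (cong (_* ⟦ zero {b} Fin.≟ i ⟧) ι-0) (*-zeroˡ ⟦ zero {b} Fin.≟ i ⟧))) (+-identityˡ _))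
    occ-replicates (suc n) cs i = trans (cong (⟦ zero {b} Fin.≟ i ⟧ +_) (occ-replicates n cs i))
      (trans (lem ⟦ zero {b} Fin.≟ i ⟧ (ι n) (occurrences (map suc cs) i)) (cong (λ m → m * ⟦ zero {b} Fin.≟ i ⟧ + occurrences (map suc cs) i) (sym (ι-suc n))))
      where
      lem : ∀ d n o → d + (n * d + o) ≡ (1ℚ + n) * d + o
      lem = solve-∀ ringℚ
    occ-zero : ∀ cs → occurrences (map suc cs) (zero {b}) ≡ 0ℚ
    occ-zero [] = refl
    occ-zero (c ∷ cs) = trans (+-identityˡ _) (occ-zero cs)
    occ-suc : ∀ cs (i : Fin b) → occurrences (map suc cs) (suc i) ≡ occurrences cs i
    occ-suc [] i = refl
    occ-suc (c ∷ cs) i = cong (⟦ c Fin.≟ i ⟧ +_) (occ-suc cs i)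

  -- Enumeration of bit strings

  private
    toBool : Fin 2 → Bool
    toBool zero = false
    toBool (suc zero) = true

    fromBool : Bool → Fin 2
    fromBool false = zero
    fromBool true = suc zero

    toBool-fromBool : ∀ c → toBool (fromBool c) ≡ c
    toBool-fromBool false = refl
    toBool-fromBool true = refl

  strings : ∀ m → Fin (2 ℕ.^ m) → Vec Bool m
  strings m i = tabulate (toBool ∘ finToFun i)

  strings-surjective : ∀ {m} (s : Vec Bool m) → ∃[ i ] strings m i ≡ s
  strings-surjective s = funToFin (fromBool ∘ lookup s) ,
    trans (tabulate-cong λ j → trans (cong toBool (Fin.finToFun-funToFin (fromBool ∘ lookup s) j)) (toBool-fromBool (lookup s j)))
      (tabulate∘lookup s)

  -- Weights of answers

  -- Both sides are monomials of degree (a + c + e)(A + C + E). The hypotheses say that the right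
  -- side has at most as many factors `υ` and `ζ` as the left, so it arises by replacing `p` factors
  -- `υ` and `q` factors `ζ` by the larger `ξ`. The outer powers clear the denominators of the
  -- proportions c/D and e/D.
  power-exchange : ∀ {ξ υ ζ} a c e A C E → 0ℚ ≤ υ → 0ℚ ≤ ζ → υ ≤ ξ → ζ ≤ ξ →
    (a ℕ.+ c ℕ.+ e) ℕ.* C ℕ.≤ c ℕ.* (A ℕ.+ C ℕ.+ E) → (a ℕ.+ c ℕ.+ e) ℕ.* E ℕ.≤ e ℕ.* (A ℕ.+ C ℕ.+ E) →
    (ξ ^ a * (υ ^ c * ζ ^ e)) ^ (A ℕ.+ C ℕ.+ E) ≤ (ξ ^ A * (υ ^ C * ζ ^ E)) ^ (a ℕ.+ c ℕ.+ e)
  power-exchange {ξ} {υ} {ζ} a c e A C E 0≤υ 0≤ζ υ≤ξ ζ≤ξ DC≤ck DE≤ek = begin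
    (ξ ^ a * (υ ^ c * ζ ^ e)) ^ k                                      ≡⟨ expand a c e k ⟩
    ξ ^ (a ℕ.* k) * (υ ^ (c ℕ.* k) * ζ ^ (e ℕ.* k))                    ≡⟨ cong₂ (λ i j → ξ ^ (a ℕ.* k) * (υ ^ i * ζ ^ j)) ck ek ⟩
    ξ ^ (a ℕ.* k) * (υ ^ (C ℕ.* D ℕ.+ p) * ζ ^ (E ℕ.* D ℕ.+ q))        ≡⟨ cong₂ (λ x y → ξ ^ (a ℕ.* k) * (x * y)) (^-homo-* υ (C ℕ.* D) p) (^-homo-* ζ (E ℕ.* D) q) ⟩
    X * ((Y * υ ^ p) * (Z * ζ ^ q))                                    ≤⟨ *-monoˡ (0≤^ (a ℕ.* k) 0≤ξ) (*-mono (0≤* 0≤Y (0≤^ p 0≤υ)) (0≤* 0≤Z (0≤^ q 0≤ζ))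
                                                                          (*-monoˡ 0≤Y (^-monoˡ p 0≤υ υ≤ξ)) (*-monoˡ 0≤Z (^-monoˡ q 0≤ζ ζ≤ξ))) ⟩
    X * ((Y * ξ ^ p) * (Z * ξ ^ q))                                    ≡⟨ lem X Y Z (ξ ^ p) (ξ ^ q) ⟩
    X * (ξ ^ p * ξ ^ q) * (Y * Z)                                      ≡⟨ cong (_* (Y * Z)) (trans (cong (X *_) (sym (^-homo-* ξ p q))) (sym (^-homo-* ξ (a ℕ.* k) (p ℕ.+ q)))) ⟩
    ξ ^ (a ℕ.* k ℕ.+ (p ℕ.+ q)) * (Y * Z)                              ≡⟨ cong (λ i → ξ ^ i * (Y * Z)) (sym AD) ⟩
    ξ ^ (A ℕ.* D) * (Y * Z)                                            ≡⟨ expand A C E D ⟨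
    (ξ ^ A * (υ ^ C * ζ ^ E)) ^ D                                      ∎
    where
    open ≤-Reasoning
    D = a ℕ.+ c ℕ.+ e
    k = A ℕ.+ C ℕ.+ E
    p = c ℕ.* k ℕ.∸ C ℕ.* D
    q = e ℕ.* k ℕ.∸ E ℕ.* D
    X = ξ ^ (a ℕ.* k)
    Y = υ ^ (C ℕ.* D)
    Z = ζ ^ (E ℕ.* D)
    0≤ξ = ≤-trans 0≤υ υ≤ξ
    0≤Y = 0≤^ (C ℕ.* D) 0≤υ
    0≤Z = 0≤^ (E ℕ.* D) 0≤ζ
    expand : ∀ a c e k → (ξ ^ a * (υ ^ c * ζ ^ e)) ^ k ≡ ξ ^ (a ℕ.* k) * (υ ^ (c ℕ.* k) * ζ ^ (e ℕ.* k))
    expand a c e k = trans (^-distrib-* (ξ ^ a) (υ ^ c * ζ ^ e) k) (cong₂ _*_ (^-assocʳ ξ a k)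
      (trans (^-distrib-* (υ ^ c) (ζ ^ e) k) (cong₂ _*_ (^-assocʳ υ c k) (^-assocʳ ζ e k))))
    ck : c ℕ.* k ≡ C ℕ.* D ℕ.+ p
    ck = sym (ℕ.m+[n∸m]≡n (subst (ℕ._≤ c ℕ.* k) (ℕ.*-comm D C) DC≤ck))
    ek : e ℕ.* k ≡ E ℕ.* D ℕ.+ q
    ek = sym (ℕ.m+[n∸m]≡n (subst (ℕ._≤ e ℕ.* k) (ℕ.*-comm D E) DE≤ek))
    AD : A ℕ.* D ≡ a ℕ.* k ℕ.+ (p ℕ.+ q)
    AD = ℕ.+-cancelʳ-≡ (C ℕ.* D ℕ.+ E ℕ.* D) (A ℕ.* D) (a ℕ.* k ℕ.+ (p ℕ.+ q))
      (trans (distr A C E a c e) (trans (cong₂ (λ i j → a ℕ.* k ℕ.+ (i ℕ.+ j)) ck ek) (shuffle (a ℕ.* k) (C ℕ.* D) (E ℕ.* D) p q)))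
      where
      distr : ∀ A C E a c e → A ℕ.* (a ℕ.+ c ℕ.+ e) ℕ.+ (C ℕ.* (a ℕ.+ c ℕ.+ e) ℕ.+ E ℕ.* (a ℕ.+ c ℕ.+ e))
        ≡ a ℕ.* (A ℕ.+ C ℕ.+ E) ℕ.+ (c ℕ.* (A ℕ.+ C ℕ.+ E) ℕ.+ e ℕ.* (A ℕ.+ C ℕ.+ E))
      distr = ℕ-solver.solve-∀
      shuffle : ∀ x y z p q → x ℕ.+ ((y ℕ.+ p) ℕ.+ (z ℕ.+ q)) ≡ x ℕ.+ (p ℕ.+ q) ℕ.+ (y ℕ.+ z)
      shuffle = ℕ-solver.solve-∀
    lem : ∀ x y z p q → x * ((y * p) * (z * q)) ≡ x * (p * q) * (y * z)
    lem = solve-∀ ringℚ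

  module _ {b : ℕ} (i : Fin b) where

    inClass wrong missing : Fin b × Maybe (Fin b) → ℚ
    inClass (c , τ) = ⟦ c Fin.≟ i ⟧
    wrong (c , τ) = ⟦ c Fin.≟ i ×-dec Maybe.dec (λ j → ¬? (j Fin.≟ i)) τ ⟧
    missing (c , τ) = ⟦ c Fin.≟ i ×-dec ≡-dec Fin._≟_ τ nothing ⟧

  module Weighting {b : ℕ} (ξ : Fin b → ℚ) (υ ζ : ℚ) where

    w : Fin b → Maybe (Fin b) → ℚ
    w c nothing = ζ
    w c (just j) = if does (j Fin.≟ c) then ξ c else υ

    -- A, C and E are the numbers of correct, wrong and missing answers in class `i`. The second
    -- product, with `T` arbitrary, provides the other side of the comparison with the same
    -- exponents.
    class-powers : ∀ (T : Fin b → ℚ) i as → ∃[ A ] ∃[ C ] ∃[ E ]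
      ∏ᴸ (map (λ a → if does (proj₁ a Fin.≟ i) then w (proj₁ a) (proj₂ a) else 1ℚ) as) ≡ ξ i ^ A * (υ ^ C * ζ ^ E) ×
      ∏ᴸ (map (λ a → if does (proj₁ a Fin.≟ i) then T (proj₁ a) else 1ℚ) as) ≡ T i ^ (A ℕ.+ C ℕ.+ E) ×
      ι (A ℕ.+ C ℕ.+ E) ≡ ∑ᴸ (map (inClass i) as) × ι C ≡ ∑ᴸ (map (wrong i) as) × ι E ≡ ∑ᴸ (map (missing i) as)
    class-powers T i [] = 0 , 0 , 0 , refl , refl , ι-0 , ι-0 , ι-0
    class-powers T i ((c , τ) ∷ as) with class-powers T i as
    ... | A , C , E , W≡ , T≡ , k≡ , C≡ , E≡ with c Fin.≟ i
    ... | no _ = A , C , E , trans (*-identityˡ _) W≡ , trans (*-identityˡ _) T≡ ,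
      trans k≡ (sym (+-identityˡ _)) , trans C≡ (sym (+-identityˡ _)) , trans E≡ (sym (+-identityˡ _))
    ... | yes refl with τ
    ...   | nothing = A , C , suc E , trans (cong (ζ *_) W≡) (lem ζ (ξ c ^ A) (υ ^ C) (ζ ^ E)) ,
      trans (cong (T c *_) T≡) (cong (T c ^_) (sym (ℕ.+-suc (A ℕ.+ C) E))) ,
      trans (cong ι (ℕ.+-suc (A ℕ.+ C) E)) (trans (ι-suc (A ℕ.+ C ℕ.+ E)) (cong (1ℚ +_) k≡)) ,
      trans C≡ (sym (+-identityˡ _)) , trans (ι-suc E) (cong (1ℚ +_) E≡)
      where
      lem : ∀ z a b c → z * (a * (b * c)) ≡ a * (b * (z * c))
      lem = solve-∀ ringℚ
    ...   | just j with j Fin.≟ c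
    ...     | yes _ = suc A , C , E , trans (cong (ξ c *_) W≡) (sym (*-assoc (ξ c) (ξ c ^ A) (υ ^ C * ζ ^ E))) ,
      cong (T c *_) T≡ , trans (ι-suc (A ℕ.+ C ℕ.+ E)) (cong (1ℚ +_) k≡) ,
      trans C≡ (sym (+-identityˡ _)) , trans E≡ (sym (+-identityˡ _))
    ...     | no _ = A , suc C , E , trans (cong (υ *_) W≡) (lem υ (ξ c ^ A) (υ ^ C) (ζ ^ E)) ,
      trans (cong (T c *_) T≡) (cong (T c ^_) (cong (ℕ._+ E) (sym (ℕ.+-suc A C)))) ,
      trans (cong (λ k → ι (k ℕ.+ E)) (ℕ.+-suc A C)) (trans (ι-suc (A ℕ.+ C ℕ.+ E)) (cong (1ℚ +_) k≡)) ,
      trans (ι-suc C) (cong (1ℚ +_) C≡) , trans E≡ (sym (+-identityˡ _))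
      where
      lem : ∀ z a b c → z * (a * (b * c)) ≡ a * ((z * b) * c)
      lem = solve-∀ ringℚ

    module _ (0≤υ : 0ℚ ≤ υ) (0≤ζ : 0ℚ ≤ ζ) (υ≤ξ : ∀ i → υ ≤ ξ i) (ζ≤ξ : ∀ i → ζ ≤ ξ i) where

      0≤w : ∀ c τ → 0ℚ ≤ w c τ
      0≤w c nothing = 0≤ζ
      0≤w c (just j) with does (j Fin.≟ c)
      ... | true = ≤-trans 0≤υ (υ≤ξ c)
      ... | false = 0≤υ

      -- If the fractions of wrong and of missing answers in each class are at
      -- most c/D and e/D, the weight is smallest when both are attained.
      w-lower-bound : ∀ a c e as →
        (∀ i → ι (a ℕ.+ c ℕ.+ e) * ∑ᴸ (map (wrong i) as) ≤ ι c * ∑ᴸ (map (inClass i) as)) →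
        (∀ i → ι (a ℕ.+ c ℕ.+ e) * ∑ᴸ (map (missing i) as) ≤ ι e * ∑ᴸ (map (inClass i) as)) →
        ∏ᴸ (map (λ (i , _) → ξ i ^ a * (υ ^ c * ζ ^ e)) as) ≤ ∏ᴸ (map (λ (i , τ) → w i τ) as) ^ (a ℕ.+ c ℕ.+ e)
      w-lower-bound a c e as few-wrong few-missing = begin
        ∏ᴸ (map (λ (i , _) → T i) as)                                                           ≡⟨ ∏-by-class proj₁ (λ (i , _) → T i) as ⟩
        ∏ (λ i → ∏ᴸ (map (λ p → if does (proj₁ p Fin.≟ i) then T (proj₁ p) else 1ℚ) as))        ≤⟨ ∏-mono 0≤ per-class ⟩
        ∏ (λ i → W i ^ D)                                                                       ≡⟨ ∏-^ W D ⟨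
        ∏ W ^ D                                                                                 ≡⟨ cong (_^ D) (∏-by-class proj₁ (λ (i , τ) → w i τ) as) ⟨
        ∏ᴸ (map (λ (i , τ) → w i τ) as) ^ D                                                     ∎
        where
        open ≤-Reasoning
        D = a ℕ.+ c ℕ.+ e
        T W : Fin b → ℚ
        T i = ξ i ^ a * (υ ^ c * ζ ^ e)
        W i = ∏ᴸ (map (λ p → if does (proj₁ p Fin.≟ i) then w (proj₁ p) (proj₂ p) else 1ℚ) as)
        0≤T : ∀ i → 0ℚ ≤ T i
        0≤T i = 0≤* (0≤^ a (≤-trans 0≤υ (υ≤ξ i))) (0≤* (0≤^ c 0≤υ) (0≤^ e 0≤ζ))
        0≤ : ∀ i → 0ℚ ≤ ∏ᴸ (map (λ p → if does (proj₁ p Fin.≟ i) then T (proj₁ p) else 1ℚ) as)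
        0≤ i = let A , C , E , _ , T≡ , _ = class-powers T i as
               in subst (0ℚ ≤_) (sym T≡) (0≤^ (A ℕ.+ C ℕ.+ E) (0≤T i))
        -- The error bounds hold in each class and `ξ` depends on the class, so the worst case has
        -- to be taken class by class.
        per-class : ∀ i → ∏ᴸ (map (λ p → if does (proj₁ p Fin.≟ i) then T (proj₁ p) else 1ℚ) as) ≤ W i ^ D
        per-class i =
          let A , C , E , W≡ , T≡ , k≡ , C≡ , E≡ = class-powers T i as
          in subst₂ _≤_ (sym T≡) (cong (_^ D) (sym W≡)) (power-exchange a c e A C E 0≤υ 0≤ζ (υ≤ξ i) (ζ≤ξ i)
            (ι-cancel-≤ (subst₂ _≤_ (trans (cong (ι D *_) (sym C≡)) (sym (ι-* D C))) (trans (cong (ι c *_) (sym k≡)) (sym (ι-* c (A ℕ.+ C ℕ.+ E)))) (few-wrong i)))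
            (ι-cancel-≤ (subst₂ _≤_ (trans (cong (ι D *_) (sym E≡)) (sym (ι-* D E))) (trans (cong (ι e *_) (sym k≡)) (sym (ι-* e (A ℕ.+ C ℕ.+ E)))) (few-missing i))))

      -- The three charges overlap: `υ` is paid for every answered element and `ζ` for every element
      -- of the universe. This overcount is affordable, as it is what leads to the total x + y + z.
      w-upper-bound : ∀ {u} (s : Fin u → Maybe (Fin b)) c →
        sum (λ x → w c (s x)) ≤ ξ c * sum (λ x → ⟦ ≡? s c x ⟧) + (υ * sum (λ x → ⟦ ≢⊥? s x ⟧) + ι u * ζ)
      w-upper-bound {u} s c = begin
        sum (λ x → w c (s x))                                                                    ≤⟨ sum-mono (λ x → pointwise (s x)) ⟩
        sum (λ x → ξ c * ⟦ ≡? s c x ⟧ + (υ * ⟦ ≢⊥? s x ⟧ + ζ))                                   ≡⟨ ∑-distrib-+ (λ x → ξ c * ⟦ ≡? s c x ⟧) (λ x → υ * ⟦ ≢⊥? s x ⟧ + ζ) ⟩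
        sum (λ x → ξ c * ⟦ ≡? s c x ⟧) + sum (λ x → υ * ⟦ ≢⊥? s x ⟧ + ζ)                         ≡⟨ cong (sum (λ x → ξ c * ⟦ ≡? s c x ⟧) +_) (∑-distrib-+ (λ x → υ * ⟦ ≢⊥? s x ⟧) (λ _ → ζ)) ⟩
        sum (λ x → ξ c * ⟦ ≡? s c x ⟧) + (sum (λ x → υ * ⟦ ≢⊥? s x ⟧) + sum {u} (λ _ → ζ))       ≡⟨ cong₂ _+_ (sym (*-distribˡ-sum (ξ c) (λ x → ⟦ ≡? s c x ⟧)))
                                                                                                    (cong₂ _+_ (sym (*-distribˡ-sum υ (λ x → ⟦ ≢⊥? s x ⟧))) (sum-const u ζ)) ⟩
        ξ c * sum (λ x → ⟦ ≡? s c x ⟧) + (υ * sum (λ x → ⟦ ≢⊥? s x ⟧) + ι u * ζ)                 ∎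
        where
        open ≤-Reasoning
        pointwise : ∀ τ → w c τ ≤ ξ c * ⟦ ≡-dec Fin._≟_ τ (just c) ⟧ + (υ * ⟦ ¬? (≡-dec Fin._≟_ τ nothing) ⟧ + ζ)
        pointwise nothing = ≤-reflexive (lem ζ (ξ c) υ)
          where
          lem : ∀ z x y → z ≡ x * 0ℚ + (y * 0ℚ + z)
          lem = solve-∀ ringℚ
        pointwise (just j) with does (j Fin.≟ c)
        ... | true = ≤-by _ (0≤+ 0≤υ 0≤ζ) (lem ζ (ξ c) υ)
          where
          lem : ∀ z x y → x + (y + z) ≡ x * 1ℚ + (y * 1ℚ + z)
          lem = solve-∀ ringℚ
        ... | false = ≤-by _ 0≤ζ (lem ζ (ξ c) υ)
          where
          lem : ∀ z x y → y + z ≡ x * 0ℚ + (y * 1ℚ + z)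
          lem = solve-∀ ringℚ

  -- The counting bound

  ι-sum : ∀ {b} (k : Fin b → ℕ) → ι (ℕΣ.sum k) ≡ sum (ι ∘ k)
  ι-sum {zero} k = ι-0
  ι-sum {suc b} k = trans (ι-+ (k zero) (ℕΣ.sum (k ∘ suc))) (cong (ι (k zero) +_) (ι-sum (k ∘ suc)))

  sum-≡? : ∀ {u b} (s : Fin u → Maybe (Fin b)) → sum (λ i → sum (λ x → ⟦ ≡? s i x ⟧)) ≡ sum (λ x → ⟦ ≢⊥? s x ⟧)
  sum-≡? {b = b} s = trans (∑-comm (λ i x → ⟦ ≡? s i x ⟧)) (sum-cong-≗ (λ x → value (s x)))
    where
    value : ∀ (τ : Maybe (Fin b)) → sum (λ i → ⟦ ≡-dec Fin._≟_ τ (just i) ⟧) ≡ ⟦ ¬? (≡-dec Fin._≟_ τ nothing) ⟧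
    value nothing = sum-replicate-zero b
    value (just j) = trans (sum-cong-≗ (λ i → trans (≟-sym j i) (sym (*-identityʳ ⟦ i Fin.≟ j ⟧)))) (sum-≟ j (λ _ → 1ℚ))

  module Encoding
    {b n u m v : ℕ} (u≡ : u ≡ suc v ℕ.+ n)
    (k : Fin b → ℕ) (∑k≡n : ℕΣ.sum k ≡ n)
    {P Q : Fin b → ℚ} (0≤P : ∀ i → 0ℚ ≤ P i) (P≤1 : ∀ i → P i ≤ 1ℚ) (0≤Q : ∀ i → 0ℚ ≤ Q i)
    (PQ≡1 : ∀ i → P i * Q i ≡ 1ℚ) (k≡Pn : ∀ i → ι (k i) ≡ P i * ι n)
    {x y z r : ℚ} (0≤y : 0ℚ ≤ y) (0≤z : 0ℚ ≤ z) (y≤x : y ≤ x) (z≤x : z ≤ x) (x+y+z≤1 : x + y + z ≤ 1ℚ) (1≤r : 1ℚ ≤ r)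
    (a c e : ℕ) (𝔻 : DataStructure m u b)
    (encodes : ∀ M → # (≢⊥? M) ≡ n → (∀ i → # (≡? M i) ≡ k i) → ∃[ s ]
      r * ι (# (≢⊥? (𝔻 s))) ≤ ι u × ∀ i →
      ι (a ℕ.+ c ℕ.+ e) * ι (# (λ x → ≡? M i x ×-dec other? (𝔻 s) i x)) ≤ ι c * ι (k i) ×
      ι (a ℕ.+ c ℕ.+ e) * ι (# (λ x → ≡? M i x ×-dec ≡⊥? (𝔻 s) x)) ≤ ι e * ι (k i))
    where
    open ≤-Reasoning

    -- In these weights, scaled by 1/u, the mean over the classes of the total
    -- weight is at most x + y + z; here r stands for 1/ε⁺ and Q for 1/p.
    ξ : Fin b → ℚ
    ξ i = x * (Q i * r)
    υ = y * r
    ζ = z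
    open Weighting ξ υ ζ

    D = a ℕ.+ c ℕ.+ e
    cs = proj₁ (classList k)

    T : Fin b → ℚ
    T i = ξ i ^ a * (υ ^ c * ζ ^ e)

    private
      0≤x = ≤-trans 0≤y y≤x
      0≤r = ≤-trans 0≤1 1≤r
      0≤υ = 0≤* 0≤y 0≤r

      1≤Q : ∀ i → 1ℚ ≤ Q i
      1≤Q i = subst₂ _≤_ (PQ≡1 i) (*-identityˡ (Q i)) (*-monoʳ (0≤Q i) (P≤1 i))

      υ≤ξ : ∀ i → υ ≤ ξ i
      υ≤ξ i = begin
        y * r                ≤⟨ *-monoʳ 0≤r y≤x ⟩
        x * r                ≡⟨ cong (x *_) (*-identityˡ r) ⟨
        x * (1ℚ * r)         ≤⟨ *-monoˡ 0≤x (*-monoʳ 0≤r (1≤Q i)) ⟩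
        x * (Q i * r)        ∎

      ζ≤ξ : ∀ i → ζ ≤ ξ i
      ζ≤ξ i = begin
        z                    ≤⟨ z≤x ⟩
        x                    ≡⟨ *-identityʳ x ⟨
        x * (1ℚ * 1ℚ)        ≤⟨ *-monoˡ 0≤x (*-mono 0≤1 0≤1 (1≤Q i) 1≤r) ⟩
        x * (Q i * r)        ∎

      s : Fin (2 ℕ.^ m) → Fin u → Maybe (Fin b)
      s j = 𝔻 (strings m j)

      S : Fin (2 ℕ.^ m) → ℚ
      S j = sum (λ x → ⟦ ≢⊥? (s j) x ⟧)

      -- Strings with too many answered elements have no useful bound on their total weight. Their
      -- indicator, as the initial `t` of `greedy`, removes them; the string that encodes the chosen
      -- map survives.
      rS≤u? : ∀ j → Dec (r * S j ≤ ι u)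
      rS≤u? j = r * S j ≤? ι u

      wt : Fin b → Fin (2 ℕ.^ m) → Fin u → ℚ
      wt c j x = w c (s j x)

      0≤wt : ∀ c j x → 0ℚ ≤ wt c j x
      0≤wt c j x = 0≤w 0≤υ 0≤z υ≤ξ ζ≤ξ c (s j x)

      length-cs : length cs ≡ n
      length-cs = trans (proj₁ (proj₂ (classList k))) ∑k≡n

      occ-cs : ∀ i → ∑ᴸ (map (λ c → ⟦ c Fin.≟ i ⟧) cs) ≡ ι (k i)
      occ-cs = proj₂ (proj₂ (classList k))

      -- Since `P i * Q i ≡ 1ℚ`, a class contributes its correct answers with a coefficient
      -- independent of the class; over all classes they sum to `S j` by `sum-≡?`, as every answered
      -- element has exactly one value.
      mean≤u : ∀ j → r * S j ≤ ι u → ∑ᴸ (map (λ c → sum (wt c j)) cs) ≤ ι n * ι u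
      mean≤u j rS≤u = begin
        ∑ᴸ (map (λ c → sum (wt c j)) cs)                                 ≡⟨ sum-by-class (λ c → sum (wt c j)) cs ⟩
        sum (λ i → ∑ᴸ (map (λ c → ⟦ c Fin.≟ i ⟧) cs) * sum (wt i j))     ≡⟨ sum-cong-≗ (λ i → cong (_* sum (wt i j)) (occ-cs i)) ⟩
        sum (λ i → ι (k i) * sum (wt i j))                               ≤⟨ sum-mono (λ i → *-monoˡ (0≤ι (k i)) (w-upper-bound 0≤υ 0≤z υ≤ξ ζ≤ξ (s j) i)) ⟩
        sum (λ i → ι (k i) * (ξ i * Sᵢ i + B))                           ≡⟨ sum-cong-≗ (λ i → rearrange i) ⟩
        sum (λ i → (ι n * (x * r)) * Sᵢ i + ι (k i) * B)                 ≡⟨ ∑-distrib-+ (λ i → (ι n * (x * r)) * Sᵢ i) (λ i → ι (k i) * B) ⟩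
        sum (λ i → (ι n * (x * r)) * Sᵢ i) + sum (λ i → ι (k i) * B)     ≡⟨ cong₂ _+_ (trans (sym (*-distribˡ-sum (ι n * (x * r)) Sᵢ)) (cong ((ι n * (x * r)) *_) (sum-≡? (s j))))
                                                                            (trans (sym (*-distribʳ-sum B (ι ∘ k))) (cong (_* B) (trans (sym (ι-sum k)) (cong ι ∑k≡n)))) ⟩
        (ι n * (x * r)) * S j + ι n * B                                  ≡⟨ lem₁ (ι n) x y z r (S j) (ι u) ⟩
        ι n * ((x + y) * (r * S j) + z * ι u)                            ≤⟨ *-monoˡ (0≤ι n) (+-monoˡ-≤ (z * ι u) (*-monoˡ (0≤+ 0≤x 0≤y) rS≤u)) ⟩
        ι n * ((x + y) * ι u + z * ι u)                                  ≡⟨ cong (ι n *_) (*-distribʳ-+ (ι u) (x + y) z) ⟨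
        ι n * ((x + y + z) * ι u)                                        ≤⟨ *-monoˡ (0≤ι n) (*-monoʳ (0≤ι u) x+y+z≤1) ⟩
        ι n * (1ℚ * ι u)                                                 ≡⟨ cong (ι n *_) (*-identityˡ (ι u)) ⟩
        ι n * ι u                                                        ∎
        where
        B = υ * S j + ι u * ζ
        Sᵢ : Fin b → ℚ
        Sᵢ i = sum (λ x → ⟦ ≡? (s j) i x ⟧)
        lem₁ : ∀ n x y z r s u → (n * (x * r)) * s + n * (y * r * s + u * z) ≡ n * ((x + y) * (r * s) + z * u)
        lem₁ = solve-∀ ringℚ
        lem₂ : ∀ p q n x r s B → p * n * (x * (q * r) * s + B) ≡ (p * q) * ((n * (x * r)) * s) + p * n * B
        lem₂ = solve-∀ ringℚ
        rearrange : ∀ i → ι (k i) * (ξ i * Sᵢ i + B) ≡ (ι n * (x * r)) * Sᵢ i + ι (k i) * B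
        rearrange i = trans (cong (_* (ξ i * Sᵢ i + B)) (k≡Pn i)) (trans (lem₂ (P i) (Q i) (ι n) x r (Sᵢ i) B)
          (cong₂ _+_ (trans (cong (_* ((ι n * (x * r)) * Sᵢ i)) (PQ≡1 i)) (*-identityˡ ((ι n * (x * r)) * Sᵢ i))) (cong (_* B) (sym (k≡Pn i)))))

      per-string : ∀ j → ⟦ rS≤u? j ⟧ * total wt 0≤wt j cs ≤ ι u ^ n
      per-string j = helper (rS≤u? j)
        where
        helper : ∀ (d : Dec (r * S j ≤ ι u)) → ⟦ d ⟧ * total wt 0≤wt j cs ≤ ι u ^ n
        helper (no _) = ≤-trans (≤-reflexive (*-zeroˡ (total wt 0≤wt j cs))) (0≤^ n (0≤ι u))
        helper (yes rS≤u) = ≤-trans (≤-reflexive (*-identityˡ (total wt 0≤wt j cs)))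
          (subst (λ l → total wt 0≤wt j cs ≤ ι u ^ l) len
            (am-gm (0≤ι u) (nonneg cs) (subst (λ l → ∑ᴸ (map (λ c → sum (wt c j)) cs) ≤ ι l * ι u) (sym len) (mean≤u j rS≤u))))
          where
          len : length (map (λ c → sum (wt c j)) cs) ≡ n
          len = trans (length-map (λ c → sum (wt c j)) cs) length-cs
          nonneg : ∀ cs → All (0ℚ ≤_) (map (λ c → sum (wt c j)) cs)
          nonneg [] = []
          nonneg (c ∷ cs) = 0≤sum (0≤wt c j) ∷ nonneg cs

      all-strings : sum (λ j → ⟦ rS≤u? j ⟧ * total wt 0≤wt j cs) ≤ 2ℚ ^ m * ι u ^ n
      all-strings = ≤-trans (sum-mono per-string) (≤-reflexive (trans (sum-const (2 ℕ.^ m) (ι u ^ n))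
        (cong (_* ι u ^ n) (trans (ι-^ 2 m) (cong (_^ m) (ι-def 2))))))

      room : suc v ℕ.+ (length cs ℕ.+ 0) ℕ.≤ u
      room = ℕ.≤-reflexive (trans (cong (suc v ℕ.+_) (trans (ℕ.+-identityʳ (length cs)) length-cs)) (sym u≡))

    -- The weight of the encoding string is one nonnegative term of the sum over all strings, which
    -- the greedy choice has made small. The power D is the one in which `w-lower-bound` controls
    -- that weight.
    counting-bound : (ι (suc v) ^ n) ^ D * ∏ᴸ (map T cs) ≤ (2ℚ ^ m * ι u ^ n) ^ D
    counting-bound =
      let ps , classes , distinct , _ , bound = greedy wt 0≤wt v cs [] (λ j → ⟦ rS≤u? j ⟧) (λ j → 0≤⟦⟧ (rS≤u? j)) room
          M = asMap ps
          length-ps : length ps ≡ n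
          length-ps = trans (sym (length-map proj₁ ps)) (trans (cong length classes) length-cs)
          class-M : ∀ i → ι (# (≡? M i)) ≡ ι (k i)
          class-M i = trans (#class-asMap distinct i) (trans (cong (λ cs → ∑ᴸ (map (λ c → ⟦ c Fin.≟ i ⟧) cs)) classes) (occ-cs i))
          string , few-positives , few = encodes M (trans (#dom-asMap distinct) length-ps) (λ i → ι-injective (class-M i))
          j , j≡ = strings-surjective string
      in from-string ps classes distinct bound j
           (subst (λ t → r * ι (# (≢⊥? (𝔻 t))) ≤ ι u) (sym j≡) few-positives)
           (subst (λ t → ∀ i → ι D * ι (# (λ x → ≡? M i x ×-dec other? (𝔻 t) i x)) ≤ ι c * ι (k i) ×
                               ι D * ι (# (λ x → ≡? M i x ×-dec ≡⊥? (𝔻 t) x)) ≤ ι e * ι (k i)) (sym j≡) few)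
      where
      from-string : ∀ ps → map proj₁ ps ≡ cs → (distinct : _) →
        ι (suc v) ^ length cs * sum (λ j → ⟦ rS≤u? j ⟧ * weight wt 0≤wt j ps) ≤ sum (λ j → ⟦ rS≤u? j ⟧ * total wt 0≤wt j cs) →
        ∀ j → r * ι (# (≢⊥? (s j))) ≤ ι u →
        (∀ i → ι D * ι (# (λ x → ≡? (asMap ps) i x ×-dec other? (s j) i x)) ≤ ι c * ι (k i) ×
               ι D * ι (# (λ x → ≡? (asMap ps) i x ×-dec ≡⊥? (s j) x)) ≤ ι e * ι (k i)) →
        (ι (suc v) ^ n) ^ D * ∏ᴸ (map T cs) ≤ (2ℚ ^ m * ι u ^ n) ^ D
      from-string ps classes distinct bound j few-positives few = begin
        V ^ D * ∏ᴸ (map T cs)                              ≡⟨ cong (V ^ D *_) T≡ ⟩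
        V ^ D * ∏ᴸ (map (λ (i , _) → T i) as)              ≤⟨ *-monoˡ (0≤^ D 0≤V) (w-lower-bound 0≤υ 0≤z υ≤ξ ζ≤ξ a c e as few-wrong few-missing) ⟩
        V ^ D * ∏ᴸ (map (λ (i , τ) → w i τ) as) ^ D        ≡⟨ cong (λ y → V ^ D * ∏ᴸ y ^ D) (map-∘ ps) ⟨
        V ^ D * weight wt 0≤wt j ps ^ D                    ≡⟨ ^-distrib-* V (weight wt 0≤wt j ps) D ⟨
        (V * weight wt 0≤wt j ps) ^ D                      ≤⟨ ^-monoˡ D (0≤* 0≤V (0≤weight j)) (≤-trans one-string all-strings) ⟩
        (2ℚ ^ m * ι u ^ n) ^ D                             ∎
        where
        V = ι (suc v) ^ n
        0≤V = 0≤^ n (0≤ι (suc v))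
        as = map (λ (c , x) → c , s j x) ps
        0≤weight : ∀ j → 0ℚ ≤ weight wt 0≤wt j ps
        0≤weight j = 0≤∏ᴸ (nonneg ps)
          where
          nonneg : ∀ ps → All (0ℚ ≤_) (map (λ (c , x) → wt c j x) ps)
          nonneg [] = []
          nonneg ((c , x) ∷ ps) = 0≤wt c j x ∷ nonneg ps
        T≡ : ∏ᴸ (map T cs) ≡ ∏ᴸ (map (λ (i , _) → T i) as)
        T≡ = cong ∏ᴸ (trans (cong (map T) (sym classes)) (trans (sym (map-∘ ps)) (map-∘ ps)))
        class≡ : ∀ i → ∑ᴸ (map (inClass i) as) ≡ ι (k i)
        class≡ i = trans (cong ∑ᴸ (trans (sym (map-∘ ps)) (map-∘ ps)))
          (trans (cong (λ cs → ∑ᴸ (map (λ c → ⟦ c Fin.≟ i ⟧) cs)) classes) (occ-cs i))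
        wrong≡ : ∀ i → ι (# (λ x → ≡? (asMap ps) i x ×-dec other? (s j) i x)) ≡ ∑ᴸ (map (wrong i) as)
        wrong≡ i = trans (ι-# (λ x → ≡? (asMap ps) i x ×-dec other? (s j) i x))
          (trans (sum-asMap (λ x τ → ⟦ ≡-dec Fin._≟_ τ (just i) ×-dec other? (s j) i x ⟧) (λ _ → refl) ps distinct) (cong ∑ᴸ (map-∘ ps)))
        missing≡ : ∀ i → ι (# (λ x → ≡? (asMap ps) i x ×-dec ≡⊥? (s j) x)) ≡ ∑ᴸ (map (missing i) as)
        missing≡ i = trans (ι-# (λ x → ≡? (asMap ps) i x ×-dec ≡⊥? (s j) x))
          (trans (sum-asMap (λ x τ → ⟦ ≡-dec Fin._≟_ τ (just i) ×-dec ≡⊥? (s j) x ⟧) (λ _ → refl) ps distinct) (cong ∑ᴸ (map-∘ ps)))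
        few-wrong : ∀ i → ι D * ∑ᴸ (map (wrong i) as) ≤ ι c * ∑ᴸ (map (inClass i) as)
        few-wrong i = subst₂ (λ p q → ι D * p ≤ ι c * q) (wrong≡ i) (sym (class≡ i)) (proj₁ (few i))
        few-missing : ∀ i → ι D * ∑ᴸ (map (missing i) as) ≤ ι e * ∑ᴸ (map (inClass i) as)
        few-missing i = subst₂ (λ p q → ι D * p ≤ ι e * q) (missing≡ i) (sym (class≡ i)) (proj₂ (few i))
        one-string : V * weight wt 0≤wt j ps ≤ sum (λ j → ⟦ rS≤u? j ⟧ * total wt 0≤wt j cs)
        one-string = ≤-trans (*-monoˡ 0≤V (≤-trans (≤-reflexive (trans (sym (*-identityˡ (weight wt 0≤wt j ps))) (cong (_* weight wt 0≤wt j ps) (sym active))))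
            (term≤sum (λ j → 0≤* (0≤⟦⟧ (rS≤u? j)) (0≤weight j)) j)))
          (subst (λ l → ι (suc v) ^ l * sum (λ j → ⟦ rS≤u? j ⟧ * weight wt 0≤wt j ps) ≤ sum (λ j → ⟦ rS≤u? j ⟧ * total wt 0≤wt j cs)) length-cs bound)
          where
          active : ⟦ rS≤u? j ⟧ ≡ 1ℚ
          active = ⟦⟧-yes (rS≤u? j) (subst (λ y → r * y ≤ ι u) (ι-# (≢⊥? (s j))) few-positives)

  -- The right-hand side of the theorem at rational arguments: ε and γ stand for
  -- ε⁻ and ε*, and Λ, lε, lγ, lα, lp for the logarithms of 1/ε⁺, ε⁻, ε*,
  -- 1 - ε⁻ - ε*, p.
  rhs : ∀ {b} (ε γ Λ lε lγ lα : ℚ) (P lp : Fin b → ℚ) → ℚ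
  rhs ε γ Λ lε lγ lα P lp =
    (1ℚ - ε) * Λ + (1ℚ - ε - γ) * (- sum (λ i → P i * lp i))
      - (- (ε * lε + (γ * lγ + ((1ℚ - ε - γ) * lα + 0ℚ))))

  -- Here `ρ` is (u - n)/u, so `δ` is the loss per key from drawing without replacement. The
  -- hypotheses on `lγ` and `lε` concern the powers `y ^ c` and `z ^ e`: for a vanishing error rate
  -- the exponent is 0 and its logarithm is unconstrained.
  counting-bound-log :
    ∀ {b n u m v : ℕ} (u≡ : u ≡ suc v ℕ.+ n)
    (k : Fin b → ℕ) (∑k≡n : ℕΣ.sum k ≡ n)
    {P Q : Fin b → ℚ} (0≤P : ∀ i → 0ℚ ≤ P i) (P≤1 : ∀ i → P i ≤ 1ℚ) (0≤Q : ∀ i → 0ℚ ≤ Q i)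
    (PQ≡1 : ∀ i → P i * Q i ≡ 1ℚ) (k≡Pn : ∀ i → ι (k i) ≡ P i * ι n) (∑P≡1 : sum P ≡ 1ℚ)
    {x y z r : ℚ} (0≤y : 0ℚ ≤ y) (0≤z : 0ℚ ≤ z) (y≤x : y ≤ x) (z≤x : z ≤ x) (x+y+z≤1 : x + y + z ≤ 1ℚ) (1≤r : 1ℚ ≤ r)
    (a c e d : ℕ) (D≡ : a ℕ.+ c ℕ.+ e ≡ suc d) (𝔻 : DataStructure m u b)
    (encodes : ∀ M → # (≢⊥? M) ≡ n → (∀ i → # (≡? M i) ≡ k i) → ∃[ s ]
      r * ι (# (≢⊥? (𝔻 s))) ≤ ι u × ∀ i →
      ι (a ℕ.+ c ℕ.+ e) * ι (# (λ x → ≡? M i x ×-dec other? (𝔻 s) i x)) ≤ ι c * ι (k i) ×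
      ι (a ℕ.+ c ℕ.+ e) * ι (# (λ x → ≡? M i x ×-dec ≡⊥? (𝔻 s) x)) ≤ ι e * ι (k i)) →
    ∀ {ε γ Λ lε lγ lα δ ρ} {lp : Fin b → ℚ} → ι e ≡ ι (suc d) * ε → ι c ≡ ι (suc d) * γ →
    0ℚ ≤ ρ → ρ * ι u ≡ ι (suc v) → - δ ≤log ρ →
    Λ ≤log r → lα ≤log x → ι c * lγ ≤log y ^ c → ι e * lε ≤log z ^ e → (∀ i → - lp i ≤log Q i) →
    ι n * (rhs ε γ Λ lε lγ lα P lp - δ) ≤ ι m
  counting-bound-log {b} {n} {u} {m} {v} u≡ k ∑k≡n {P} {Q} 0≤P P≤1 0≤Q PQ≡1 k≡Pn ∑P≡1 {x} {y} {z} {r} 0≤y 0≤z y≤x z≤x x+y+z≤1 1≤r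
    a c e d D≡ 𝔻 encodes {ε} {γ} {Λ} {lε} {lγ} {lα} {δ} {ρ} {lp} e≡ c≡ 0≤ρ ρu≡v ρ-log r-log x-log y-log z-log Q-log =
    *-cancelˡ (0<ι d) (begin
      ι (suc d) * (ι n * (rhs ε γ Λ lε lγ lα P lp - δ))                       ≡⟨ lem₁ (ι (suc d)) (ι n) (rhs ε γ Λ lε lγ lα P lp) δ ⟩
      ι (suc d) * (ι n * - δ) + ι n * (ι (suc d) * rhs ε γ Λ lε lγ lα P lp)   ≡⟨ cong (λ t → ι (suc d) * (ι n * - δ) + ι n * t) mean ⟨
      ι (suc d) * (ι n * - δ) + ι n * sum (λ i → P i * l i)                   ≡⟨ cong₂ _+_ (cong (λ D → ι D * (ι n * - δ)) D≡) ∑l≡ ⟨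
      ι D * (ι n * - δ) + ∑ᴸ (map l cs)                                       ≤⟨ ≤log-2^ (m ℕ.* D) (≤log-mono ≤-refl 0≤product product≤
                                                                                (≤log-* (≤log-^ D (≤log-^ n ρ-log)) (≤log-∏ l≤logT cs))) ⟩
      ι (m ℕ.* D)                                                             ≡⟨ trans (cong (λ D → ι (m ℕ.* D)) D≡) (trans (ι-* m (suc d)) (*-comm (ι m) (ι (suc d)))) ⟩
      ι (suc d) * ι m                                                         ∎)
    where
    open ≤-Reasoning
    open Encoding {b} {n} {u} {m} {v} u≡ k ∑k≡n 0≤P P≤1 0≤Q PQ≡1 k≡Pn 0≤y 0≤z y≤x z≤x x+y+z≤1 1≤r a c e 𝔻 encodes
    lem₁ : ∀ d n F δ → d * (n * (F - δ)) ≡ d * (n * - δ) + n * (d * F)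
    lem₁ = solve-∀ ringℚ
    0≤x = ≤-trans 0≤y y≤x
    0≤r = ≤-trans 0≤1 1≤r

    U = (ι u ^ n) ^ D

    0≤T : ∀ i → 0ℚ ≤ T i
    0≤T i = 0≤* (0≤^ a (0≤* 0≤x (0≤* (0≤Q i) 0≤r))) (0≤* (0≤^ c (0≤* 0≤y 0≤r)) (0≤^ e 0≤z))

    0≤∏T : ∀ cs → 0ℚ ≤ ∏ᴸ (map T cs)
    0≤∏T [] = 0≤1
    0≤∏T (c ∷ cs) = 0≤* (0≤T c) (0≤∏T cs)

    0≤product : 0ℚ ≤ (ρ ^ n) ^ D * ∏ᴸ (map T cs)
    0≤product = 0≤* (0≤^ D (0≤^ n 0≤ρ)) (0≤∏T cs)

    0<U : 0ℚ < U
    0<U = 0<^ D (0<^ n (subst (λ u → 0ℚ < ι u) (sym u≡) (0<ι (v ℕ.+ n))))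

    product≤ : (ρ ^ n) ^ D * ∏ᴸ (map T cs) ≤ 2ℚ ^ (m ℕ.* D)
    product≤ = *-cancelˡ 0<U (begin
      U * ((ρ ^ n) ^ D * ∏ᴸ (map T cs))                   ≡⟨ lem U ((ρ ^ n) ^ D) (∏ᴸ (map T cs)) ⟩
      ((ρ ^ n) ^ D * U) * ∏ᴸ (map T cs)                   ≡⟨ cong (_* ∏ᴸ (map T cs)) (trans (sym (^-distrib-* (ρ ^ n) (ι u ^ n) D))
                                                            (cong (_^ D) (trans (sym (^-distrib-* ρ (ι u) n)) (cong (_^ n) ρu≡v)))) ⟩
      (ι (suc v) ^ n) ^ D * ∏ᴸ (map T cs)                 ≤⟨ counting-bound ⟩
      (2ℚ ^ m * ι u ^ n) ^ D                              ≡⟨ ^-distrib-* (2ℚ ^ m) (ι u ^ n) D ⟩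
      (2ℚ ^ m) ^ D * U                                    ≡⟨ trans (*-comm ((2ℚ ^ m) ^ D) U) (cong (U *_) (^-assocʳ 2ℚ m D)) ⟩
      U * 2ℚ ^ (m ℕ.* D)                                  ∎)
      where
      lem : ∀ u r t → u * (r * t) ≡ (r * u) * t
      lem = solve-∀ ringℚ

    l : Fin b → ℚ
    l i = ι a * (lα + (- lp i + Λ)) + ((ι c * lγ + ι c * Λ) + ι e * lε)

    l≤logT : ∀ i → l i ≤log T i
    l≤logT i = ≤log-* (≤log-^ a (≤log-* x-log (≤log-* (Q-log i) r-log)))
      (≤log-* (subst ((ι c * lγ + ι c * Λ) ≤log_) (sym (^-distrib-* y r c)) (≤log-* y-log (≤log-^ c r-log))) z-log)

    ∑l≡ : ∑ᴸ (map l cs) ≡ ι n * sum (λ i → P i * l i)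
    ∑l≡ = trans (sum-by-class l cs) (trans (sum-cong-≗ (λ i → trans (cong (_* l i) (trans (proj₂ (proj₂ (classList k)) i) (k≡Pn i)))
      (lem (P i) (ι n) (l i)))) (sym (*-distribˡ-sum (ι n) (λ i → P i * l i))))
      where
      lem : ∀ p n l → p * n * l ≡ n * (p * l)
      lem = solve-∀ ringℚ

    a≡ : ι a ≡ ι (suc d) * (1ℚ - ε - γ)
    a≡ = trans (lem (ι a) (ι c) (ι e)) (trans (cong₂ (λ s t → s - t) (trans (sym (trans (ι-+ (a ℕ.+ c) e) (cong (_+ ι e) (ι-+ a c)))) (cong ι D≡)) (cong₂ _+_ c≡ e≡))
      (lem′ (ι (suc d)) ε γ))
      where
      lem : ∀ a c e → a ≡ a + c + e - (c + e)
      lem = solve-∀ ringℚ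
      lem′ : ∀ d ε γ → d - (d * γ + d * ε) ≡ d * (1ℚ - ε - γ)
      lem′ = solve-∀ ringℚ

    mean : sum (λ i → P i * l i) ≡ ι (suc d) * rhs ε γ Λ lε lγ lα P lp
    mean = begin-equality
      sum (λ i → P i * l i)                                         ≡⟨ sum-cong-≗ (λ i → lem (P i) (ι a) lα (lp i) Λ rest) ⟩
      sum (λ i → P i * (ι a * (lα + Λ) + rest) + - ι a * (P i * lp i))
        ≡⟨ ∑-distrib-+ (λ i → P i * (ι a * (lα + Λ) + rest)) (λ i → - ι a * (P i * lp i)) ⟩
      sum (λ i → P i * (ι a * (lα + Λ) + rest)) + sum (λ i → - ι a * (P i * lp i))
        ≡⟨ cong₂ _+_ (trans (sym (*-distribʳ-sum (ι a * (lα + Λ) + rest) P)) (cong (_* (ι a * (lα + Λ) + rest)) ∑P≡1)) (sym (*-distribˡ-sum (- ι a) (λ i → P i * lp i))) ⟩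
      1ℚ * (ι a * (lα + Λ) + rest) + - ι a * L                      ≡⟨ cong₂ (λ a rest → 1ℚ * (a * (lα + Λ) + rest) + - a * L) a≡ (cong₂ (λ c e → (c * lγ + c * Λ) + e * lε) c≡ e≡) ⟩
      1ℚ * (ι (suc d) * (1ℚ - ε - γ) * (lα + Λ) + (ι (suc d) * γ * lγ + ι (suc d) * γ * Λ + ι (suc d) * ε * lε)) + - (ι (suc d) * (1ℚ - ε - γ)) * L
                                                                    ≡⟨ lem′ (ι (suc d)) ε γ Λ lε lγ lα L ⟩
      ι (suc d) * rhs ε γ Λ lε lγ lα P lp                           ∎
      where
      rest = (ι c * lγ + ι c * Λ) + ι e * lε
      L = sum (λ i → P i * lp i)
      lem : ∀ p a lα lp Λ rest → p * (a * (lα + (- lp + Λ)) + rest) ≡ p * (a * (lα + Λ) + rest) + - a * (p * lp)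
      lem = solve-∀ ringℚ
      lem′ : ∀ d ε γ Λ lε lγ lα L →
        1ℚ * (d * (1ℚ - ε - γ) * (lα + Λ) + (d * γ * lγ + d * γ * Λ + d * ε * lε)) + - (d * (1ℚ - ε - γ)) * L
        ≡ d * ((1ℚ - ε) * Λ + (1ℚ - ε - γ) * (- L) - (- (ε * lε + (γ * lγ + ((1ℚ - ε - γ) * lα + 0ℚ)))))
      lem′ = solve-∀ ringℚ

  -- Error fractions

  #-mono : ∀ {u} {A B : Pred (Fin u) 0ℓ} (A? : Decidable A) (B? : Decidable B) →
    (∀ x → ⟦ A? x ⟧ ≤ ⟦ B? x ⟧) → # A? ℕ.≤ # B?
  #-mono A? B? A≤B = ι-cancel-≤ (subst₂ _≤_ (sym (ι-# A?)) (sym (ι-# B?)) (sum-mono A≤B))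

  ⟦×⟧≤ˡ : ∀ {A B : Set} (a? : Dec A) (b? : Dec B) → ⟦ a? ×-dec b? ⟧ ≤ ⟦ a? ⟧
  ⟦×⟧≤ˡ (no _)  b?      = ≤-refl
  ⟦×⟧≤ˡ (yes _) (no _)  = 0≤1
  ⟦×⟧≤ˡ (yes _) (yes _) = ≤-refl

  ÷-≤ : ∀ {k d t} → k ℕ.≤ d → k ÷ d ≤ t → ι k ≤ t * ι d
  -- As `k ÷ 0` is 0 by convention, the bound on the quotient carries no information here; `k ≤ d`
  -- forces k = 0.
  ÷-≤ {d = zero} {t} ℕ.z≤n _ = ≤-reflexive (trans ι-0 (sym (trans (cong (t *_) ι-0) (*-zeroʳ t))))
  ÷-≤ {k} {suc d} k≤d k÷d≤t = subst (_≤ _) (÷-* k d) (*-monoʳ (0≤ι (suc d)) k÷d≤t)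

  module _ {u b : ℕ} (M s : Fin u → Maybe (Fin b)) where

    -- The fraction f⁺ is blind to the keys; all of them may be answered, which accounts for the
    -- second summand.
    f⁺-bound : ∀ {t} → 0ℚ ≤ t → f⁺ M s ≤ t → ι (# (≢⊥? s)) ≤ t * ι u + ι (# (≢⊥? M))
    f⁺-bound {t} 0≤t f⁺≤t = begin
      ι (# (≢⊥? s))                                                                 ≡⟨ ι-# (≢⊥? s) ⟩
      sum (λ x → ⟦ ≢⊥? s x ⟧)                                                       ≤⟨ sum-mono (λ x → cover (M x) (≢⊥? s x)) ⟩
      sum (λ x → ⟦ ≡⊥? M x ×-dec ≢⊥? s x ⟧ + ⟦ ≢⊥? M x ⟧)                           ≡⟨ ∑-distrib-+ (λ x → ⟦ ≡⊥? M x ×-dec ≢⊥? s x ⟧) (λ x → ⟦ ≢⊥? M x ⟧) ⟩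
      sum (λ x → ⟦ ≡⊥? M x ×-dec ≢⊥? s x ⟧) + sum (λ x → ⟦ ≢⊥? M x ⟧)               ≡⟨ cong₂ _+_ (ι-# (λ x → ≡⊥? M x ×-dec ≢⊥? s x)) (ι-# (≢⊥? M)) ⟨
      ι (# (λ x → ≡⊥? M x ×-dec ≢⊥? s x)) + ι (# (≢⊥? M))                           ≤⟨ +-monoˡ-≤ (ι (# (≢⊥? M))) (≤-trans (÷-≤ (#-mono (λ x → ≡⊥? M x ×-dec ≢⊥? s x) (≡⊥? M) (λ x → ⟦×⟧≤ˡ (≡⊥? M x) (≢⊥? s x))) f⁺≤t)
                                                                                       (*-monoˡ 0≤t #≤u)) ⟩
      t * ι u + ι (# (≢⊥? M))                                                       ∎
      where
      open ≤-Reasoning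
      cover : ∀ {B : Set} τ (b? : Dec B) → ⟦ b? ⟧ ≤ ⟦ ≡-dec Fin._≟_ τ nothing ×-dec b? ⟧ + ⟦ ¬? (≡-dec (Fin._≟_ {b}) τ nothing) ⟧
      cover nothing (yes _) = ≤-refl
      cover nothing (no _) = ≤-refl
      cover (just _) (yes _) = ≤-refl
      cover (just _) (no _) = 0≤1
      ⟦⟧≤1 : ∀ {A : Set} (a? : Dec A) → ⟦ a? ⟧ ≤ 1ℚ
      ⟦⟧≤1 (yes _) = ≤-refl
      ⟦⟧≤1 (no _) = 0≤1
      #≤u : ι (# (≡⊥? M)) ≤ ι u
      #≤u = ≤-trans (≤-reflexive (ι-# (≡⊥? M))) (≤-trans (sum-mono (λ x → ⟦⟧≤1 (≡⊥? M x))) (≤-reflexive (trans (sum-const u 1ℚ) (*-identityʳ (ι u)))))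

    f*-bound : ∀ {t} i → f* M s i ≤ t → ι (# (λ x → ≡? M i x ×-dec other? s i x)) ≤ t * ι (# (≡? M i))
    f*-bound i = ÷-≤ (#-mono (λ x → ≡? M i x ×-dec other? s i x) (≡? M i) (λ x → ⟦×⟧≤ˡ (≡? M i x) (other? s i x)))

    f⁻-bound : ∀ {t} i → f⁻ M s i ≤ t → ι (# (λ x → ≡? M i x ×-dec ≡⊥? s x)) ≤ t * ι (# (≡? M i))
    f⁻-bound i = ÷-≤ (#-mono (λ x → ≡? M i x ×-dec ≡⊥? s x) (≡? M i) (λ x → ⟦×⟧≤ˡ (≡? M i x) (≡⊥? s x)))

  private
    numerator : ∀ q → 0ℚ ≤ q → ∃[ k ] ∃[ d ] ι k ≡ ι (suc d) * q
    numerator q@(mkℚ (ℤ.+ k) d _) 0≤q = k , d ,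
      trans (ι-def k) (trans (sym (/-* (ℤ.+ k) d)) (trans (cong (_* ι (suc d)) (↥p/↧p≡p q)) (*-comm q (ι (suc d)))))
    numerator q@(mkℚ -[1+ n ] _ _) 0≤q = contradiction (≤-<-trans 0≤q (negative⁻¹ q)) (<-irrefl refl)

  common-denominator : ∀ {ε γ} → 0ℚ ≤ ε → 0ℚ ≤ γ → ε + γ ≤ 1ℚ →
    ∃[ a ] ∃[ c ] ∃[ e ] ∃[ d ] a ℕ.+ c ℕ.+ e ≡ suc d × ι e ≡ ι (suc d) * ε × ι c ≡ ι (suc d) * γ
  common-denominator {ε} {γ} 0≤ε 0≤γ ε+γ≤1 = from (numerator ε 0≤ε) (numerator γ 0≤γ)
    where
    from : ∃[ k ] ∃[ d ] ι k ≡ ι (suc d) * ε → ∃[ k ] ∃[ d ] ι k ≡ ι (suc d) * γ →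
      ∃[ a ] ∃[ c ] ∃[ e ] ∃[ d ] a ℕ.+ c ℕ.+ e ≡ suc d × ι e ≡ ι (suc d) * ε × ι c ≡ ι (suc d) * γ
    from (e₀ , d₁ , e₀≡) (c₀ , d₂ , c₀≡) =
      suc d ℕ.∸ (c ℕ.+ e) , c , e , d , trans (ℕ.+-assoc (suc d ℕ.∸ (c ℕ.+ e)) c e) (ℕ.m∸n+n≡m c+e≤d) , e≡ , c≡
      where
      open ≤-Reasoning
      d = d₂ ℕ.+ d₁ ℕ.* suc d₂
      e = e₀ ℕ.* suc d₂
      c = c₀ ℕ.* suc d₁
      lem₁ : ∀ a b q → a * q * b ≡ a * b * q
      lem₁ = solve-∀ ringℚ
      lem₂ : ∀ a b q → b * q * a ≡ a * b * q
      lem₂ = solve-∀ ringℚ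
      e≡ : ι e ≡ ι (suc d) * ε
      e≡ = trans (ι-* e₀ (suc d₂)) (trans (cong (_* ι (suc d₂)) e₀≡) (trans (lem₁ (ι (suc d₁)) (ι (suc d₂)) ε) (cong (_* ε) (sym (ι-* (suc d₁) (suc d₂))))))
      c≡ : ι c ≡ ι (suc d) * γ
      c≡ = trans (ι-* c₀ (suc d₁)) (trans (cong (_* ι (suc d₁)) c₀≡) (trans (lem₂ (ι (suc d₁)) (ι (suc d₂)) γ) (cong (_* γ) (sym (ι-* (suc d₁) (suc d₂))))))
      lem₃ : ∀ d γ ε → d * γ + d * ε ≡ d * (ε + γ)
      lem₃ = solve-∀ ringℚ
      c+e≤d : c ℕ.+ e ℕ.≤ suc d
      c+e≤d = ι-cancel-≤ (begin
        ι (c ℕ.+ e)                              ≡⟨ trans (ι-+ c e) (cong₂ _+_ c≡ e≡) ⟩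
        ι (suc d) * γ + ι (suc d) * ε            ≡⟨ lem₃ (ι (suc d)) γ ε ⟩
        ι (suc d) * (ε + γ)                      ≤⟨ *-monoˡ (0≤ι (suc d)) ε+γ≤1 ⟩
        ι (suc d) * 1ℚ                           ≡⟨ *-identityʳ (ι (suc d)) ⟩
        ι (suc d)                                ∎)

  -- For K ≥ 1/δ and h ≤ η = 1/(2K), Bernoulli's inequality gives (1 - h)^K ≥ 1/2, hence log(1 - h)
  -- ≥ -1/K ≥ -δ. With h = n/u this bounds the loss from drawing without replacement.
  log-1-h : ∀ {δ} → 0ℚ < δ → ∃[ η ] 0ℚ < η × (∀ {h} → 0ℚ ≤ h → h ≤ 1ℚ → h ≤ η → - δ ≤log 1ℚ - h)
  log-1-h {δ} 0<δ = from (archimedes-* 1ℚ 0<δ)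
    where
    open ≤-Reasoning
    from : ∃[ k ] 1ℚ ≤ δ * ι (suc k) → ∃[ η ] 0ℚ < η × (∀ {h} → 0ℚ ≤ h → h ≤ 1ℚ → h ≤ η → - δ ≤log 1ℚ - h)
    from (k , 1≤δK) = from′ (inv (0<ι k))
      where
      from′ : ∃[ q ] 0ℚ < q × ι (suc k) * q ≡ 1ℚ → ∃[ η ] 0ℚ < η × (∀ {h} → 0ℚ ≤ h → h ≤ 1ℚ → h ≤ η → - δ ≤log 1ℚ - h)
      from′ (q , 0<q , Kq≡1) = q * ½ , 0<* 0<q (positive⁻¹ ½) , λ {h} 0≤h h≤1 h≤η → ≤log-intro 0 1 k
        (subst₂ _≤_ (cong₂ _+_ (neg-distribˡ-* δ (ι (suc k))) (sym (ι-def 1))) (trans (+-inverseˡ 1ℚ) (sym ι-0))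
          (+-monoˡ-≤ 1ℚ (neg-antimono-≤ 1≤δK)))
        (begin
          1ℚ                                      ≡⟨⟩
          (1ℚ - ½) * (2ℚ * 1ℚ)                    ≡⟨ cong (λ t → (1ℚ - t) * (2ℚ * 1ℚ)) (trans (sym (*-identityˡ ½)) (trans (cong (_* ½) (sym Kq≡1)) (*-assoc (ι (suc k)) q ½))) ⟩
          (1ℚ - ι (suc k) * (q * ½)) * (2ℚ * 1ℚ)  ≤⟨ *-monoʳ (0≤^ 1 (<⇒≤ 0<2)) (≤-trans (+-monoʳ-≤ 1ℚ (neg-antimono-≤ (*-monoˡ (0≤ι (suc k)) h≤η))) (bernoulli (suc k) 0≤h h≤1)) ⟩
          (1ℚ - h) ^ suc k * 2ℚ ^ 1               ∎)

open Rational

open import Defs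
open import Axiom.ExcludedMiddle using (ExcludedMiddle)
open import Data.Fin.Base using (Fin; zero; suc)
open import Data.Integer.Base using (+_)
open import Data.Nat.Base as ℕ using (ℕ; zero; suc)
import Data.Nat.Properties as ℕ
open import Data.Product.Base using (Σ-syntax; ∃-syntax; _×_; _,_; proj₁; proj₂; swap)
open import Data.Rational.Base as ℚ using (ℚ; 0ℚ; 1ℚ; ½; _/_)
import Data.Rational.Properties as ℚ
open import Data.Sum.Base using (inj₁; inj₂; [_,_]′)
open import Data.Vec.Functional using ([]; _∷_)
open import Function.Base using (_∘_)
open import Level using (0ℓ)
open import Relation.Binary.PropositionalEquality hiding ([_])
open import Relation.Nullary
open import Relation.Nullary.Decidable using (_×-dec_)
open import Tactic.RingSolver using (solve-∀)
import Algebra.Properties.Semiring.Sum ℕ.+-*-semiring as ℕΣ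

-- Rational sequences converging to a cut

∈-down : ∀ x {q r} → q ℚ.≤ r → r ∈ x → q ∈ x
∈-down x q≤r r∈x = let s , r<s , s∈x = ℝ.rounded x r∈x in ℝ.closed x (ℚ.≤-<-trans q≤r r<s) s∈x

∉-up : ∀ x {q r} → q ℚ.≤ r → q ∉ x → r ∉ x
∉-up x q≤r q∉x r∈x = q∉x (∈-down x q≤r r∈x)

∈∉⇒< : ∀ x {q r} → q ∈ x → r ∉ x → q ℚ.< r
∈∉⇒< x q∈x r∉x = ℚ.≰⇒> λ r≤q → r∉x (∈-down x r≤q q∈x)

infix 4 _⟶_

-- Ordinary convergence, written as f j - δ < x ≤ f j + δ so that only membership in the cut `x`
-- occurs.
record _⟶_ (f : ℕ → ℚ) (x : ℝ) : Set where
  constructor limit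
  field
    converges : ∀ δ → 0ℚ ℚ.< δ → ∃[ N ] ∀ j → N ℕ.≤ j → (f j ℚ.- δ) ∈ x × (f j ℚ.+ δ) ∉ x

open _⟶_ public

private
  half : ∀ {δ} → 0ℚ ℚ.< δ → 0ℚ ℚ.< δ ℚ.* ½
  half 0<δ = 0<* 0<δ (ℚ.positive⁻¹ ½)

  minus< : ∀ q {δ} → 0ℚ ℚ.< δ → q ℚ.- δ ℚ.< q
  minus< q {δ} 0<δ = <-by δ 0<δ (lem q δ)
    where
    lem : ∀ q d → q ℚ.- d ℚ.+ d ≡ q
    lem = solve-∀ ringℚ

⟶-const : ∀ q → (λ _ → q) ⟶ fromℚ q
⟶-const q .converges δ 0<δ = 0 , λ _ _ → minus< q 0<δ , ≤⇒≯ (≤-by δ (ℚ.<⇒≤ 0<δ) refl)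

⟶-≃ : ∀ {f x y} → f ⟶ x → x ≃ y → f ⟶ y
⟶-≃ f⟶x (x≤y , y≤x) .converges δ 0<δ =
  let N , lim = converges f⟶x δ 0<δ
  in N , λ j N≤j → x≤y _ (proj₁ (lim j N≤j)) , λ f+δ∈y → proj₂ (lim j N≤j) (y≤x _ f+δ∈y)

⟶-cong : ∀ {f g x} → (∀ j → f j ≡ g j) → f ⟶ x → g ⟶ x
⟶-cong {x = x} f≗g f⟶x .converges δ 0<δ =
  let N , lim = converges f⟶x δ 0<δ
  in N , λ j N≤j → subst (λ q → (q ℚ.- δ) ∈ x × (q ℚ.+ δ) ∉ x) (f≗g j) (lim j N≤j)

⟶-unique-≤ : ∀ {f x y} → f ⟶ x → f ⟶ y → x ≤ y
⟶-unique-≤ {f} {x} {y} f⟶x f⟶y q q∈x =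
  let r , q<r , r∈x = ℝ.rounded x q∈x
      0<r-q = p<q⇒0<q-p q<r
      δ = (r ℚ.- q) ℚ.* ½
      N , lim = converges f⟶x δ (half 0<r-q)
      N′ , lim′ = converges f⟶y δ (half 0<r-q)
      j = N ℕ.⊔ N′
      r<f+δ = ∈∉⇒< x r∈x (proj₂ (lim j (ℕ.m≤m⊔n N N′)))
  in ℝ.closed y (subst₂ ℚ._<_ (lem r q) (lem′ (f j) δ) (ℚ.+-monoˡ-< (ℚ.- (δ ℚ.+ δ)) r<f+δ))
       (proj₁ (lim′ j (ℕ.m≤n⊔m N N′)))
  where
  lem : ∀ r q → r ℚ.+ ℚ.- ((r ℚ.- q) ℚ.* ½ ℚ.+ (r ℚ.- q) ℚ.* ½) ≡ q
  lem = solve-∀ ringℚ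
  lem′ : ∀ f d → f ℚ.+ d ℚ.+ ℚ.- (d ℚ.+ d) ≡ f ℚ.- d
  lem′ = solve-∀ ringℚ

-- This replaces algebraic laws for cuts: two real expressions are equal once they are limits of the
-- same rational sequence, and that is a matter of rational arithmetic.
⟶-unique : ∀ {f x y} → f ⟶ x → f ⟶ y → x ≃ y
⟶-unique f⟶x f⟶y = ⟶-unique-≤ f⟶x f⟶y , ⟶-unique-≤ f⟶y f⟶x

fromℚ-cancel-≤ : ∀ {p q} → fromℚ p ≤ fromℚ q → p ℚ.≤ q
fromℚ-cancel-≤ {p} {q} p≤q = ℚ.≮⇒≥ λ q<p → ℚ.<-irrefl refl (p≤q q q<p)

fromℚ-injective : ∀ {p q} → fromℚ p ≃ fromℚ q → p ≡ q
fromℚ-injective (p≤q , q≤p) = ℚ.≤-antisym (fromℚ-cancel-≤ p≤q) (fromℚ-cancel-≤ q≤p)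

⟶-+ : ∀ {f g x y} → f ⟶ x → g ⟶ y → (λ j → f j ℚ.+ g j) ⟶ x + y
⟶-+ {f} {g} {x} {y} f⟶x g⟶y .converges δ 0<δ =
  let η = δ ℚ.* ½ ℚ.* ½
      0<η = half (half 0<δ)
      N , lim = converges f⟶x η 0<η
      N′ , lim′ = converges g⟶y η 0<η
  in N ℕ.⊔ N′ , λ j N≤j →
    let f-∈ , f+∉ = lim j (ℕ.≤-trans (ℕ.m≤m⊔n N N′) N≤j)
        g-∈ , g+∉ = lim′ j (ℕ.≤-trans (ℕ.m≤n⊔m N N′) N≤j)
    in (f j ℚ.- η , g j ℚ.- η , f-∈ , g-∈ , <-by (δ ℚ.* ½) (half 0<δ) (lem (f j) (g j) δ))
     , λ (a , c , a∈x , c∈y , lt) → ℚ.<-asym lt (ℚ.<-≤-trans (ℚ.+-mono-< (∈∉⇒< x a∈x f+∉) (∈∉⇒< y c∈y g+∉))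
         (≤-by (δ ℚ.* ½) (ℚ.<⇒≤ (half 0<δ)) (lem′ (f j) (g j) δ)))
  where
  lem : ∀ f g d → f ℚ.+ g ℚ.- d ℚ.+ d ℚ.* ½ ≡ (f ℚ.- d ℚ.* ½ ℚ.* ½) ℚ.+ (g ℚ.- d ℚ.* ½ ℚ.* ½)
  lem = solve-∀ ringℚ
  lem′ : ∀ f g d → (f ℚ.+ d ℚ.* ½ ℚ.* ½) ℚ.+ (g ℚ.+ d ℚ.* ½ ℚ.* ½) ℚ.+ d ℚ.* ½ ≡ f ℚ.+ g ℚ.+ d
  lem′ = solve-∀ ringℚ

⟶-neg : ∀ {f x} → f ⟶ x → (λ j → ℚ.- f j) ⟶ - x
⟶-neg {f} {x} f⟶x .converges δ 0<δ =
  let N , lim = converges f⟶x (δ ℚ.* ½) (half 0<δ)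
  in N , λ j N≤j →
    let f-∈ , f+∉ = lim j N≤j
    in (f j ℚ.+ δ ℚ.* ½ , f+∉ , <-by (δ ℚ.* ½) (half 0<δ) (lem (f j) δ))
     , λ (r , r∉x , lt) → ℚ.<-asym (ℚ.neg-antimono-< (∈∉⇒< x f-∈ r∉x))
         (ℚ.≤-<-trans (≤-by (δ ℚ.* ½) (ℚ.<⇒≤ (half 0<δ)) (lem′ (f j) δ)) lt)
  where
  lem : ∀ f d → ℚ.- f ℚ.- d ℚ.+ d ℚ.* ½ ≡ ℚ.- (f ℚ.+ d ℚ.* ½)
  lem = solve-∀ ringℚ
  lem′ : ∀ f d → ℚ.- (f ℚ.- d ℚ.* ½) ℚ.+ d ℚ.* ½ ≡ ℚ.- f ℚ.+ d
  lem′ = solve-∀ ringℚ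

⟶-- : ∀ {f g x y} → f ⟶ x → g ⟶ y → (λ j → f j ℚ.- g j) ⟶ x - y
⟶-- f⟶x g⟶y = ⟶-+ f⟶x (⟶-neg g⟶y)

private
  p≤∣p∣ : ∀ p → p ℚ.≤ ℚ.∣ p ∣
  p≤∣p∣ p with ℚ.≤-total 0ℚ p
  ... | inj₁ 0≤p = ℚ.≤-reflexive (sym (ℚ.0≤p⇒∣p∣≡p 0≤p))
  ... | inj₂ p≤0 = ℚ.≤-trans p≤0 (ℚ.0≤∣p∣ p)

  -∣p∣≤p : ∀ p → ℚ.- ℚ.∣ p ∣ ℚ.≤ p
  -∣p∣≤p p = subst₂ ℚ._≤_ (cong ℚ.-_ (ℚ.∣-p∣≡∣p∣ p)) (lem p) (ℚ.neg-antimono-≤ (p≤∣p∣ (ℚ.- p)))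
    where
    lem : ∀ p → ℚ.- (ℚ.- p) ≡ p
    lem = solve-∀ ringℚ

  ∣p∣≤ : ∀ {p B} → ℚ.- B ℚ.≤ p → p ℚ.≤ B → ℚ.∣ p ∣ ℚ.≤ B
  ∣p∣≤ {p} {B} -B≤p p≤B with ℚ.∣p∣≡p∨∣p∣≡-p p
  ... | inj₁ eq = subst (ℚ._≤ B) (sym eq) p≤B
  ... | inj₂ eq = subst₂ ℚ._≤_ (sym eq) (lem B) (ℚ.neg-antimono-≤ -B≤p)
    where
    lem : ∀ p → ℚ.- (ℚ.- p) ≡ p
    lem = solve-∀ ringℚ

  ∣p*q∣≤ : ∀ {p q B C} → ℚ.∣ p ∣ ℚ.≤ B → ℚ.∣ q ∣ ℚ.≤ C → ℚ.∣ p ℚ.* q ∣ ℚ.≤ B ℚ.* C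
  ∣p*q∣≤ {p} {q} p≤ q≤ = ℚ.≤-trans (ℚ.≤-reflexive (ℚ.∣p*q∣≡∣p∣*∣q∣ p q)) (*-mono (ℚ.0≤∣p∣ p) (ℚ.0≤∣p∣ q) p≤ q≤)

  -- The product changes by f t + g s + s t, at most η (2B + 1) in absolute value. The equation for
  -- `η` leaves η (1 + δ) to spare, which makes both inequalities strict.
  product-near : ∀ {f g s t B η δ} → ℚ.∣ f ∣ ℚ.≤ B → ℚ.∣ g ∣ ℚ.≤ B → ℚ.∣ s ∣ ℚ.≤ η → ℚ.∣ t ∣ ℚ.≤ η →
    0ℚ ℚ.< η → η ℚ.≤ 1ℚ → 0ℚ ℚ.< δ → η ℚ.* (B ℚ.+ B ℚ.+ 1ℚ ℚ.+ 1ℚ ℚ.+ δ) ≡ δ →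
    f ℚ.* g ℚ.- δ ℚ.< (f ℚ.+ s) ℚ.* (g ℚ.+ t) × (f ℚ.+ s) ℚ.* (g ℚ.+ t) ℚ.< f ℚ.* g ℚ.+ δ
  product-near {f} {g} {s} {t} {B} {η} {δ} f≤ g≤ s≤ t≤ 0<η η≤1 0<δ η≡ =
      subst₂ ℚ._<_ (lem₁ (f ℚ.* g) δ) (lem₂ f g s t) (ℚ.+-monoʳ-< (f ℚ.* g) (ℚ.<-≤-trans (ℚ.neg-antimono-< small) (ℚ.≤-trans (ℚ.neg-antimono-≤ change≤) (-∣p∣≤p change))))
    , subst (ℚ._< f ℚ.* g ℚ.+ δ) (lem₂ f g s t) (ℚ.+-monoʳ-< (f ℚ.* g) (ℚ.≤-<-trans (ℚ.≤-trans (p≤∣p∣ change) change≤) small))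
    where
    change = f ℚ.* t ℚ.+ (g ℚ.* s ℚ.+ s ℚ.* t)
    change≤ : ℚ.∣ change ∣ ℚ.≤ B ℚ.* η ℚ.+ (B ℚ.* η ℚ.+ 1ℚ ℚ.* η)
    change≤ = ℚ.≤-trans (ℚ.∣p+q∣≤∣p∣+∣q∣ (f ℚ.* t) (g ℚ.* s ℚ.+ s ℚ.* t)) (ℚ.+-mono-≤ (∣p*q∣≤ {f} {t} f≤ t≤)
      (ℚ.≤-trans (ℚ.∣p+q∣≤∣p∣+∣q∣ (g ℚ.* s) (s ℚ.* t)) (ℚ.+-mono-≤ (∣p*q∣≤ {g} {s} g≤ s≤) (∣p*q∣≤ {s} {t} (ℚ.≤-trans s≤ η≤1) t≤))))
    small : B ℚ.* η ℚ.+ (B ℚ.* η ℚ.+ 1ℚ ℚ.* η) ℚ.< δ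
    small = <-by (η ℚ.* (1ℚ ℚ.+ δ)) (0<* 0<η (ℚ.+-mono-< 0<1 0<δ)) (trans (lem₃ B η δ) η≡)
      where
      lem₃ : ∀ B η δ → B ℚ.* η ℚ.+ (B ℚ.* η ℚ.+ 1ℚ ℚ.* η) ℚ.+ η ℚ.* (1ℚ ℚ.+ δ) ≡ η ℚ.* (B ℚ.+ B ℚ.+ 1ℚ ℚ.+ 1ℚ ℚ.+ δ)
      lem₃ = solve-∀ ringℚ
    lem₁ : ∀ p d → p ℚ.+ ℚ.- d ≡ p ℚ.- d
    lem₁ = solve-∀ ringℚ
    lem₂ : ∀ f g s t → f ℚ.* g ℚ.+ (f ℚ.* t ℚ.+ (g ℚ.* s ℚ.+ s ℚ.* t)) ≡ (f ℚ.+ s) ℚ.* (g ℚ.+ t)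
    lem₂ = solve-∀ ringℚ

  <-⊓ : ∀ {p q r} → p ℚ.< q → p ℚ.< r → p ℚ.< q ℚ.⊓ r
  <-⊓ {p} {q} {r} p<q p<r = [ (λ eq → subst (p ℚ.<_) (sym eq) p<q) , (λ eq → subst (p ℚ.<_) (sym eq) p<r) ]′ (ℚ.⊓-sel q r)

  edge : ∀ p {c s d} → c ℚ.≤ s → s ℚ.≤ d → (p ℚ.* c) ℚ.⊓ (p ℚ.* d) ℚ.≤ p ℚ.* s
  edge p {c} {s} {d} c≤s s≤d with ℚ.≤-total 0ℚ p
  ... | inj₁ 0≤p = ℚ.≤-trans (ℚ.p⊓q≤p (p ℚ.* c) (p ℚ.* d)) (*-monoˡ 0≤p c≤s)
  ... | inj₂ p≤0 = ℚ.≤-trans (ℚ.p⊓q≤q (p ℚ.* c) (p ℚ.* d)) (ℚ.*-monoˡ-≤-nonPos p {{ℚ.nonPositive p≤0}} s≤d)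

  corner-≤ : ∀ {a b c d r s} → a ℚ.≤ r → r ℚ.≤ b → c ℚ.≤ s → s ℚ.≤ d →
    ((a ℚ.* c) ℚ.⊓ (a ℚ.* d)) ℚ.⊓ ((b ℚ.* c) ℚ.⊓ (b ℚ.* d)) ℚ.≤ r ℚ.* s
  corner-≤ {a} {b} {c} {d} {r} {s} a≤r r≤b c≤s s≤d = ℚ.≤-trans (ℚ.⊓-mono-≤ (edge a c≤s s≤d) (edge b c≤s s≤d))
    (subst₂ ℚ._≤_ (cong₂ ℚ._⊓_ (ℚ.*-comm s a) (ℚ.*-comm s b)) (ℚ.*-comm s r) (edge s a≤r r≤b))

  eventually-bounded : ∀ {f x} → f ⟶ x → ∃[ B ] 0ℚ ℚ.≤ B × ∃[ N ] ∀ j → N ℕ.≤ j → ℚ.∣ f j ∣ ℚ.≤ B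
  eventually-bounded {f} {x} f⟶x =
    let a , a∈x = ℝ.inhabited x
        b , b∉x = ℝ.bounded x
        B = ℚ.∣ a ∣ ℚ.+ ℚ.∣ b ∣ ℚ.+ 1ℚ
        N , lim = converges f⟶x 1ℚ 0<1
    in B , 0≤+ (0≤+ (ℚ.0≤∣p∣ a) (ℚ.0≤∣p∣ b)) 0≤1 , N , λ j N≤j →
      let f-1∈ , f+1∉ = lim j N≤j
      in ∣p∣≤ (ℚ.≤-trans (≤-by (ℚ.∣ b ∣) (ℚ.0≤∣p∣ b) (lem₁ ℚ.∣ a ∣ ℚ.∣ b ∣)) (ℚ.≤-trans (ℚ.+-monoˡ-≤ (ℚ.- 1ℚ) (ℚ.≤-trans (-∣p∣≤p a) (ℚ.<⇒≤ (∈∉⇒< x a∈x f+1∉)))) (ℚ.≤-reflexive (lem₂ (f j)))))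
              (ℚ.≤-trans (ℚ.≤-trans (ℚ.≤-reflexive (lem₃ (f j))) (ℚ.+-monoˡ-≤ 1ℚ (ℚ.≤-trans (ℚ.<⇒≤ (∈∉⇒< x f-1∈ b∉x)) (p≤∣p∣ b)))) (≤-by (ℚ.∣ a ∣) (ℚ.0≤∣p∣ a) (lem₄ ℚ.∣ a ∣ ℚ.∣ b ∣)))
    where
    lem₁ : ∀ a b → ℚ.- (a ℚ.+ b ℚ.+ 1ℚ) ℚ.+ b ≡ ℚ.- a ℚ.+ ℚ.- 1ℚ
    lem₁ = solve-∀ ringℚ
    lem₂ : ∀ f → f ℚ.+ 1ℚ ℚ.+ ℚ.- 1ℚ ≡ f
    lem₂ = solve-∀ ringℚ
    lem₃ : ∀ f → f ≡ f ℚ.- 1ℚ ℚ.+ 1ℚ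
    lem₃ = solve-∀ ringℚ
    lem₄ : ∀ a b → b ℚ.+ 1ℚ ℚ.+ a ≡ a ℚ.+ b ℚ.+ 1ℚ
    lem₄ = solve-∀ ringℚ

private
  -- Two rational enclosures of the same real overlap; the larger of their left ends lies in both.
  common : ∀ x {a b q η} → a ∈ x → b ∉ x → (q ℚ.- η) ∈ x → (q ℚ.+ η) ∉ x →
    ∃[ r ] a ℚ.≤ r × r ℚ.≤ b × ℚ.∣ r ℚ.- q ∣ ℚ.≤ η
  common x {a} {b} {q} {η} a∈ b∉ q-∈ q+∉ = r , ℚ.p≤p⊔q a (q ℚ.- η) , ℚ.⊔-lub (lt a∈ b∉) (lt q-∈ b∉) ,
    ∣p∣≤ (subst (ℚ._≤ r ℚ.- q) (lem₃ q η) (ℚ.+-monoˡ-≤ (ℚ.- q) (ℚ.p≤q⊔p a (q ℚ.- η))))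
         (subst (r ℚ.- q ℚ.≤_) (lem₄ q η) (ℚ.+-monoˡ-≤ (ℚ.- q) (ℚ.⊔-lub (lt a∈ q+∉) (lt q-∈ q+∉))))
    where
    r = a ℚ.⊔ (q ℚ.- η)
    lt : ∀ {q r} → q ∈ x → r ∉ x → q ℚ.≤ r
    lt q∈ r∉ = ℚ.<⇒≤ (∈∉⇒< x q∈ r∉)
    lem₃ : ∀ q e → q ℚ.- e ℚ.- q ≡ ℚ.- e
    lem₃ = solve-∀ ringℚ
    lem₄ : ∀ q e → q ℚ.+ e ℚ.- q ≡ e
    lem₄ = solve-∀ ringℚ

  -- The summand `δ` in the divisor ensures η ≤ 1 without a case distinction.
  product-scale : ∀ {B δ} → 0ℚ ℚ.≤ B → 0ℚ ℚ.< δ →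
    ∃[ η ] 0ℚ ℚ.< η × η ℚ.≤ 1ℚ × η ℚ.* (B ℚ.+ B ℚ.+ 1ℚ ℚ.+ 1ℚ ℚ.+ δ) ≡ δ
  product-scale {B} {δ} 0≤B 0<δ = scale (inv {W} (ℚ.+-mono-≤-< 0≤B′ 0<δ))
    where
    W = B ℚ.+ B ℚ.+ 1ℚ ℚ.+ 1ℚ ℚ.+ δ
    0≤B′ : 0ℚ ℚ.≤ B ℚ.+ B ℚ.+ 1ℚ ℚ.+ 1ℚ
    0≤B′ = 0≤+ (0≤+ (0≤+ 0≤B 0≤B) 0≤1) 0≤1
    lem₁ : ∀ d v w → d ℚ.* v ℚ.* w ≡ d ℚ.* (w ℚ.* v)
    lem₁ = solve-∀ ringℚ
    scale : ∃[ V ] 0ℚ ℚ.< V × W ℚ.* V ≡ 1ℚ → ∃[ η ] 0ℚ ℚ.< η × η ℚ.≤ 1ℚ × η ℚ.* W ≡ δ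
    scale (V , 0<V , WV≡1) = δ ℚ.* V , 0<* 0<δ 0<V ,
      ℚ.≤-trans {δ ℚ.* V} {W ℚ.* V} {1ℚ} (*-monoʳ {V} {δ} {W} (ℚ.<⇒≤ 0<V) (≤-by (B ℚ.+ B ℚ.+ 1ℚ ℚ.+ 1ℚ) 0≤B′ (ℚ.+-comm δ (B ℚ.+ B ℚ.+ 1ℚ ℚ.+ 1ℚ)))) (ℚ.≤-reflexive WV≡1) ,
      trans (lem₁ δ V W) (trans (cong (δ ℚ.*_) WV≡1) (ℚ.*-identityʳ δ))

  -- From below, the box of radius `η` around (q, r) is itself a witness, as all its corners have
  -- products above q r - δ. From above, any other enclosing box shares a point with that box, and
  -- its least corner product is at most the product at this point.
  *-near : ∀ x y {q r B η δ} → ℚ.∣ q ∣ ℚ.≤ B → ℚ.∣ r ∣ ℚ.≤ B →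
    0ℚ ℚ.< η → η ℚ.≤ 1ℚ → 0ℚ ℚ.< δ → η ℚ.* (B ℚ.+ B ℚ.+ 1ℚ ℚ.+ 1ℚ ℚ.+ δ) ≡ δ →
    (q ℚ.- η) ∈ x → (q ℚ.+ η) ∉ x → (r ℚ.- η) ∈ y → (r ℚ.+ η) ∉ y →
    (q ℚ.* r ℚ.- δ) ∈ x * y × (q ℚ.* r ℚ.+ δ) ∉ x * y
  *-near x y {q} {r} {B} {η} {δ} q≤B r≤B 0<η η≤1 0<δ η≡ q-∈ q+∉ r-∈ r+∉ =
      (q ℚ.- η , q ℚ.+ η , r ℚ.- η , r ℚ.+ η , q-∈ , q+∉ , r-∈ , r+∉ ,
        <-⊓ (<-⊓ (proj₁ (near ∣-η∣≤ ∣-η∣≤)) (proj₁ (near ∣-η∣≤ ∣η∣≤))) (<-⊓ (proj₁ (near ∣η∣≤ ∣-η∣≤)) (proj₁ (near ∣η∣≤ ∣η∣≤))))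
    , λ (a , b , c , d , a∈ , b∉ , c∈ , d∉ , lt) →
         let s , a≤s , s≤b , s≤ = common x a∈ b∉ q-∈ q+∉
             t , c≤t , t≤d , t≤ = common y c∈ d∉ r-∈ r+∉
         in ℚ.<-asym lt (ℚ.≤-<-trans (corner-≤ a≤s s≤b c≤t t≤d)
              (subst₂ (λ s t → s ℚ.* t ℚ.< q ℚ.* r ℚ.+ δ) (lem q s) (lem r t) (proj₂ (near s≤ t≤))))
    where
    ∣η∣≤ : ℚ.∣ η ∣ ℚ.≤ η
    ∣η∣≤ = ℚ.≤-reflexive (ℚ.0≤p⇒∣p∣≡p (ℚ.<⇒≤ 0<η))
    ∣-η∣≤ : ℚ.∣ ℚ.- η ∣ ℚ.≤ η
    ∣-η∣≤ = ℚ.≤-trans (ℚ.≤-reflexive (ℚ.∣-p∣≡∣p∣ η)) ∣η∣≤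
    near : ∀ {s t} → ℚ.∣ s ∣ ℚ.≤ η → ℚ.∣ t ∣ ℚ.≤ η →
      q ℚ.* r ℚ.- δ ℚ.< (q ℚ.+ s) ℚ.* (r ℚ.+ t) × (q ℚ.+ s) ℚ.* (r ℚ.+ t) ℚ.< q ℚ.* r ℚ.+ δ
    near {s} {t} s≤ t≤ = product-near {q} {r} {s} {t} q≤B r≤B s≤ t≤ 0<η η≤1 0<δ η≡
    lem : ∀ f r → f ℚ.+ (r ℚ.- f) ≡ r
    lem = solve-∀ ringℚ

⟶-* : ∀ {f g x y} → f ⟶ x → g ⟶ y → (λ j → f j ℚ.* g j) ⟶ x * y
⟶-* {f} {g} {x} {y} f⟶x g⟶y .converges δ 0<δ =
  let B₁ , 0≤B₁ , N₁ , f≤ = eventually-bounded f⟶x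
      B₂ , 0≤B₂ , N₂ , g≤ = eventually-bounded g⟶y
      η , 0<η , η≤1 , η≡ = product-scale (0≤+ 0≤B₁ 0≤B₂) 0<δ
      N₃ , lim = converges f⟶x η 0<η
      N₄ , lim′ = converges g⟶y η 0<η
  in N₁ ℕ.⊔ N₂ ℕ.⊔ (N₃ ℕ.⊔ N₄) , λ j N≤j →
    let N₁₂≤j = ℕ.≤-trans (ℕ.m≤m⊔n (N₁ ℕ.⊔ N₂) (N₃ ℕ.⊔ N₄)) N≤j
        N₃₄≤j = ℕ.≤-trans (ℕ.m≤n⊔m (N₁ ℕ.⊔ N₂) (N₃ ℕ.⊔ N₄)) N≤j
        f-∈ , f+∉ = lim j (ℕ.≤-trans (ℕ.m≤m⊔n N₃ N₄) N₃₄≤j)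
        g-∈ , g+∉ = lim′ j (ℕ.≤-trans (ℕ.m≤n⊔m N₃ N₄) N₃₄≤j)
    in *-near x y {B = B₁ ℚ.+ B₂} {η} {δ}
         (ℚ.≤-trans (f≤ j (ℕ.≤-trans (ℕ.m≤m⊔n N₁ N₂) N₁₂≤j)) (≤-by B₂ 0≤B₂ refl))
         (ℚ.≤-trans (g≤ j (ℕ.≤-trans (ℕ.m≤n⊔m N₁ N₂) N₁₂≤j)) (≤-by B₁ 0≤B₁ (ℚ.+-comm B₂ B₁)))
         0<η η≤1 0<δ η≡ f-∈ f+∉ g-∈ g+∉

⟶-0 : (λ _ → 0ℚ) ⟶ 0ℝ
⟶-0 = ⟶-const (+ 0 / 1)

⟶-∑ : ∀ {n} {f : Fin n → ℕ → ℚ} {x : Fin n → ℝ} → (∀ i → f i ⟶ x i) → (λ j → sum (λ i → f i j)) ⟶ ∑ x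
⟶-∑ {zero} f⟶x = ⟶-0
⟶-∑ {suc n} f⟶x = ⟶-+ (f⟶x zero) (⟶-∑ (f⟶x ∘ suc))

-- Index j uses precision 1/(j + 1). The predicate `A` carries along the side of the limit, or a
-- certificate such as a bound on a logarithm.
sequence : ∀ {A : ℚ → Set} {x} →
  (∀ h → 0ℚ ℚ.< h → ∃[ q ] A q × (q ℚ.- h) ∈ x × (q ℚ.+ h) ∉ x) → ∃[ f ] f ⟶ x × ∀ j → A (f j)
sequence {A} {x} near = along (λ j → proj₁ (gap j)) (λ j → proj₁ (proj₂ (gap j))) (λ j → proj₂ (proj₂ (gap j)))
  where
  gap : ∀ j → ∃[ h ] 0ℚ ℚ.< h × ι (suc j) ℚ.* h ≡ 1ℚ
  gap j = inv (0<ι j)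
  small : ∀ {h k δ} → 0ℚ ℚ.< h → k ℚ.* h ≡ 1ℚ → 1ℚ ℚ.≤ δ ℚ.* k → h ℚ.≤ δ
  small {h} {k} {δ} 0<h kh≡1 1≤δk = begin
    h                     ≡⟨ ℚ.*-identityˡ h ⟨
    1ℚ ℚ.* h              ≤⟨ *-monoʳ (ℚ.<⇒≤ 0<h) 1≤δk ⟩
    δ ℚ.* k ℚ.* h         ≡⟨ ℚ.*-assoc δ k h ⟩
    δ ℚ.* (k ℚ.* h)       ≡⟨ trans (cong (δ ℚ.*_) kh≡1) (ℚ.*-identityʳ δ) ⟩
    δ                     ∎
    where open ℚ.≤-Reasoning
  along : (h : ℕ → ℚ) → (∀ j → 0ℚ ℚ.< h j) → (∀ j → ι (suc j) ℚ.* h j ≡ 1ℚ) → ∃[ f ] f ⟶ x × ∀ j → A (f j)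
  along h 0<h jh≡1 = f , limit tends , λ j → proj₁ (proj₂ (near (h j) (0<h j)))
    where
    f : ℕ → ℚ
    f j = proj₁ (near (h j) (0<h j))
    tends : ∀ δ → 0ℚ ℚ.< δ → ∃[ N ] ∀ j → N ℕ.≤ j → (f j ℚ.- δ) ∈ x × (f j ℚ.+ δ) ∉ x
    tends δ 0<δ = proj₁ (archimedes-* 1ℚ 0<δ) , λ j N≤j →
      let h≤δ = small (0<h j) (jh≡1 j) (ℚ.≤-trans (proj₂ (archimedes-* 1ℚ 0<δ)) (*-monoˡ (ℚ.<⇒≤ 0<δ) (ι-mono-≤ (ℕ.s≤s N≤j))))
          _ , _ , f-∈ , f+∉ = near (h j) (0<h j)
      in ∈-down x (ℚ.+-monoʳ-≤ (f j) (ℚ.neg-antimono-≤ h≤δ)) f-∈ , ∉-up x (ℚ.+-monoʳ-≤ (f j) h≤δ) f+∉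

-- Locating reals with excluded middle

module Approximation (em : ExcludedMiddle 0ℓ) where

  -- A walk in steps of `h` from a member of the cut towards an upper bound must leave the cut;
  -- excluded middle decides at each step whether it has.
  approximate : ∀ x {h} → 0ℚ ℚ.< h → ∃[ q ] q ∈ x × (q ℚ.+ h) ∉ x
  approximate x {h} 0<h =
    let a , a∈x = ℝ.inhabited x
        b , b∉x = ℝ.bounded x
        K , le = archimedes-* (b ℚ.- a) 0<h
    in walk (suc K) a a∈x (∉-up x (subst₂ ℚ._≤_ (lem a b) (cong (a ℚ.+_) (ℚ.*-comm h (ι (suc K)))) (ℚ.+-monoʳ-≤ a le)) b∉x)
    where
    lem : ∀ a b → a ℚ.+ (b ℚ.- a) ≡ b
    lem = solve-∀ ringℚ
    walk : ∀ K a → a ∈ x → (a ℚ.+ ι K ℚ.* h) ∉ x → ∃[ q ] q ∈ x × (q ℚ.+ h) ∉ x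
    walk zero a a∈x ∉x = contradiction (subst (_∈ x) (sym (trans (cong (λ z → a ℚ.+ z ℚ.* h) ι-0) (lem′ a h))) a∈x) ∉x
      where
      lem′ : ∀ a h → a ℚ.+ 0ℚ ℚ.* h ≡ a
      lem′ = solve-∀ ringℚ
    walk (suc K) a a∈x ∉x with em {(a ℚ.+ h) ∈ x}
    ... | no a+h∉x = a , a∈x , a+h∉x
    ... | yes a+h∈x = walk K (a ℚ.+ h) a+h∈x (subst (_∉ x) (trans (cong (λ k → a ℚ.+ k ℚ.* h) (ι-suc K)) (lem′ a (ι K) h)) ∉x)
      where
      lem′ : ∀ a k h → a ℚ.+ (1ℚ ℚ.+ k) ℚ.* h ≡ a ℚ.+ h ℚ.+ k ℚ.* h
      lem′ = solve-∀ ringℚ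

  from-below : ∀ x → ∃[ f ] f ⟶ x × ∀ j → f j ∈ x
  from-below x = sequence {_∈ x} {x} λ h 0<h →
    let q , q∈x , q+h∉x = approximate x 0<h
    in q , q∈x , ∈-down x (ℚ.<⇒≤ (minus< q 0<h)) q∈x , q+h∉x

-- Rational approximations of the parameters and their logarithms

⅛ : ℚ
⅛ = + 1 / 8

⊓-closed : ∀ {A : ℚ → Set} {p q} → A p → A q → A (p ℚ.⊓ q)
⊓-closed {A} {p} {q} Ap Aq = [ (λ eq → subst A (sym eq) Ap) , (λ eq → subst A (sym eq) Aq) ]′ (ℚ.⊓-sel p q)

⊔-closed : ∀ {A : ℚ → Set} {p q} → A p → A q → A (p ℚ.⊔ q)
⊔-closed {A} {p} {q} Ap Aq = [ (λ eq → subst A (sym eq) Ap) , (λ eq → subst A (sym eq) Aq) ]′ (ℚ.⊔-sel p q)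

0<⇒0ℝ< : ∀ x {q} → 0ℚ ℚ.≤ q → q ∈ x → 0ℝ < x
0<⇒0ℝ< x {q} 0≤q q∈x = q , q∈x , ≤⇒≯ 0≤q

-- Rational approximations f of ε and l of log ε. When ε = 0, f is 0 and l is
-- arbitrary, so l ≤log z is only asked for to the power e with e/d = f.
record EntropyTerm (ε : ℝ) (f l : ℚ) : Set where
  field
    f-nonNeg  : 0ℚ ℚ.≤ f
    f≤⅛       : f ℚ.≤ ⅛
    f∉ε       : f ∉ ε
    weighting : ∀ τ → 0ℚ ℚ.< τ → ∃[ z ] 0ℚ ℚ.≤ z × (∀ q → 0ℚ ℚ.≤ q → q ∉ ε → z ℚ.≤ q ℚ.+ τ) ×
                (∀ d e → ι e ≡ ι d ℚ.* f → ι e ℚ.* l ≤log z ^ e)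

module LogLimit (em : ExcludedMiddle 0ℓ) where
  open Classical em
  open Approximation em

  ∈-log⁻ : ∀ {x l} → 0ℝ < x → l ∈ log x → ∃[ r ] r ∈ x × 0ℚ ℚ.< r × l ≤log r
  ∈-log⁻ {x} 0<x l∈ with em {0ℝ < x}
  ... | no ≮ = contradiction 0<x ≮
  ... | yes _ = let a , k , r , l< , r∈x , 0<r , 2ᵃ≤rᵏ = l∈ in r , r∈x , 0<r , ≤log-ℤ a k (ℚ.<⇒≤ l<) 2ᵃ≤rᵏ

  ∈-log⁺ : ∀ {x l} → 0ℝ < x → ∀ a k r → l ℚ.< a / suc k → r ∈ x → 0ℚ ℚ.< r → 2^ a ℚ.≤ r ^ suc k → l ∈ log x
  ∈-log⁺ {x} 0<x a k r l< r∈x 0<r 2ᵃ≤rᵏ with em {0ℝ < x}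
  ... | no ≮ = contradiction 0<x ≮
  ... | yes _ = a , k , r , l< , r∈x , 0<r , 2ᵃ≤rᵏ

  log-from-below : ∀ {x} → 0ℝ < x → ∃[ f ] f ⟶ log x × ∀ j → ∃[ r ] r ∈ x × 0ℚ ℚ.< r × f j ≤log r
  log-from-below {x} 0<x = let f , f⟶ , f∈ = from-below (log x) in f , f⟶ , λ j → ∈-log⁻ 0<x (f∈ j)

  -- The logarithms of the pᵢ occur with a negative sign and are needed from above. The cut of log x
  -- certifies only lower bounds, so the certificate is transferred to the reciprocal by `≤log-1/`.
  log-1/-from-above : ∀ {x P Q} → x ≃ fromℚ P → 0ℚ ℚ.< P → 0ℚ ℚ.< Q → P ℚ.* Q ≡ 1ℚ →
    ∃[ f ] f ⟶ log x × ∀ j → ℚ.- f j ≤log Q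
  log-1/-from-above {x} {P} {Q} (_ , P≤x) 0<P 0<Q PQ≡1 = sequence {λ l → ℚ.- l ≤log Q} {log x} near
    where
    0<x : 0ℝ < x
    0<x = 0<⇒0ℝ< x ℚ.≤-refl (P≤x 0ℚ 0<P)
    near : ∀ h → 0ℚ ℚ.< h → ∃[ l ] ℚ.- l ≤log Q × (l ℚ.- h) ∈ log x × (l ℚ.+ h) ∉ log x
    near h 0<h = from (approximate (log x) 0<h½)
      where
      0<h½ = 0<* 0<h (ℚ.positive⁻¹ ½)
      lem : ∀ q h → (q ℚ.+ h ℚ.* ½) ℚ.+ h ℚ.* ½ ℚ.- h ≡ q
      lem = solve-∀ ringℚ
      lem′ : ∀ q h → q ℚ.+ h ℚ.* ½ ℚ.+ (h ℚ.+ h ℚ.* ½) ≡ (q ℚ.+ h ℚ.* ½) ℚ.+ h ℚ.* ½ ℚ.+ h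
      lem′ = solve-∀ ringℚ
      from : ∃[ q ] q ∈ log x × (q ℚ.+ h ℚ.* ½) ∉ log x → ∃[ l ] ℚ.- l ≤log Q × (l ℚ.- h) ∈ log x × (l ℚ.+ h) ∉ log x
      -- The first half of `h` leads to an upper bound of log x, the second is the margin that
      -- `≤log-1/` requires.
      from (q , q∈ , q+∉) = (q ℚ.+ h ℚ.* ½) ℚ.+ h ℚ.* ½ ,
        ≤log-1/ 0<P 0<Q PQ≡1 0<h½ (λ a k r r<P 0<r 2ᵃ≤rᵏ → ℚ.≮⇒≥ λ lt → q+∉ (∈-log⁺ 0<x a k r lt (P≤x r r<P) 0<r 2ᵃ≤rᵏ)) ,
        subst (_∈ log x) (sym (lem q h)) q∈ ,
        ∉-up (log x) (≤-by (h ℚ.+ h ℚ.* ½) (ℚ.<⇒≤ (ℚ.+-mono-< 0<h 0<h½)) (lem′ q h)) q+∉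

  -- The two approximations lie on opposite sides: `f` is an upper bound of ε, because error
  -- fractions known to be at most ε must be at most `f`, while for ε > 0 `l` lies below the
  -- logarithm of a rational z < ε, which keeps the weights within their total of 1.
  entropy-term : ∀ {ε} → 0ℝ ≤ ε → ⅛ ∉ ε → ∃[ f ] ∃[ l ] f ⟶ ε × l ⟶ log ε × ∀ j → EntropyTerm ε (f j) (l j)
  entropy-term {ε} 0≤ε ⅛∉ε = cases (em {0ℝ < ε})
    where
    nonNeg : ∀ {q} → q ∉ ε → 0ℚ ℚ.≤ q
    nonNeg q∉ε = ℚ.≮⇒≥ λ q<0 → q∉ε (0≤ε _ q<0)
    above : ∀ h → 0ℚ ℚ.< h → ∃[ q ] (q ℚ.≤ ⅛ × q ∉ ε) × (q ℚ.- h) ∈ ε × (q ℚ.+ h) ∉ ε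
    above h 0<h = from (approximate ε 0<h)
      where
      lem : ∀ q h → q ℚ.+ h ℚ.- h ≡ q
      lem = solve-∀ ringℚ
      from : ∃[ q ] q ∈ ε × (q ℚ.+ h) ∉ ε → ∃[ q ] (q ℚ.≤ ⅛ × q ∉ ε) × (q ℚ.- h) ∈ ε × (q ℚ.+ h) ∉ ε
      from (q , q∈ , q+∉) = r , (ℚ.p⊓q≤q (q ℚ.+ h) ⅛ , r∉) ,
        ∈-down ε (ℚ.≤-trans (ℚ.+-monoˡ-≤ (ℚ.- h) (ℚ.p⊓q≤p (q ℚ.+ h) ⅛)) (ℚ.≤-reflexive (lem q h))) q∈ ,
        ∉-up ε (≤-by h (ℚ.<⇒≤ 0<h) refl) r∉
        where
        r = (q ℚ.+ h) ℚ.⊓ ⅛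
        r∉ : r ∉ ε
        r∉ = ⊓-closed {_∉ ε} q+∉ ⅛∉ε
    cases : Dec (0ℝ < ε) → ∃[ f ] ∃[ l ] f ⟶ ε × l ⟶ log ε × ∀ j → EntropyTerm ε (f j) (l j)
    cases (yes 0<ε) =
      let f , f⟶ , f-prop = sequence {λ q → q ℚ.≤ ⅛ × q ∉ ε} {ε} above
          l , l⟶ , l-prop = log-from-below 0<ε
      in f , l , f⟶ , l⟶ , λ j → record
        { f-nonNeg = nonNeg (proj₂ (f-prop j))
        ; f≤⅛ = proj₁ (f-prop j)
        ; f∉ε = proj₂ (f-prop j)
        ; weighting = λ τ 0<τ → let z , z∈ε , 0<z , l≤logz = l-prop j in
            z , ℚ.<⇒≤ 0<z , (λ q _ q∉ε → ℚ.≤-trans (ℚ.<⇒≤ (∈∉⇒< ε z∈ε q∉ε)) (≤-by τ (ℚ.<⇒≤ 0<τ) refl)) , λ _ e _ → ≤log-^ e l≤logz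
        }
    cases (no 0≮ε) =
      let l , l⟶ , _ = from-below (log ε)
      in (λ _ → 0ℚ) , l , ⟶-≃ ⟶-0 (0≤ε , ε≤0) , l⟶ , λ j → record
        { f-nonNeg = ℚ.≤-refl
        ; f≤⅛ = ℚ.nonNegative⁻¹ ⅛
        ; f∉ε = λ 0∈ε → 0≮ε (0<⇒0ℝ< ε ℚ.≤-refl 0∈ε)
        ; weighting = λ τ 0<τ → τ , ℚ.<⇒≤ 0<τ , (λ q 0≤q _ → ≤-by q 0≤q (ℚ.+-comm τ q)) , λ d e e≡ →
            subst (λ e → ι e ℚ.* l j ≤log τ ^ e) (sym (ι-injective (trans e≡ (trans (ℚ.*-zeroʳ (ι d)) (sym ι-0)))))
              (subst (_≤log 1ℚ) (sym (trans (cong (ℚ._* l j) ι-0) (ℚ.*-zeroˡ (l j)))) 0≤log1)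
        }
      where
      ε≤0 : ε ≤ 0ℝ
      ε≤0 q q∈ε = ℚ.≰⇒> λ 0≤q → 0≮ε (0<⇒0ℝ< ε 0≤q q∈ε)

  module _ {ε⁺ : ℝ} (0<ε⁺ : 0ℝ < ε⁺) (⅛∉ε⁺ : ⅛ ∉ ε⁺) where

    ∈-⁻¹ : ∀ {q} → q ∈ ε⁺ ⁻¹ → ∃[ s ] ∃[ t ] q ℚ.< s × t ∉ ε⁺ × s ℚ.* t ℚ.≤ 1ℚ
    ∈-⁻¹ q∈ with em {0ℝ < ε⁺}
    ... | no ≮ = contradiction 0<ε⁺ ≮
    ... | yes _ = q∈

    1∈⁻¹ : 1ℚ ∈ ε⁺ ⁻¹
    1∈⁻¹ with em {0ℝ < ε⁺}
    ... | no ≮ = contradiction 0<ε⁺ ≮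
    ... | yes _ = 2ℚ , ⅛ , <-by 1ℚ 0<1 refl , ⅛∉ε⁺ , ≤-by (+ 3 / 4) (ℚ.nonNegative⁻¹ (+ 3 / 4)) refl

    -- The strict inequality r t < 1, with `t` an upper bound of ε⁺, leaves room for the n keys that
    -- f⁺ ignores. The maximum with 1 keeps the weight of a correct answer at least that of ⊥.
    log-⁻¹ : ∃[ f ] f ⟶ log (ε⁺ ⁻¹) × ∀ j → ∃[ r ] ∃[ t ] 1ℚ ℚ.≤ r × 0ℚ ℚ.≤ t × r ℚ.* t ℚ.< 1ℚ × t ∉ ε⁺ × f j ≤log r
    log-⁻¹ =
      let f , f⟶ , f-prop = log-from-below {ε⁺ ⁻¹} (0<⇒0ℝ< (ε⁺ ⁻¹) 0≤1 1∈⁻¹)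
      in f , f⟶ , λ j →
        let r₀ , r₀∈ , 0<r₀ , f≤log = f-prop j
            r = r₀ ℚ.⊔ 1ℚ
            s , t , r<s , t∉ , st≤1 = ∈-⁻¹ {r} (⊔-closed {_∈ ε⁺ ⁻¹} r₀∈ 1∈⁻¹)
            0<t = positive t∉
        in r , t , ℚ.p≤q⊔p r₀ 1ℚ , ℚ.<⇒≤ 0<t , ℚ.<-≤-trans (ℚ.*-monoˡ-<-pos t {{ℚ.positive 0<t}} r<s) st≤1 , t∉ ,
           ≤log-mono ℚ.≤-refl (ℚ.<⇒≤ 0<r₀) (ℚ.p≤p⊔q r₀ 1ℚ) f≤log
      where
      positive : ∀ {t} → t ∉ ε⁺ → 0ℚ ℚ.< t
      positive t∉ = let q , q∈ , q≮0 = 0<ε⁺ in ℚ.≤-<-trans (ℚ.≮⇒≥ q≮0) (∈∉⇒< ε⁺ q∈ t∉)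

-- Complements, the error term and rationality of the class proportions

⟶-1 : (λ _ → 1ℚ) ⟶ 1ℝ
⟶-1 = ⟶-const (+ 1 / 1)

⟶-1- : ∀ {f x} → f ⟶ x → (λ j → 1ℚ ℚ.- f j) ⟶ 1ℝ - x
⟶-1- {f} {x} f⟶x = ⟶-- {λ _ → 1ℚ} {f} {1ℝ} {x} ⟶-1 f⟶x

⟶-const-injective : ∀ {p q} → (λ _ → p) ⟶ fromℚ q → p ≡ q
⟶-const-injective {p} lim = fromℚ-injective (⟶-unique (⟶-const p) lim)

≃-trans : ∀ x y z → x ≃ y → y ≃ z → x ≃ z
≃-trans _ _ _ (x≤y , y≤x) (y≤z , z≤y) = (λ q q∈x → y≤z q (x≤y q q∈x)) , λ q q∈z → y≤x q (z≤y q q∈z)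

∉⇒0≤ : ∀ x {q} → 0ℝ ≤ x → q ∉ x → 0ℚ ℚ.≤ q
∉⇒0≤ x 0≤x q∉x = ℚ.≮⇒≥ λ q<0 → q∉x (0≤x _ q<0)

fromℚ-≤ : ∀ x {p q} → fromℚ p ≤ x → q ∉ x → p ℚ.≤ q
fromℚ-≤ x p≤x q∉x = ℚ.≮⇒≥ λ q<p → q∉x (p≤x _ q<p)

-- Extracts from the cut of 1 - x - y a positive gap 1 - (r + q + q′), in which the other two
-- weights may exceed their targets.
complement-slack : ∀ x y {r} → 0ℝ ≤ x → 0ℝ ≤ y → r ∈ 1ℝ - x - y →
  ∃[ q ] ∃[ q′ ] (0ℚ ℚ.≤ q × q ∉ x) × (0ℚ ℚ.≤ q′ × q′ ∉ y) × r ℚ.+ q ℚ.+ q′ ℚ.< 1ℚ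
complement-slack x y {r} 0≤x 0≤y (a₁ , a₂ , (s , t , s<1 , (q , q∉ , t<-q) , a₁<s+t) , (q′ , q′∉ , a₂<-q′) , r<a₁+a₂) =
  q , q′ , (∉⇒0≤ x 0≤x q∉ , q∉) , (∉⇒0≤ y 0≤y q′∉ , q′∉) ,
  subst (r ℚ.+ q ℚ.+ q′ ℚ.<_) (lem q q′)
    (subst (ℚ._< _) (sym (ℚ.+-assoc r q q′)) (ℚ.+-monoˡ-< (q ℚ.+ q′) (ℚ.<-trans r<a₁+a₂ (ℚ.+-mono-< (ℚ.<-trans a₁<s+t (ℚ.+-mono-< s<1 t<-q)) a₂<-q′))))
  where
  lem : ∀ q q′ → 1ℚ ℚ.+ ℚ.- q ℚ.+ ℚ.- q′ ℚ.+ (q ℚ.+ q′) ≡ 1ℚ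
  lem = solve-∀ ringℚ

-- The o(1) term will be min(0, aₙ - c).
min0 : ℝ → ℝ
min0 x = record
  { lower     = λ q → q ℚ.< 0ℚ × q ∈ x
  ; inhabited = let q , q∈x = ℝ.inhabited x
                in q ℚ.⊓ (ℚ.- 1ℚ) , ℚ.≤-<-trans (ℚ.p⊓q≤q q (ℚ.- 1ℚ)) (ℚ.negative⁻¹ (ℚ.- 1ℚ)) , ∈-down x (ℚ.p⊓q≤p q (ℚ.- 1ℚ)) q∈x
  ; bounded   = 0ℚ , λ (0<0 , _) → ℚ.<-irrefl refl 0<0
  ; closed    = λ q<r (r<0 , r∈x) → ℚ.<-trans q<r r<0 , ℝ.closed x q<r r∈x
  ; rounded   = λ (q<0 , q∈x) →
                  let r , q<r , r∈x = ℝ.rounded x q∈x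
                      s , q<s , s<0 = ℚ.<-dense q<0
                  in s ℚ.⊓ r , ⊓-closed {λ t → _ ℚ.< t} q<s q<r , ℚ.≤-<-trans (ℚ.p⊓q≤p s r) s<0 , ∈-down x (ℚ.p⊓q≤q s r) r∈x
  }

c+min0≤a : ∀ a c → c + min0 (a - c) ≤ a
c+min0≤a a c q (x , y , x∈c , (_ , (t , w , t∈a , (r , r∉c , w<-r) , y<t+w)) , q<x+y) =
  ℝ.closed a (ℚ.<-trans q<x+y (subst (x ℚ.+ y ℚ.<_) (lem r t) (ℚ.+-mono-< (∈∉⇒< c x∈c r∉c) (ℚ.<-trans y<t+w (ℚ.+-monoʳ-< t w<-r))))) t∈a
  where
  lem : ∀ r t → r ℚ.+ (t ℚ.+ ℚ.- r) ≡ t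
  lem = solve-∀ ringℚ

-δ≤min0 : ∀ {a c δ} → 0ℚ ℚ.< δ → (a ℚ.+ δ) ∉ c → fromℚ (ℚ.- δ) ≤ min0 (fromℚ a - c)
-δ≤min0 {a} {c} {δ} 0<δ a+δ∉c q q<-δ = ℚ.<-trans q<-δ (ℚ.neg-antimono-< 0<δ) ,
  a ℚ.- γ , ℚ.- (a ℚ.+ δ) ℚ.- γ , <-by γ 0<γ (lem₁ a γ) ,
  (a ℚ.+ δ , a+δ∉c , <-by γ 0<γ (lem₁ (ℚ.- (a ℚ.+ δ)) γ)) ,
  <-by (½ ℚ.* (ℚ.- δ ℚ.- q)) (0<* (ℚ.positive⁻¹ ½) (p<q⇒0<q-p q<-δ)) (lem₂ q a δ)
  where
  -- A quarter of the gap between q and -δ: it is lost once in each summand, and half of the gap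
  -- remains for the strict inequality.
  γ = ½ ℚ.* ½ ℚ.* (ℚ.- δ ℚ.- q)
  0<γ : 0ℚ ℚ.< γ
  0<γ = 0<* {½ ℚ.* ½} (ℚ.positive⁻¹ (½ ℚ.* ½)) (p<q⇒0<q-p q<-δ)
  lem₁ : ∀ a g → a ℚ.- g ℚ.+ g ≡ a
  lem₁ = solve-∀ ringℚ
  lem₂ : ∀ q a δ → q ℚ.+ ½ ℚ.* (ℚ.- δ ℚ.- q) ≡ (a ℚ.- ½ ℚ.* ½ ℚ.* (ℚ.- δ ℚ.- q)) ℚ.+ (ℚ.- (a ℚ.+ δ) ℚ.- ½ ℚ.* ½ ℚ.* (ℚ.- δ ℚ.- q))
  lem₂ = solve-∀ ringℚ

min0≤δ : ∀ {x δ} → 0ℚ ℚ.< δ → min0 x ≤ fromℚ δ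
min0≤δ 0<δ q (q<0 , _) = ℚ.<-trans q<0 0<δ

module _ {p : ℝ} {P : ℚ} (p≃P : p ≃ fromℚ P) where

  rational-multiple : ∀ {n k} → p * fromℕ n ≃ fromℕ k → ι k ≡ P ℚ.* ι n
  rational-multiple {n} {k} pn≃k = trans (ι-def k) (trans (sym (⟶-const-injective {P ℚ.* (+ n / 1)} {+ k / 1}
    (⟶-≃ {y = fromℕ k} (⟶-* (⟶-≃ {y = p} (⟶-const P) (swap p≃P)) (⟶-const (+ n / 1))) pn≃k))) (cong (P ℚ.*_) (sym (ι-def n))))

module Rationality (em : ExcludedMiddle 0ℓ) where
  open Approximation em

  -- Along any rational sequence tending to p, multiplying by n + 1 and then by its inverse changes
  -- nothing; in the limit, p is k/(n + 1).
  rational : ∀ {p n k} → p * fromℕ (suc n) ≃ fromℕ k → ∃[ P ] p ≃ fromℚ P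
  rational {p} {n} {k} pn≃k = from (inv (0<ι n))
    where
    from : ∃[ w ] 0ℚ ℚ.< w × ι (suc n) ℚ.* w ≡ 1ℚ → ∃[ P ] p ≃ fromℚ P
    from (w , _ , nw≡1) = from′ (from-below p)
      where
      from′ : ∃[ f ] f ⟶ p × (∀ j → f j ∈ p) → ∃[ P ] p ≃ fromℚ P
      from′ (f , f⟶p , _) = (+ k / 1) ℚ.* w ,
        ≃-trans p (fromℕ k * fromℚ w) (fromℚ ((+ k / 1) ℚ.* w)) (⟶-unique f⟶p (⟶-cong cancel (⟶-* (⟶-≃ {y = fromℕ k} (⟶-* f⟶p (⟶-const (+ suc n / 1))) pn≃k) (⟶-const w))))
          (⟶-unique (⟶-* (⟶-const (+ k / 1)) (⟶-const w)) (⟶-const ((+ k / 1) ℚ.* w)))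
        where
        cancel : ∀ j → f j ℚ.* (+ suc n / 1) ℚ.* w ≡ f j
        cancel j = trans (ℚ.*-assoc (f j) (+ suc n / 1) w)
          (trans (cong (f j ℚ.*_) (trans (cong (ℚ._* w) (sym (ι-def (suc n)))) nw≡1)) (ℚ.*-identityʳ (f j)))

-- The lower bound

÷-cancel : ∀ n u → 1 ℕ.≤ u → (n ÷ u) ℚ.* ι u ≡ ι n
÷-cancel n (suc u) _ = ÷-* n u

0≤÷ : ∀ n u → 0ℚ ℚ.≤ n ÷ u
0≤÷ n zero = ℚ.≤-refl
0≤÷ n (suc u) = *-cancelˡ (0<ι u) (subst₂ ℚ._≤_ (sym (ℚ.*-zeroʳ (ι (suc u)))) (trans (sym (÷-* n u)) (ℚ.*-comm (n ÷ suc u) (ι (suc u)))) (0≤ι n))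

≤÷ : ∀ {q} m n → 1 ℕ.≤ n → ι n ℚ.* q ℚ.≤ ι m → q ℚ.≤ m ÷ n
≤÷ m (suc n) _ le = *-cancelˡ (0<ι n) (ℚ.≤-trans le (ℚ.≤-reflexive (trans (sym (÷-* m n)) (ℚ.*-comm (m ÷ suc n) (ι (suc n))))))

1≤⇒0<ι : ∀ {u} → 1 ℕ.≤ u → 0ℚ ℚ.< ι u
1≤⇒0<ι {suc u} _ = 0<ι u

module _
  {b : ℕ} (p : Fin b → ℝ) {P Q : Fin b → ℚ} (p≃P : ∀ i → p i ≃ fromℚ (P i))
  (0≤P : ∀ i → 0ℚ ℚ.≤ P i) (P≤1 : ∀ i → P i ℚ.≤ 1ℚ) (0≤Q : ∀ i → 0ℚ ℚ.≤ Q i)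
  (PQ≡1 : ∀ i → P i ℚ.* Q i ≡ 1ℚ) (∑P≡1 : sum P ≡ 1ℚ)
  (ε⁺ ε* ε⁻ : ℝ)
  where

  -- Here `h` is n/u. Together with h ≤ η, the condition r t + r η ≤ 1 absorbs the answered keys and
  -- gives r times the number of answered elements at most u; h ≤ 1/2 ensures n < u.
  one-n : ∀ {ε γ Λ lε lγ lα : ℚ} {lp : Fin b → ℚ} {x y z r t η δ : ℚ} →
    0ℚ ℚ.≤ y → 0ℚ ℚ.≤ z → y ℚ.≤ x → z ℚ.≤ x → x ℚ.+ y ℚ.+ z ℚ.≤ 1ℚ →
    1ℚ ℚ.≤ r → 0ℚ ℚ.≤ t → t ∉ ε⁺ → r ℚ.* t ℚ.+ r ℚ.* η ℚ.≤ 1ℚ →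
    γ ∉ ε* → ε ∉ ε⁻ →
    (a c e d : ℕ) → a ℕ.+ c ℕ.+ e ≡ suc d → ι e ≡ ι (suc d) ℚ.* ε → ι c ≡ ι (suc d) ℚ.* γ →
    Λ ≤log r → lα ≤log x → ι c ℚ.* lγ ≤log y ^ c → ι e ℚ.* lε ≤log z ^ e → (∀ i → ℚ.- lp i ≤log Q i) →
    ∀ {n u m} → Admissible p n → 0ℚ ℚ.< ι u →
    ∀ {h} → h ℚ.* ι u ≡ ι n → 0ℚ ℚ.≤ h → h ℚ.≤ η → h ℚ.≤ ½ → ℚ.- δ ≤log 1ℚ ℚ.- h →
    Σ[ D ∈ DataStructure m u b ] EncodesAll ε⁺ ε* ε⁻ D p n →
    ι n ℚ.* (rhs ε γ Λ lε lγ lα P lp ℚ.- δ) ℚ.≤ ι m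
  one-n {ε} {γ} {Λ} {lε} {lγ} {lα} {lp} {x} {y} {z} {r} {t} {η} {δ} 0≤y 0≤z y≤x z≤x x+y+z≤1 1≤r 0≤t t∉ε⁺ rt+rη≤1 γ∉ε* ε∉ε⁻ a c e d D≡ e≡ c≡
    r-log x-log y-log z-log Q-log {n} {u} {m} (_ , pn) 0<u {h} hu≡n 0≤h h≤η h≤½ 1-h-log (𝔻 , encodesAll) =
    counting-bound-log {b} {n} {u} {m} {v} u≡ k ∑k≡n 0≤P P≤1 0≤Q PQ≡1 k≡ ∑P≡1 0≤y 0≤z y≤x z≤x x+y+z≤1 1≤r a c e d D≡ 𝔻 encodes
        {ε} {γ} {Λ} {lε} {lγ} {lα} {δ} {1ℚ ℚ.- h} {lp} e≡ c≡ (p≤q⇒0≤q-p h≤1) ρu≡v 1-h-log r-log x-log y-log z-log Q-log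
    where
    open ℚ.≤-Reasoning
    h≤1 : h ℚ.≤ 1ℚ
    h≤1 = ℚ.≤-trans h≤½ (≤-by ½ 0≤½ refl)
    n<u : n ℕ.< u
    n<u = ℕ.≰⇒> λ u≤n → ≤⇒≯ (ι-mono-≤ u≤n) (ℚ.≤-<-trans (ℚ.≤-trans (ℚ.≤-reflexive (sym hu≡n)) (*-monoʳ (0≤ι u) h≤½))
      (<-by (½ ℚ.* ι u) (0<* (ℚ.positive⁻¹ ½) 0<u) (lem (ι u))))
      where
      lem : ∀ u → ½ ℚ.* u ℚ.+ ½ ℚ.* u ≡ u
      lem = solve-∀ ringℚ
    v = u ℕ.∸ suc n
    u≡ : u ≡ suc v ℕ.+ n
    u≡ = trans (sym (ℕ.m∸n+n≡m n<u)) (ℕ.+-suc v n)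
    ρu≡v : (1ℚ ℚ.- h) ℚ.* ι u ≡ ι (suc v)
    ρu≡v = trans (lem h (ι u)) (trans (cong₂ ℚ._-_ (trans (cong ι u≡) (ι-+ (suc v) n)) hu≡n) (lem′ (ι (suc v)) (ι n)))
      where
      lem : ∀ h u → (1ℚ ℚ.- h) ℚ.* u ≡ u ℚ.- h ℚ.* u
      lem = solve-∀ ringℚ
      lem′ : ∀ v n → v ℚ.+ n ℚ.- n ≡ v
      lem′ = solve-∀ ringℚ
    k : Fin b → ℕ
    k i = proj₁ (pn i)
    k≡ : ∀ i → ι (k i) ≡ P i ℚ.* ι n
    k≡ i = rational-multiple {p i} (p≃P i) {n} {k i} (proj₂ (pn i))
    ∑k≡n : ℕΣ.sum k ≡ n
    ∑k≡n = ι-injective (trans (ι-sum k) (trans (sum-cong-≗ k≡) (trans (sym (*-distribʳ-sum (ι n) P))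
      (trans (cong (ℚ._* ι n) ∑P≡1) (ℚ.*-identityˡ (ι n))))))

    encodes : ∀ M → # (≢⊥? M) ≡ n → (∀ i → # (≡? M i) ≡ k i) → ∃[ s ]
      r ℚ.* ι (# (≢⊥? (𝔻 s))) ℚ.≤ ι u × ∀ i →
      ι (a ℕ.+ c ℕ.+ e) ℚ.* ι (# (λ x → ≡? M i x ×-dec other? (𝔻 s) i x)) ℚ.≤ ι c ℚ.* ι (k i) ×
      ι (a ℕ.+ c ℕ.+ e) ℚ.* ι (# (λ x → ≡? M i x ×-dec ≡⊥? (𝔻 s) x)) ℚ.≤ ι e ℚ.* ι (k i)
    encodes M dom classes = string (encodesAll (record { val = M ; ∣X∣ = dom ; ∣Xᵢ∣ = class }))
      where
      class : ∀ i → fromℕ (# (≡? M i)) ≃ p i * fromℕ n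
      class i = subst (λ k → fromℕ k ≃ p i * fromℕ n) (sym (classes i)) (swap (proj₂ (pn i)))
      string : ∃[ s ] Encodes ε⁺ ε* ε⁻ (𝔻 s) M → ∃[ s ]
        r ℚ.* ι (# (≢⊥? (𝔻 s))) ℚ.≤ ι u × ∀ i →
        ι (a ℕ.+ c ℕ.+ e) ℚ.* ι (# (λ x → ≡? M i x ×-dec other? (𝔻 s) i x)) ℚ.≤ ι c ℚ.* ι (k i) ×
        ι (a ℕ.+ c ℕ.+ e) ℚ.* ι (# (λ x → ≡? M i x ×-dec ≡⊥? (𝔻 s) x)) ℚ.≤ ι e ℚ.* ι (k i)
      string (s , f⁺≤ , f≤) = s , few-positives , λ i →
          few {ι (k i)} {γ} {ι (# (λ x → ≡? M i x ×-dec other? (𝔻 s) i x))} c≡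
            (subst (λ k → ι (# (λ x → ≡? M i x ×-dec other? (𝔻 s) i x)) ℚ.≤ γ ℚ.* ι k) (classes i) (f*-bound M (𝔻 s) i (fromℚ-≤ ε* (proj₁ (f≤ i)) γ∉ε*)))
        , few {ι (k i)} {ε} {ι (# (λ x → ≡? M i x ×-dec ≡⊥? (𝔻 s) x))} e≡
            (subst (λ k → ι (# (λ x → ≡? M i x ×-dec ≡⊥? (𝔻 s) x)) ℚ.≤ ε ℚ.* ι k) (classes i) (f⁻-bound M (𝔻 s) i (fromℚ-≤ ε⁻ (proj₂ (f≤ i)) ε∉ε⁻)))
        where
        few : ∀ {κ φ w j} → ι j ≡ ι (suc d) ℚ.* φ → w ℚ.≤ φ ℚ.* κ → ι (a ℕ.+ c ℕ.+ e) ℚ.* w ℚ.≤ ι j ℚ.* κ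
        few {κ} {φ} {w} {j} j≡ w≤ = ℚ.≤-trans (ℚ.≤-reflexive (cong (λ D → ι D ℚ.* w) D≡)) (ℚ.≤-trans (*-monoˡ (0≤ι (suc d)) w≤)
          (ℚ.≤-reflexive (trans (sym (ℚ.*-assoc (ι (suc d)) φ κ)) (cong (ℚ._* κ) (sym j≡)))))
        few-positives : r ℚ.* ι (# (≢⊥? (𝔻 s))) ℚ.≤ ι u
        few-positives = begin
          r ℚ.* ι (# (≢⊥? (𝔻 s)))                          ≤⟨ *-monoˡ (ℚ.≤-trans 0≤1 1≤r) (f⁺-bound M (𝔻 s) 0≤t (fromℚ-≤ ε⁺ f⁺≤ t∉ε⁺)) ⟩
          r ℚ.* (t ℚ.* ι u ℚ.+ ι (# (≢⊥? M)))              ≡⟨ cong (λ w → r ℚ.* (t ℚ.* ι u ℚ.+ w)) (trans (cong ι dom) (sym hu≡n)) ⟩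
          r ℚ.* (t ℚ.* ι u ℚ.+ h ℚ.* ι u)                  ≤⟨ *-monoˡ (ℚ.≤-trans 0≤1 1≤r) (ℚ.+-monoʳ-≤ (t ℚ.* ι u) (*-monoʳ (0≤ι u) h≤η)) ⟩
          r ℚ.* (t ℚ.* ι u ℚ.+ η ℚ.* ι u)                  ≡⟨ lem r t η (ι u) ⟩
          (r ℚ.* t ℚ.+ r ℚ.* η) ℚ.* ι u                    ≤⟨ *-monoʳ (0≤ι u) rt+rη≤1 ⟩
          1ℚ ℚ.* ι u                                       ≡⟨ ℚ.*-identityˡ (ι u) ⟩
          ι u                                              ∎
          where
          lem : ∀ r t η u → r ℚ.* (t ℚ.* u ℚ.+ η ℚ.* u) ≡ (r ℚ.* t ℚ.+ r ℚ.* η) ℚ.* u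
          lem = solve-∀ ringℚ

  -- For one fixed choice of rational approximations, all slacks are positive constants: `τ` comes
  -- from x < 1 - ε⁻ - ε*, `η` from r t < 1 and from δ. Hence n/u ≤ η holds from some N on.
  sample-bound : 0ℝ ≤ ε* → 0ℝ ≤ ε⁻ → ⅛ ∉ ε* → ⅛ ∉ ε⁻ →
    ∀ {ε γ Λ lε lγ lα : ℚ} {lp : Fin b → ℚ} → EntropyTerm ε⁻ ε lε → EntropyTerm ε* γ lγ →
    ∃[ x ] (x ∈ 1ℝ - ε⁻ - ε* × ½ ℚ.≤ x × lα ≤log x) →
    ∃[ r ] ∃[ t ] (1ℚ ℚ.≤ r × 0ℚ ℚ.≤ t × r ℚ.* t ℚ.< 1ℚ × t ∉ ε⁺ × Λ ≤log r) →
    (∀ i → ℚ.- lp i ≤log Q i) →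
    (u m : ℕ → ℕ) → (∀ n → Admissible p n → 1 ℕ.≤ u n) →
    Vanishes (Admissible p) (λ n → fromℚ (n ÷ u n)) →
    (∀ n → Admissible p n → Σ[ D ∈ DataStructure (m n) (u n) b ] EncodesAll ε⁺ ε* ε⁻ D p n) →
    ∀ {δ} → 0ℚ ℚ.< δ → ∃[ N ] ∀ n → N ℕ.≤ n → Admissible p n → rhs ε γ Λ lε lγ lα P lp ℚ.- δ ℚ.≤ m n ÷ n
  sample-bound 0≤ε* 0≤ε⁻ ⅛∉ε* ⅛∉ε⁻ {ε} {γ} {Λ} {lε} {lγ} {lα} {lp} termε termγ (x , x∈ , ½≤x , x-log)
    (r , t , 1≤r , 0≤t , rt<1 , t∉ , r-log) Q-log u m 1≤u vanishes structures {δ} 0<δ =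
    choose-τ (complement-slack ε⁻ ε* 0≤ε⁻ 0≤ε* x∈)
    where
    open EntropyTerm
    Goal = ∃[ N ] ∀ n → N ℕ.≤ n → Admissible p n → rhs ε γ Λ lε lγ lα P lp ℚ.- δ ℚ.≤ m n ÷ n

    0≤⅛ : 0ℚ ℚ.≤ ⅛
    0≤⅛ = ℚ.nonNegative⁻¹ ⅛

    choose-η : ∀ {y z} → 0ℚ ℚ.≤ y → 0ℚ ℚ.≤ z → y ℚ.≤ x → z ℚ.≤ x → x ℚ.+ y ℚ.+ z ℚ.≤ 1ℚ →
      (∀ d e → ι e ≡ ι d ℚ.* γ → ι e ℚ.* lγ ≤log y ^ e) → (∀ d e → ι e ≡ ι d ℚ.* ε → ι e ℚ.* lε ≤log z ^ e) → Goal
    choose-η {y} {z} 0≤y 0≤z y≤x z≤x x+y+z≤1 y-log z-log =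
      from (inv {r} (ℚ.<-≤-trans 0<1 1≤r)) (log-1-h 0<δ)
        (common-denominator (f-nonNeg termε) (f-nonNeg termγ) (ℚ.≤-trans (ℚ.+-mono-≤ (f≤⅛ termε) (f≤⅛ termγ)) (≤-by (+ 3 / 4) (ℚ.nonNegative⁻¹ (+ 3 / 4)) refl)))
      where
      from : ∃[ q ] (0ℚ ℚ.< q × r ℚ.* q ≡ 1ℚ) →
        ∃[ η ] (0ℚ ℚ.< η × (∀ {h} → 0ℚ ℚ.≤ h → h ℚ.≤ 1ℚ → h ℚ.≤ η → ℚ.- δ ≤log 1ℚ ℚ.- h)) →
        ∃[ a ] ∃[ c ] ∃[ e ] ∃[ d ] (a ℕ.+ c ℕ.+ e ≡ suc d × ι e ≡ ι (suc d) ℚ.* ε × ι c ≡ ι (suc d) ℚ.* γ) → Goal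
      from (q , 0<q , rq≡1) (η₁ , 0<η₁ , 1-h-log) (a , c , e , d , D≡ , e≡ , c≡) =
        let N , small = vanishes η 0<η
        in N , λ n N≤n adm → ≤÷ (m n) n (proj₁ adm) (at n adm (÷-cancel n (u n) (1≤u n adm)) (0≤÷ n (u n))
             (fromℚ-cancel-≤ (proj₂ (small n N≤n adm))))
        where
        -- As q = 1/r, this solves r t + r η₂ = 1.
        η₂ = (1ℚ ℚ.- r ℚ.* t) ℚ.* q
        η = η₁ ℚ.⊓ η₂ ℚ.⊓ ½
        0<η : 0ℚ ℚ.< η
        0<η = ⊓-closed {0ℚ ℚ.<_} (⊓-closed {0ℚ ℚ.<_} 0<η₁ (0<* (p<q⇒0<q-p rt<1) 0<q)) (ℚ.positive⁻¹ ½)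
        lem : ∀ r s q → r ℚ.* (s ℚ.* q) ≡ s ℚ.* (r ℚ.* q)
        lem = solve-∀ ringℚ
        lem′ : ∀ s → s ℚ.+ (1ℚ ℚ.- s) ℚ.* 1ℚ ≡ 1ℚ
        lem′ = solve-∀ ringℚ
        rt+rη≤1 : r ℚ.* t ℚ.+ r ℚ.* η ℚ.≤ 1ℚ
        rt+rη≤1 = ℚ.≤-trans (ℚ.+-monoʳ-≤ (r ℚ.* t) (*-monoˡ (ℚ.≤-trans 0≤1 1≤r) (ℚ.≤-trans (ℚ.p⊓q≤p (η₁ ℚ.⊓ η₂) ½) (ℚ.p⊓q≤q η₁ η₂))))
          (ℚ.≤-reflexive (trans (cong (r ℚ.* t ℚ.+_) (trans (lem r (1ℚ ℚ.- r ℚ.* t) q) (cong ((1ℚ ℚ.- r ℚ.* t) ℚ.*_) rq≡1))) (lem′ (r ℚ.* t))))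

        at : ∀ n → Admissible p n → ∀ {h} → h ℚ.* ι (u n) ≡ ι n → 0ℚ ℚ.≤ h → h ℚ.≤ η →
          ι n ℚ.* (rhs ε γ Λ lε lγ lα P lp ℚ.- δ) ℚ.≤ ι (m n)
        at n adm {h} hu≡n 0≤h h≤η = one-n {δ = δ} 0≤y 0≤z y≤x z≤x x+y+z≤1 1≤r 0≤t t∉ rt+rη≤1 (f∉ε termγ) (f∉ε termε) a c e d D≡ e≡ c≡
          r-log x-log (y-log (suc d) c c≡) (z-log (suc d) e e≡) Q-log {n} {u n} {m n} adm (1≤⇒0<ι (1≤u n adm)) {h} hu≡n 0≤h h≤η h≤½
          (1-h-log 0≤h (ℚ.≤-trans h≤½ (≤-by ½ 0≤½ refl)) (ℚ.≤-trans h≤η (ℚ.≤-trans (ℚ.p⊓q≤p (η₁ ℚ.⊓ η₂) ½) (ℚ.p⊓q≤p η₁ η₂))))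
          (structures n adm)
          where
          h≤½ : h ℚ.≤ ½
          h≤½ = ℚ.≤-trans h≤η (ℚ.p⊓q≤q (η₁ ℚ.⊓ η₂) ½)

    choose-τ : ∃[ q ] ∃[ q′ ] ((0ℚ ℚ.≤ q × q ∉ ε⁻) × (0ℚ ℚ.≤ q′ × q′ ∉ ε*) × x ℚ.+ q ℚ.+ q′ ℚ.< 1ℚ) → Goal
    choose-τ (q , q′ , (0≤q , q∉) , (0≤q′ , q′∉) , x+q+q′<1) =
      let y , 0≤y , y≤ , y-log = weighting termγ τ 0<τ
          z , 0≤z , z≤ , z-log = weighting termε τ 0<τ
      in choose-η 0≤y 0≤z (≤x (y≤ ⅛ 0≤⅛ ⅛∉ε*)) (≤x (z≤ ⅛ 0≤⅛ ⅛∉ε⁻)) (total≤1 y z (y≤ q′ 0≤q′ q′∉) (z≤ q 0≤q q∉)) y-log z-log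
      where
      σ = 1ℚ ℚ.- (x ℚ.+ q ℚ.+ q′)
      -- Each of y and z may take half of the gap σ. The cap by 1/8 gives y, z ≤ 1/8 + 1/8 ≤ 1/2 ≤
      -- x, so a correct answer stays the heaviest.
      τ = (σ ℚ.* ½) ℚ.⊓ ⅛
      0<τ : 0ℚ ℚ.< τ
      0<τ = ⊓-closed {0ℚ ℚ.<_} (0<* (p<q⇒0<q-p x+q+q′<1) (ℚ.positive⁻¹ ½)) (ℚ.positive⁻¹ ⅛)
      ≤x : ∀ {w} → w ℚ.≤ ⅛ ℚ.+ τ → w ℚ.≤ x
      ≤x w≤ = ℚ.≤-trans w≤ (ℚ.≤-trans (ℚ.+-monoʳ-≤ ⅛ (ℚ.p⊓q≤q (σ ℚ.* ½) ⅛)) (ℚ.≤-trans (≤-by (+ 1 / 4) (ℚ.nonNegative⁻¹ (+ 1 / 4)) refl) ½≤x))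
      total≤1 : ∀ y z → y ℚ.≤ q′ ℚ.+ τ → z ℚ.≤ q ℚ.+ τ → x ℚ.+ y ℚ.+ z ℚ.≤ 1ℚ
      total≤1 y z y≤ z≤ = ℚ.≤-trans (ℚ.+-mono-≤ (ℚ.+-monoʳ-≤ x (ℚ.≤-trans y≤ (ℚ.+-monoʳ-≤ q′ τ≤))) (ℚ.≤-trans z≤ (ℚ.+-monoʳ-≤ q τ≤)))
        (ℚ.≤-reflexive (lem x q q′))
        where
        τ≤ = ℚ.p⊓q≤p (σ ℚ.* ½) ⅛
        lem : ∀ x q q′ → x ℚ.+ (q′ ℚ.+ (1ℚ ℚ.- (x ℚ.+ q ℚ.+ q′)) ℚ.* ½) ℚ.+ (q ℚ.+ (1ℚ ℚ.- (x ℚ.+ q ℚ.+ q′)) ℚ.* ½) ≡ 1ℚ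
        lem = solve-∀ ringℚ

-- Passage to the limit

½∈complement : ∀ {x y F G} → F ⟶ x → G ⟶ y → (∀ j → F j ℚ.≤ ⅛) → (∀ j → G j ℚ.≤ ⅛) → ½ ∈ 1ℝ - x - y
½∈complement {x} {y} {F} {G} F⟶x G⟶y F≤⅛ G≤⅛ =
  -- The precision 1/4 is what remains: 1 - 1/8 - 1/8 - 1/4 = 1/2.
  let N , lim = converges (⟶-- (⟶-1- F⟶x) G⟶y) (+ 1 / 4) (ℚ.positive⁻¹ (+ 1 / 4))
  in ∈-down (1ℝ - x - y) (ℚ.+-monoˡ-≤ (ℚ.- (+ 1 / 4)) (ℚ.+-mono-≤ (ℚ.+-monoʳ-≤ 1ℚ (ℚ.neg-antimono-≤ (F≤⅛ N))) (ℚ.neg-antimono-≤ (G≤⅛ N))))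
       (proj₁ (lim N ℕ.≤-refl))

module LowerBound (em : ExcludedMiddle 0ℓ) where
  open Classical em
  open LogLimit em
  open Rationality em

  bound : ∀ {b} → (Fin b → ℝ) → (ε⁺ ε* ε⁻ : ℝ) → ℝ
  bound p ε⁺ ε* ε⁻ =
    (1ℝ - ε⁻) * log (ε⁺ ⁻¹)
      + (1ℝ - ε⁻ - ε*) * H p
      - H (ε⁻ ∷ ε* ∷ (1ℝ - ε⁻ - ε*) ∷ [])

  rhs⟶bound : ∀ {b} {p : Fin b → ℝ} {P : Fin b → ℚ} {ε⁺ ε* ε⁻ : ℝ} {F G Λ lF lG lα : ℕ → ℚ} {lp : Fin b → ℕ → ℚ} →
    (∀ i → p i ≃ fromℚ (P i)) → F ⟶ ε⁻ → G ⟶ ε* → Λ ⟶ log (ε⁺ ⁻¹) → lF ⟶ log ε⁻ → lG ⟶ log ε* →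
    lα ⟶ log (1ℝ - ε⁻ - ε*) → (∀ i → lp i ⟶ log (p i)) →
    (λ j → rhs (F j) (G j) (Λ j) (lF j) (lG j) (lα j) P (λ i → lp i j)) ⟶ bound p ε⁺ ε* ε⁻
  rhs⟶bound {p = p} {P} {ε⁺} {ε*} {ε⁻} {F} {G} {Λ} {lF} {lG} {lα} {lp} p≃P F⟶ G⟶ Λ⟶ lF⟶ lG⟶ lα⟶ lp⟶ =
    ⟶-cong (λ j → refl) (⟶-- (⟶-+ t₁ t₂) t₃)
    where
    q : Fin 3 → ℝ
    q = ε⁻ ∷ ε* ∷ (1ℝ - ε⁻ - ε*) ∷ []
    α⟶ : (λ j → 1ℚ ℚ.- F j ℚ.- G j) ⟶ 1ℝ - ε⁻ - ε*
    α⟶ = ⟶-- (⟶-1- F⟶) G⟶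
    f : Fin 3 → ℕ → ℚ
    f = (λ j → F j ℚ.* lF j) ∷ (λ j → G j ℚ.* lG j) ∷ (λ j → (1ℚ ℚ.- F j ℚ.- G j) ℚ.* lα j) ∷ []
    -- The trailing `0ℚ`, also present in `rhs`, is the end of the `foldr` in `H`.
    sum₃ : ∀ (f : Fin 3 → ℚ) → sum f ≡ f zero ℚ.+ (f (suc zero) ℚ.+ (f (suc (suc zero)) ℚ.+ 0ℚ))
    sum₃ f = refl
    terms : ∀ i → f i ⟶ q i * log (q i)
    terms zero = ⟶-* F⟶ lF⟶
    terms (suc zero) = ⟶-* G⟶ lG⟶
    terms (suc (suc zero)) = ⟶-* α⟶ lα⟶
    t₁ : (λ j → (1ℚ ℚ.- F j) ℚ.* Λ j) ⟶ (1ℝ - ε⁻) * log (ε⁺ ⁻¹)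
    t₁ = ⟶-* (⟶-1- F⟶) Λ⟶
    t₂ : (λ j → (1ℚ ℚ.- F j ℚ.- G j) ℚ.* (ℚ.- sum (λ i → P i ℚ.* lp i j))) ⟶ (1ℝ - ε⁻ - ε*) * H p
    t₂ = ⟶-* α⟶ (⟶-neg (⟶-∑ λ i → ⟶-* (⟶-≃ {y = p i} (⟶-const (P i)) (swap (p≃P i))) (lp⟶ i)))
    t₃ : (λ j → ℚ.- (F j ℚ.* lF j ℚ.+ (G j ℚ.* lG j ℚ.+ ((1ℚ ℚ.- F j ℚ.- G j) ℚ.* lα j ℚ.+ 0ℚ)))) ⟶ H q
    t₃ = ⟶-neg (⟶-cong (λ j → sum₃ (λ i → f i j)) (⟶-∑ {3} {f} {λ i → q i * log (q i)} terms))

  module _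
    {b : ℕ} (p : Fin b → ℝ) (0<p : ∀ i → 0ℝ < p i) (∑p≃1 : ∑ p ≃ 1ℝ)
    {ε⁺ ε* ε⁻ : ℝ} (0<ε⁺ : 0ℝ < ε⁺) (0≤ε* : 0ℝ ≤ ε*) (0≤ε⁻ : 0ℝ ≤ ε⁻)
    (⅛∉ε⁺ : ⅛ ∉ ε⁺) (⅛∉ε* : ⅛ ∉ ε*) (⅛∉ε⁻ : ⅛ ∉ ε⁻)
    (u m : ℕ → ℕ) (1≤u : ∀ n → Admissible p n → 1 ℕ.≤ u n)
    (vanishes : Vanishes (Admissible p) (λ n → fromℚ (n ÷ u n)))
    (structures : ∀ n → Admissible p n → Σ[ D ∈ DataStructure (m n) (u n) b ] EncodesAll ε⁺ ε* ε⁻ D p n)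
    where

    private
      Goal : ℚ → Set
      Goal δ = ∃[ N ] ∀ n → N ℕ.≤ n → Admissible p n → (m n ÷ n ℚ.+ δ) ∉ bound p ε⁺ ε* ε⁻

      α = 1ℝ - ε⁻ - ε*

      rational-case : ∀ {P Q : Fin b → ℚ} → (∀ i → p i ≃ fromℚ (P i)) → (∀ i → 0ℚ ℚ.< P i) → (∀ i → 0ℚ ℚ.< Q i) →
        (∀ i → P i ℚ.* Q i ≡ 1ℚ) → ∀ {δ} → 0ℚ ℚ.< δ → Goal δ
      rational-case {P} {Q} p≃P 0<P 0<Q PQ≡1 {δ} 0<δ =
        let F , lF , F⟶ , lF⟶ , termF = entropy-term 0≤ε⁻ ⅛∉ε⁻
            G , lG , G⟶ , lG⟶ , termG = entropy-term 0≤ε* ⅛∉ε*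
            Λ , Λ⟶ , Λ-log = log-⁻¹ 0<ε⁺ ⅛∉ε⁺
            ½∈α = ½∈complement F⟶ G⟶ (λ j → EntropyTerm.f≤⅛ (termF j)) (λ j → EntropyTerm.f≤⅛ (termG j))
            lα , lα⟶ , lα-log = log-from-below {α} (0<⇒0ℝ< α 0≤½ ½∈α)
            lp = λ i → log-1/-from-above (p≃P i) (0<P i) (0<Q i) (PQ≡1 i)
            -- One index j is fixed before n grows: half of δ is spent on the distance between `rhs`
            -- at j and the real bound, the other half on the finite-n losses in `sample-bound`.
            j , lim = converges (rhs⟶bound {p = p} {P} {ε⁺} {ε*} {ε⁻} p≃P F⟶ G⟶ Λ⟶ lF⟶ lG⟶ lα⟶ (λ i → proj₁ (proj₂ (lp i)))) (δ ℚ.* ½) 0<δ½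
            N , large = sample-bound p p≃P (λ i → ℚ.<⇒≤ (0<P i)) P≤1 (λ i → ℚ.<⇒≤ (0<Q i)) PQ≡1 ∑P≡1 ε⁺ ε* ε⁻
              0≤ε* 0≤ε⁻ ⅛∉ε* ⅛∉ε⁻ (termF j) (termG j) (at-least-½ ½∈α (lα-log j)) (Λ-log j) (λ i → proj₂ (proj₂ (lp i)) j)
              u m 1≤u vanishes structures 0<δ½
        in N , λ n N≤n adm → ∉-up (bound p ε⁺ ε* ε⁻) (shift {rhs (F j) (G j) (Λ j) (lF j) (lG j) (lα j) P (λ i → proj₁ (lp i) j)} {m n ÷ n} (large n N≤n adm)) (proj₂ (lim j ℕ.≤-refl))
        where
        0<δ½ : 0ℚ ℚ.< δ ℚ.* ½
        0<δ½ = 0<* 0<δ (ℚ.positive⁻¹ ½)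
        ∑P≡1 : sum P ≡ 1ℚ
        ∑P≡1 = ⟶-const-injective {sum P} {+ 1 / 1} (⟶-≃ {y = 1ℝ} (⟶-∑ λ i → ⟶-≃ {y = p i} (⟶-const (P i)) (swap (p≃P i))) ∑p≃1)
        P≤1 : ∀ i → P i ℚ.≤ 1ℚ
        P≤1 i = ℚ.≤-trans (term≤sum (λ i → ℚ.<⇒≤ (0<P i)) i) (ℚ.≤-reflexive ∑P≡1)
        at-least-½ : ½ ∈ α → ∀ {l} → ∃[ x ] (x ∈ α × 0ℚ ℚ.< x × l ≤log x) → ∃[ x ] (x ∈ α × ½ ℚ.≤ x × l ≤log x)
        at-least-½ ½∈α (x , x∈α , 0<x , l≤log) =
          x ℚ.⊔ ½ , ⊔-closed {_∈ α} x∈α ½∈α , ℚ.p≤q⊔p x ½ , ≤log-mono ℚ.≤-refl (ℚ.<⇒≤ 0<x) (ℚ.p≤p⊔q x ½) l≤log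
        shift : ∀ {f a} → f ℚ.- δ ℚ.* ½ ℚ.≤ a → f ℚ.+ δ ℚ.* ½ ℚ.≤ a ℚ.+ δ
        shift {f} {a} le = subst (ℚ._≤ a ℚ.+ δ) (lem f δ) (ℚ.+-monoˡ-≤ δ le)
          where
          lem : ∀ f d → f ℚ.- d ℚ.* ½ ℚ.+ d ≡ f ℚ.+ d ℚ.* ½
          lem = solve-∀ ringℚ

    lower-bound : ∀ {δ} → 0ℚ ℚ.< δ → Goal δ
    lower-bound {δ} 0<δ = cases (em {∃[ n ] Admissible p n})
      where
      cases : Dec (∃[ n ] Admissible p n) → Goal δ
      -- Without an admissible n the proportions may be irrational, but then the claim is vacuous.
      cases (no none) = 0 , λ n _ adm → contradiction (n , adm) none
      cases (yes (suc n , _ , pn)) = rational-case {λ i → proj₁ (P i)} {λ i → proj₁ (Q i)} (λ i → proj₂ (P i)) 0<P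
        (λ i → proj₁ (proj₂ (Q i))) (λ i → proj₂ (proj₂ (Q i))) 0<δ
        where
        P : ∀ i → ∃[ P ] p i ≃ fromℚ P
        P i = rational {p i} {n} {proj₁ (pn i)} (proj₂ (pn i))
        0<P : ∀ i → 0ℚ ℚ.< proj₁ (P i)
        0<P i = let q , q∈p , q≮0 = 0<p i in ℚ.≤-<-trans (ℚ.≮⇒≥ q≮0) (proj₁ (proj₂ (P i)) q q∈p)
        Q : ∀ i → ∃[ Q ] (0ℚ ℚ.< Q × proj₁ (P i) ℚ.* Q ≡ 1ℚ)
        Q i = inv (0<P i)

theorem2 : (em : ExcludedMiddle 0ℓ) → let open Classical em in
    (b : ℕ) → 1 ℕ.≤ b →
    (p : Fin b → ℝ) → (∀ i → 0ℝ < p i) → ∑ p ≃ 1ℝ →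
    (ε⁺ ε* ε⁻ : ℝ) → 0ℝ < ε⁺ → 0ℝ ≤ ε* → 0ℝ ≤ ε⁻ →
    ε⁺ ⊔ ε* ⊔ ε⁻ < fromℚ (+ 1 / 8) →
    (u m : ℕ → ℕ) →
    (∀ n → Admissible p n → 1 ℕ.≤ u n) →
    Vanishes (Admissible p) (λ n → fromℚ (n ÷ u n)) →
    (∀ n → Admissible p n →
    Σ[ D ∈ DataStructure (m n) (u n) b ] EncodesAll ε⁺ ε* ε⁻ D p n) →
    (λ n → fromℚ (m n ÷ n)) ≥
    (1ℝ - ε⁻) * log (ε⁺ ⁻¹)
    + (1ℝ - ε⁻ - ε*) * H p
    - H (ε⁻ ∷ ε* ∷ (1ℝ - ε⁻ - ε*) ∷ [])
    +o[1]along Admissible p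
theorem2 em b _ p 0<p ∑p≃1 ε⁺ ε* ε⁻ 0<ε⁺ 0≤ε* 0≤ε⁻ (q , q<⅛ , q∉) u m 1≤u vanishes structures =
  (λ n → min0 (fromℚ (m n ÷ n) - c)) ,
  (λ δ 0<δ → let N , large = lower-bound p 0<p ∑p≃1 0<ε⁺ 0≤ε* 0≤ε⁻
                   (λ ∈ε → q∉ (inj₁ (inj₁ (ℝ.closed ε⁺ q<⅛ ∈ε)))) (λ ∈ε → q∉ (inj₁ (inj₂ (ℝ.closed ε* q<⅛ ∈ε)))) (λ ∈ε → q∉ (inj₂ (ℝ.closed ε⁻ q<⅛ ∈ε)))
                   u m 1≤u vanishes structures 0<δ
             in N , λ n N≤n adm → -δ≤min0 {m n ÷ n} {c} 0<δ (large n N≤n adm) , min0≤δ {fromℚ (m n ÷ n) - c} 0<δ) ,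
  λ n _ → c+min0≤a (fromℚ (m n ÷ n)) c
  where
  open LowerBound em
  c = bound p ε⁺ ε* ε⁻
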